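{- For all terms $t,t'$ of the call-by-value $\lambda\mu^{\wedge\vee}$-calculus, if $t\succ t'$ then $t'\succ t^*$.
   Context: Terms: $\mathcal{T} ::= x \mid \lambda x.\mathcal{T} \mid (\mathcal{T}\ \mathcal{E}) \mid \langle \mathcal{T},\mathcal{T}\rangle \mid \omega_1\mathcal{T} \mid \omega_2 \mathcal{T} \mid \mu a.\mathcal{T} \mid (a\ \mathcal{T})$; $\mathcal{E}$-terms: $\mathcal{E} ::= \mathcal{T} \mid \pi_1 \mid \pi_2 \mid [x.\mathcal{T}, y.\mathcal{T}]$ ($x,y$ $\lambda$-variables, $a$ $\mu$-variables). Values: $V ::= x \mid \lambda x.\mathcal{T} \mid \langle V, V\rangle \mid \omega_1 V \mid \omega_2 V \mid (a\ \mathcal{T})$. Segment structure: in a term $t$, $(u\ [x_1.u_1,x_2.u_2])$ has segment-successors $u_1,u_2$, and $\mu a.u$ has as segment-successors every $v$ occurring in $u$ in the form $(a\ v)$ (that $a$ bound by this $\mu a$); $\sqsupseteq_t$ is the reflexive–transitive closure. A $\vee_e$-term has the form $(s\ [x.u,y.v])$, a $\bot_e$-term the form $\mu a.s$. If $r$ is a subterm of $t$ which is a $\vee_e$- or $\bot_e$-term with no segment-predecessor in $t$, a segment-tree from $r$ in $t$ is a set $\mathcal{O}$ of subterms $w$ of $t$ with $r\sqsupseteq_t w$, each $w$ a $\vee_e$- or $\bot_e$-term, such that $r\sqsupseteq_t s\sqsupseteq_t w$, $w\in\mathcal{O}$ imply $s\in\mathcal{O}$. An acceptor of $\mathcal{O}$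 is a segment-successor of an element of $\mathcal{O}$ not in $\mathcal{O}$. $\mathcal{O}$ is maximal if no acceptor of $\mathcal{O}$ has a segment-successor in $t$. If $\mathcal{O}$ is a segment-tree from $t$ in $t$ and $t'$ is a reduct of $t$, $\mathcal{O}$ also denotes the corresponding segment-tree in $t'$ obtained by carrying the marks on acceptors to their residuals. For $r$ occurring as $(V\ r)$ (resp. $(r\ \varepsilon)$), $(V\ r)\succ_{\mathcal{O}} w$ (resp. $(r\ \varepsilon)\succ_{\mathcal{O}}w$) means $w$ is obtained from $r$ by replacing every acceptor $v$ of $\mathcal{O}$ by $(V\ v)$ (resp. $(v\ \varepsilon)$). Parallel reduction $\succ$: $x\succ x$; if $t\succ t'$ then $\lambda x.t\succ\lambda x.t'$, $\mu a.t\succ\mu a.t'$, $(a\ t)\succ(a\ t')$, $\omega_i t\succ\omega_i t'$; if $t\succ t'$, $u\succ u'$ then $\langle t,u\rangle\succ\langle t',u'\rangle$; if $t\succ t'$, $\varepsilon\tilde\succ\varepsilon'$ then $(t\ \varepsilon)\succ(t'\ \varepsilon')$; if $t\succ t'$, $V\succ V'$ then $(\lambda x.t\ V)\succ t'[x:=V']$; if $V_i\succ V_i'$ then $(\langle V_1,V_2\rangle\ \pi_i)\succ V_i'$; if $V\succ V'$, $u_i\succ u_i'$ then $(\omega_i V\ [x_1.u_1,x_2.u_2])\succ u_i'[x_i:=V']$; if $t\succ t'$, $V\succ V'$ (resp. $\varepsilon\tilde\succ\varepsilon'$), $\mathcal{O}$ is a segment-tree from $t$ in $t$ and $(V'\ t')\succ_{\mathcal{O}}w$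 (resp. $(t'\ \varepsilon')\succ_{\mathcal{O}}w$) then $(V\ t)\succ w$ (resp. $(t\ \varepsilon)\succ w$). Here $\varepsilon\tilde\succ\varepsilon'$ means $\varepsilon=\varepsilon'=\pi_i$, or $\varepsilon=u,\varepsilon'=u'$ with $u\succ u'$, or $\varepsilon=[x.u,y.v],\varepsilon'=[x.u',y.v']$ with $u\succ u'$, $v\succ v'$. Complete development $t^*$: $x^*=x$; $(\lambda x.t)^*=\lambda x.t^*$; $(\mu a.t)^*=\mu a.t^*$; $\langle t_1,t_2\rangle^*=\langle t_1^*,t_2^*\rangle$; $(\omega_i t)^*=\omega_i t^*$; $(a\ t)^*=(a\ t^*)$; $(\lambda x.t\ V)^*=t^*[x:=V^*]$; $(\langle V_1,V_2\rangle\ \pi_i)^*=V_i^*$; $(\omega_iV\ [x_1.u_1,x_2.u_2])^*=u_i^*[x_i:=V^*]$; if $t$ is a $\vee_e$- or $\bot_e$-term and $\mathcal{O}_m$ is the maximal segment-tree from $t$ in $t$, then $(V\ t)^*=w$ where $(V^*\ t^*)\succ_{\mathcal{O}_m} w$, and $(t\ \varepsilon)^*=w$ where $(t^*\ \tilde{\varepsilon}^*)\succ_{\mathcal{O}_m}w$, with $\tilde\varepsilon^*=\pi_i$ if $\varepsilon=\pi_i$, $u^*$ if $\varepsilon=u$, $[x.u^*,y.v^*]$ if $\varepsilon=[x.u,y.v]$; otherwise $(t\ \varepsilon)^*=(t^*\ \tilde\varepsilon^*)$. -}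

module Defs where

open import Data.Nat using (ℕ; zero; suc; _+_; _⊔_; _≤_; _≟_)
open import Data.Bool using (Bool; true; false; if_then_else_; _∧_)
open import Relation.Nullary using (yes; no)
open import Relation.Binary.PropositionalEquality using (_≡_)

-- Two separate sorts of variables: λ-variables (x, y) and μ-variables (a).
-- λ x.t and the branches of [x.u , y.v] bind λ-variable 0;  μ a.t binds
-- μ-variable 0.
--
-- The extra constructor  mark k t  is NOT part of the paper's syntax: it
-- implements the paper's "marks on acceptors" that are carried to residuals
-- in the segment rule of parallel reduction (and in the complete
-- development).  Marks carry a label k so that nested uses of the segment
-- rule do not interfere.  Terms of the paper are exactly the terms with no
-- marks, i.e. those with  bound t ≡ 0  (see below).

data Ix : Set where
  ι₁ ι₂ : Ix

sel : {A : Set} → Ix → A → A → A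
sel ι₁ a b = a
sel ι₂ a b = b

data Tm : Set
data El : Set

data Tm where
  var  : ℕ → Tm
  lam  : Tm → Tm
  app  : Tm → El → Tm
  pair : Tm → Tm → Tm
  inj  : Ix → Tm → Tm
  mu   : Tm → Tm
  thr  : ℕ → Tm → Tm         -- (a t)
  mark : ℕ → Tm → Tm

data El where
  tm   : Tm → El
  proj : Ix → El
  case : Tm → Tm → El

data Value : Tm → Set where
  var  : ∀ {x} → Value (var x)
  lam  : ∀ {t} → Value (lam t)
  pair : ∀ {v w} → Value v → Value w → Value (pair v w)
  inj  : ∀ {i v} → Value v → Value (inj i v)
  thr  : ∀ {a t} → Value (thr a t)

isValue : Tm → Bool
isValue (var x) = true
isValue (lam t) = true
isValue (pair v w) = isValue v ∧ isValue w
isValue (inj i v) = isValue v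
isValue (thr a t) = true
isValue _ = false

isSeg : Tm → Bool
isSeg (app s (case u v)) = true
isSeg (mu s) = true
isSeg _ = false

extρ : (ℕ → ℕ) → ℕ → ℕ
extρ ρ zero = zero
extρ ρ (suc n) = suc (ρ n)

renλ : (ℕ → ℕ) → Tm → Tm
renλE : (ℕ → ℕ) → El → El
renλ ρ (var x) = var (ρ x)
renλ ρ (lam t) = lam (renλ (extρ ρ) t)
renλ ρ (app t e) = app (renλ ρ t) (renλE ρ e)
renλ ρ (pair t u) = pair (renλ ρ t) (renλ ρ u)
renλ ρ (inj i t) = inj i (renλ ρ t)
renλ ρ (mu t) = mu (renλ ρ t)
renλ ρ (thr a t) = thr a (renλ ρ t)
renλ ρ (mark j t) = mark j (renλ ρ t)
renλE ρ (tm t) = tm (renλ ρ t)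
renλE ρ (proj i) = proj i
renλE ρ (case u v) = case (renλ (extρ ρ) u) (renλ (extρ ρ) v)

renμ : (ℕ → ℕ) → Tm → Tm
renμE : (ℕ → ℕ) → El → El
renμ ρ (var x) = var x
renμ ρ (lam t) = lam (renμ ρ t)
renμ ρ (app t e) = app (renμ ρ t) (renμE ρ e)
renμ ρ (pair t u) = pair (renμ ρ t) (renμ ρ u)
renμ ρ (inj i t) = inj i (renμ ρ t)
renμ ρ (mu t) = mu (renμ (extρ ρ) t)
renμ ρ (thr a t) = thr (ρ a) (renμ ρ t)
renμ ρ (mark j t) = mark j (renμ ρ t)
renμE ρ (tm t) = tm (renμ ρ t)
renμE ρ (proj i) = proj i
renμE ρ (case u v) = case (renμ ρ u) (renμ ρ v)

extσ : (ℕ → Tm) → ℕ → Tm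
extσ σ zero = var zero
extσ σ (suc n) = renλ suc (σ n)

subλ : (ℕ → Tm) → Tm → Tm
subλE : (ℕ → Tm) → El → El
subλ σ (var x) = σ x
subλ σ (lam t) = lam (subλ (extσ σ) t)
subλ σ (app t e) = app (subλ σ t) (subλE σ e)
subλ σ (pair t u) = pair (subλ σ t) (subλ σ u)
subλ σ (inj i t) = inj i (subλ σ t)
subλ σ (mu t) = mu (subλ (λ n → renμ suc (σ n)) t)
subλ σ (thr a t) = thr a (subλ σ t)
subλ σ (mark j t) = mark j (subλ σ t)
subλE σ (tm t) = tm (subλ σ t)
subλE σ (proj i) = proj i
subλE σ (case u v) = case (subλ (extσ σ) u) (subλ (extσ σ) v)

σ₀ : Tm → ℕ → Tm
σ₀ V zero = V
σ₀ V (suc n) = var n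

-- t [ V ]  is  t[x:=V]  where x is the λ-variable 0 bound just outside t
_[_] : Tm → Tm → Tm
t [ V ] = subλ (σ₀ V) t

-- Labels of marks.  bound t is strictly above every mark label in t
-- (and is 0 iff t contains no mark, i.e. t is a term of the paper).

bound : Tm → ℕ
boundE : El → ℕ
bound (var x) = 0
bound (lam t) = bound t
bound (app t e) = bound t ⊔ boundE e
bound (pair t u) = bound t ⊔ bound u
bound (inj i t) = bound t
bound (mu t) = bound t
bound (thr a t) = bound t
bound (mark j t) = suc j ⊔ bound t
boundE (tm t) = bound t
boundE (proj i) = 0
boundE (case u v) = bound u ⊔ bound v

-- Segment-trees, represented by marking their acceptors with label k.
--
-- S : ℕ → Bool records which μ-variables (by index) are bound by a
-- ⊥e-element of the tree O under construction; an occurrence (a v) with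
-- S a ≡ true makes v a segment-successor of an element of O.

_∷ᵇ_ : Bool → (ℕ → Bool) → ℕ → Bool
(b ∷ᵇ S) zero = b
(b ∷ᵇ S) (suc n) = S n

noneᵇ : ℕ → Bool
noneᵇ _ = false

-- MkT k S t t̂  : t̂ is t with every acceptor (of the tree encoded by the
-- derivation) marked by k; the current position is not a segment-successor
-- of an element of O.
-- MkSucc : the current position is a segment-successor of an element of O;
--   it is either itself an element of O, or an acceptor (then marked).
-- MkElem : the current position is an element of O (a ∨e- or ⊥e-term).
data MkT (k : ℕ) : (ℕ → Bool) → Tm → Tm → Set
data MkE (k : ℕ) : (ℕ → Bool) → El → El → Set
data MkSucc (k : ℕ) : (ℕ → Bool) → Tm → Tm → Set
data MkElem (k : ℕ) : (ℕ → Bool) → Tm → Tm → Set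

data MkT k where
  var  : ∀ {S x} → MkT k S (var x) (var x)
  lam  : ∀ {S t t̂} → MkT k S t t̂ → MkT k S (lam t) (lam t̂)
  app  : ∀ {S t t̂ e ê} → MkT k S t t̂ → MkE k S e ê → MkT k S (app t e) (app t̂ ê)
  pair : ∀ {S t t̂ u û} → MkT k S t t̂ → MkT k S u û → MkT k S (pair t u) (pair t̂ û)
  inj  : ∀ {S i t t̂} → MkT k S t t̂ → MkT k S (inj i t) (inj i t̂)
  mu   : ∀ {S t t̂} → MkT k (false ∷ᵇ S) t t̂ → MkT k S (mu t) (mu t̂)
  thrO : ∀ {S a t t̂} → S a ≡ false → MkT k S t t̂ → MkT k S (thr a t) (thr a t̂)
  thrI : ∀ {S a t t̂} → S a ≡ true → MkSucc k S t t̂ → MkT k S (thr a t) (thr a t̂)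
  mark : ∀ {S j t t̂} → MkT k S t t̂ → MkT k S (mark j t) (mark j t̂)

data MkE k where
  tm   : ∀ {S t t̂} → MkT k S t t̂ → MkE k S (tm t) (tm t̂)
  proj : ∀ {S i} → MkE k S (proj i) (proj i)
  case : ∀ {S u û v v̂} → MkT k S u û → MkT k S v v̂ → MkE k S (case u v) (case û v̂)

data MkSucc k where
  elem : ∀ {S t t̂} → MkElem k S t t̂ → MkSucc k S t t̂
  acc  : ∀ {S t t̂} → MkT k S t t̂ → MkSucc k S t (mark k t̂)

data MkElem k where
  ∨e : ∀ {S s ŝ u û v v̂} → MkT k S s ŝ → MkSucc k S u û → MkSucc k S v v̂ →
       MkElem k S (app s (case u v)) (app ŝ (case û v̂))
  ⊥e : ∀ {S s ŝ} → MkT k (true ∷ᵇ S) s ŝ → MkElem k S (mu s) (mu ŝ)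

SegTree : ℕ → Tm → Tm → Set
SegTree k t t̂ = MkElem k noneᵇ t t̂

-- The maximal segment-tree from t in t (every segment-successor of an element
-- which is a ∨e- or ⊥e-term is included), acceptors marked by k.
mmT : ℕ → (ℕ → Bool) → Tm → Tm
mmE : ℕ → (ℕ → Bool) → El → El
mmSucc : ℕ → (ℕ → Bool) → Tm → Tm
mmT k S (var x) = var x
mmT k S (lam t) = lam (mmT k S t)
mmT k S (app t e) = app (mmT k S t) (mmE k S e)
mmT k S (pair t u) = pair (mmT k S t) (mmT k S u)
mmT k S (inj i t) = inj i (mmT k S t)
mmT k S (mu t) = mu (mmT k (false ∷ᵇ S) t)
mmT k S (thr a t) = if S a then thr a (mmSucc k S t) else thr a (mmT k S t)
mmT k S (mark j t) = mark j (mmT k S t)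
mmE k S (tm t) = tm (mmT k S t)
mmE k S (proj i) = proj i
mmE k S (case u v) = case (mmT k S u) (mmT k S v)
mmSucc k S (app s (case u v)) = app (mmT k S s) (case (mmSucc k S u) (mmSucc k S v))
mmSucc k S (mu s) = mu (mmT k (true ∷ᵇ S) s)
mmSucc k S t = mark k (mmT k S t)

maxSegTree : ℕ → Tm → Tm
maxSegTree k (app s (case u v)) = app (mmT k noneᵇ s) (case (mmSucc k noneᵇ u) (mmSucc k noneᵇ v))
maxSegTree k (mu s) = mu (mmT k (true ∷ᵇ noneᵇ) s)
maxSegTree k t = t

-- Filling: replace every k-marked subterm v by (V v), resp. (v ε).

data Wrap : Set where
  wl : Tm → Wrap
  wr : El → Wrap

wλ : Wrap → Wrap
wλ (wl V) = wl (renλ suc V)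
wλ (wr e) = wr (renλE suc e)

wμ : Wrap → Wrap
wμ (wl V) = wl (renμ suc V)
wμ (wr e) = wr (renμE suc e)

applyW : Wrap → Tm → Tm
applyW (wl V) v = app V (tm v)
applyW (wr e) v = app v e

fill : ℕ → Wrap → Tm → Tm
fillE : ℕ → Wrap → El → El
fill k w (var x) = var x
fill k w (lam t) = lam (fill k (wλ w) t)
fill k w (app t e) = app (fill k w t) (fillE k w e)
fill k w (pair t u) = pair (fill k w t) (fill k w u)
fill k w (inj i t) = inj i (fill k w t)
fill k w (mu t) = mu (fill k (wμ w) t)
fill k w (thr a t) = thr a (fill k w t)
fill k w (mark j t) with j ≟ k
... | yes _ = applyW w (fill k w t)
... | no _ = mark j (fill k w t)
fillE k w (tm t) = tm (fill k w t)
fillE k w (proj i) = proj i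
fillE k w (case u v) = case (fill k (wλ w) u) (fill k (wλ w) v)

-- Parallel reduction  t ≻ t'  and  ε ~≻ ε'.
-- Marks are transparent (rule mark); the segment rules mark the acceptors
-- of a segment-tree O with a fresh label k, reduce, and then fill.

infix 4 _≻_ _≻ₑ_

data _≻_ : Tm → Tm → Set
data _≻ₑ_ : El → El → Set

data _≻_ where
  var  : ∀ {x} → var x ≻ var x
  lam  : ∀ {t t'} → t ≻ t' → lam t ≻ lam t'
  mu   : ∀ {t t'} → t ≻ t' → mu t ≻ mu t'
  thr  : ∀ {a t t'} → t ≻ t' → thr a t ≻ thr a t'
  inj  : ∀ {i t t'} → t ≻ t' → inj i t ≻ inj i t'
  mark : ∀ {j t t'} → t ≻ t' → mark j t ≻ mark j t'
  pair : ∀ {t t' u u'} → t ≻ t' → u ≻ u' → pair t u ≻ pair t' u'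
  app  : ∀ {t t' e e'} → t ≻ t' → e ≻ₑ e' → app t e ≻ app t' e'
  β    : ∀ {t t' V V'} → Value V → t ≻ t' → V ≻ V' →
         app (lam t) (tm V) ≻ t' [ V' ]
  π    : ∀ {i V₁ V₂ V'} → Value V₁ → Value V₂ → sel i V₁ V₂ ≻ V' →
         app (pair V₁ V₂) (proj i) ≻ V'
  ω    : ∀ {i V V' u₁ u₂ u'} → Value V → V ≻ V' → sel i u₁ u₂ ≻ u' →
         app (inj i V) (case u₁ u₂) ≻ u' [ V' ]
  segV : ∀ {V V' t t̂ t̂' k} → Value V → V ≻ V' →
         bound t ≤ k → SegTree k t t̂ → t̂ ≻ t̂' →
         app V (tm t) ≻ fill k (wl V') t̂'
  segE : ∀ {e e' t t̂ t̂' k} → e ≻ₑ e' →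
         bound t ≤ k → SegTree k t t̂ → t̂ ≻ t̂' →
         app t e ≻ fill k (wr e') t̂'

data _≻ₑ_ where
  tm   : ∀ {t t'} → t ≻ t' → tm t ≻ₑ tm t'
  proj : ∀ {i} → proj i ≻ₑ proj i
  case : ∀ {u u' v v'} → u ≻ u' → v ≻ v' → case u v ≻ₑ case u' v'

-- Defined with a fuel argument; star t uses fuel
-- size t, which is always sufficient (size ignores marks, and every
-- recursive call is on a term of strictly smaller size, except for marks
-- which keep the fuel), so the clause  dev zero t = t  is never reached.

size : Tm → ℕ
sizeE : El → ℕ
size (var x) = 1
size (lam t) = suc (size t)
size (app t e) = suc (size t + sizeE e)
size (pair t u) = suc (size t + size u)
size (inj i t) = suc (size t)
size (mu t) = suc (size t)
size (thr a t) = suc (size t)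
size (mark j t) = size t
sizeE (tm t) = suc (size t)
sizeE (proj i) = 1
sizeE (case u v) = suc (size u + size v)

dev : ℕ → Tm → Tm
devE : ℕ → El → El
devApp : ℕ → Tm → El → Tm
devDef : ℕ → Tm → El → Tm
devSegV : ℕ → Tm → Tm → Tm
devSegE : ℕ → Tm → El → Tm

dev zero t = t
dev (suc n) (var x) = var x
dev (suc n) (lam t) = lam (dev n t)
dev (suc n) (app t e) = devApp n t e
dev (suc n) (pair t u) = pair (dev n t) (dev n u)
dev (suc n) (inj i t) = inj i (dev n t)
dev (suc n) (mu t) = mu (dev n t)
dev (suc n) (thr a t) = thr a (dev n t)
dev (suc n) (mark j t) = mark j (dev (suc n) t)

devE n (tm t) = tm (dev n t)
devE n (proj i) = proj i
devE n (case u v) = case (dev n u) (dev n v)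

devApp n (lam b) (tm V) with isValue V
... | true = dev n b [ dev n V ]
... | false = devDef n (lam b) (tm V)
devApp n (pair V₁ V₂) (proj i) with isValue V₁ ∧ isValue V₂
... | true = dev n (sel i V₁ V₂)
... | false = devDef n (pair V₁ V₂) (proj i)
devApp n (inj i V) (case u₁ u₂) with isValue V
... | true = dev n (sel i u₁ u₂) [ dev n V ]
... | false = devDef n (inj i V) (case u₁ u₂)
devApp n t e = devDef n t e

devDef n V (tm t) with isValue V ∧ isSeg t
... | true = devSegV n V t
... | false = devSegE n V (tm t)
devDef n t e = devSegE n t e

devSegV n V t = fill k (wl (dev n V)) (dev n (maxSegTree k t))
  where k = bound t

devSegE n t e with isSeg t
... | true = fill (bound t) (wr (devE n e)) (dev n (maxSegTree (bound t) t))
... | false = app (dev n t) (devE n e)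

star : Tm → Tm
star t = dev (size t) t

-- In ≻ the segment rule marks the acceptors of a segment-tree with a fresh label,
-- reduces, and fills the marks afterwards, so a derivation juggles the labels of
-- nested segment rules.  We therefore work with a label-free relation Par Γ, in
-- which the pending wrapper (V _) or (_ ε) of a tree is recorded in an
-- environment Γ at the μ-variables bound by its ⊥e-elements, and with the
-- matching label-free development develop, which follows maximal segment-trees.
-- The triangle property (Par ∅ t t' implies Par ∅ t' (develop ∅ t)) is a single
-- induction on Par: every segment-tree used by the reduction lies inside the maximal one
-- used by the development, so the reduct can still be reduced along the maximal
-- tree, with the acceptors the reduction has already wrapped sitting inside it.
-- On mark-free terms ≻ and Par coincide (fill in the labels of a ≻-derivation;
-- conversely pick labels above all labels in use), and star t = develop ∅ t.

module Submission where

open import Defs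
open import Data.Nat using (ℕ; zero; suc; _+_; _⊔_; _≤_; _<_; _≟_; z≤n; s≤s; s≤s⁻¹)
open import Data.Nat.Properties using (⊔-lub; m⊔n≤o⇒m≤o; m⊔n≤o⇒n≤o; ≤-trans; <⇒≢; m<n⇒m<1+n; ≤-refl; n<1+n; <⇒≤; m+n≤o⇒m≤o; m+n≤o⇒n≤o)
open import Data.Bool using (Bool; true; false; if_then_else_; _∧_)
open import Data.Bool.Properties using (∧-conicalˡ; ∧-conicalʳ)
open import Data.Maybe using (Maybe; just; nothing)
open import Relation.Binary.PropositionalEquality hiding ([_])
open import Relation.Nullary using (yes; no)
open import Data.Product using (Σ; _×_; _,_)
open import Data.Sum using (_⊎_; inj₁; inj₂)
open import Data.Empty using (⊥; ⊥-elim)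
open import Data.Unit using (⊤; tt)
open import Function using (_∘_)

extρ-cong : ∀ {ρ ρ' : ℕ → ℕ} → (∀ x → ρ x ≡ ρ' x) → ∀ x → extρ ρ x ≡ extρ ρ' x
extρ-cong h zero = refl
extρ-cong h (suc x) = cong suc (h x)

renλ-cong : ∀ {ρ ρ'} → (∀ x → ρ x ≡ ρ' x) → ∀ t → renλ ρ t ≡ renλ ρ' t
renλE-cong : ∀ {ρ ρ'} → (∀ x → ρ x ≡ ρ' x) → ∀ e → renλE ρ e ≡ renλE ρ' e
renλ-cong h (var x) = cong var (h x)
renλ-cong h (lam t) = cong lam (renλ-cong (extρ-cong h) t)
renλ-cong h (app t e) = cong₂ app (renλ-cong h t) (renλE-cong h e)
renλ-cong h (pair t u) = cong₂ pair (renλ-cong h t) (renλ-cong h u)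
renλ-cong h (inj i t) = cong (inj i) (renλ-cong h t)
renλ-cong h (mu t) = cong mu (renλ-cong h t)
renλ-cong h (thr a t) = cong (thr a) (renλ-cong h t)
renλ-cong h (mark j t) = cong (mark j) (renλ-cong h t)
renλE-cong h (tm t) = cong tm (renλ-cong h t)
renλE-cong h (proj i) = refl
renλE-cong h (case u v) = cong₂ case (renλ-cong (extρ-cong h) u) (renλ-cong (extρ-cong h) v)

renμ-cong : ∀ {ρ ρ'} → (∀ x → ρ x ≡ ρ' x) → ∀ t → renμ ρ t ≡ renμ ρ' t
renμE-cong : ∀ {ρ ρ'} → (∀ x → ρ x ≡ ρ' x) → ∀ e → renμE ρ e ≡ renμE ρ' e
renμ-cong h (var x) = refl
renμ-cong h (lam t) = cong lam (renμ-cong h t)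
renμ-cong h (app t e) = cong₂ app (renμ-cong h t) (renμE-cong h e)
renμ-cong h (pair t u) = cong₂ pair (renμ-cong h t) (renμ-cong h u)
renμ-cong h (inj i t) = cong (inj i) (renμ-cong h t)
renμ-cong h (mu t) = cong mu (renμ-cong (extρ-cong h) t)
renμ-cong h (thr a t) = cong₂ thr (h a) (renμ-cong h t)
renμ-cong h (mark j t) = cong (mark j) (renμ-cong h t)
renμE-cong h (tm t) = cong tm (renμ-cong h t)
renμE-cong h (proj i) = refl
renμE-cong h (case u v) = cong₂ case (renμ-cong h u) (renμ-cong h v)

extσ-cong : ∀ {σ σ' : ℕ → Tm} → (∀ x → σ x ≡ σ' x) → ∀ x → extσ σ x ≡ extσ σ' x
extσ-cong h zero = refl
extσ-cong h (suc x) = cong (renλ suc) (h x)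

subλ-cong : ∀ {σ σ'} → (∀ x → σ x ≡ σ' x) → ∀ t → subλ σ t ≡ subλ σ' t
subλE-cong : ∀ {σ σ'} → (∀ x → σ x ≡ σ' x) → ∀ e → subλE σ e ≡ subλE σ' e
subλ-cong h (var x) = h x
subλ-cong h (lam t) = cong lam (subλ-cong (extσ-cong h) t)
subλ-cong h (app t e) = cong₂ app (subλ-cong h t) (subλE-cong h e)
subλ-cong h (pair t u) = cong₂ pair (subλ-cong h t) (subλ-cong h u)
subλ-cong h (inj i t) = cong (inj i) (subλ-cong h t)
subλ-cong h (mu t) = cong mu (subλ-cong (λ n → cong (renμ suc) (h n)) t)
subλ-cong h (thr a t) = cong (thr a) (subλ-cong h t)
subλ-cong h (mark j t) = cong (mark j) (subλ-cong h t)
subλE-cong h (tm t) = cong tm (subλ-cong h t)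
subλE-cong h (proj i) = refl
subλE-cong h (case u v) = cong₂ case (subλ-cong (extσ-cong h) u) (subλ-cong (extσ-cong h) v)

renλ-fuse : ∀ ρ ρ' t → renλ ρ (renλ ρ' t) ≡ renλ (ρ ∘ ρ') t
renλE-fuse : ∀ ρ ρ' e → renλE ρ (renλE ρ' e) ≡ renλE (ρ ∘ ρ') e
extρ-fuse : ∀ ρ ρ' x → extρ ρ (extρ ρ' x) ≡ extρ (ρ ∘ ρ') x
extρ-fuse ρ ρ' zero = refl
extρ-fuse ρ ρ' (suc x) = refl
renλ-fuse ρ ρ' (var x) = refl
renλ-fuse ρ ρ' (lam t) = cong lam (trans (renλ-fuse _ _ t) (renλ-cong (extρ-fuse ρ ρ') t))
renλ-fuse ρ ρ' (app t e) = cong₂ app (renλ-fuse ρ ρ' t) (renλE-fuse ρ ρ' e)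
renλ-fuse ρ ρ' (pair t u) = cong₂ pair (renλ-fuse ρ ρ' t) (renλ-fuse ρ ρ' u)
renλ-fuse ρ ρ' (inj i t) = cong (inj i) (renλ-fuse ρ ρ' t)
renλ-fuse ρ ρ' (mu t) = cong mu (renλ-fuse ρ ρ' t)
renλ-fuse ρ ρ' (thr a t) = cong (thr a) (renλ-fuse ρ ρ' t)
renλ-fuse ρ ρ' (mark j t) = cong (mark j) (renλ-fuse ρ ρ' t)
renλE-fuse ρ ρ' (tm t) = cong tm (renλ-fuse ρ ρ' t)
renλE-fuse ρ ρ' (proj i) = refl
renλE-fuse ρ ρ' (case u v) = cong₂ case (trans (renλ-fuse _ _ u) (renλ-cong (extρ-fuse ρ ρ') u))
  (trans (renλ-fuse _ _ v) (renλ-cong (extρ-fuse ρ ρ') v))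

renμ-fuse : ∀ ρ ρ' t → renμ ρ (renμ ρ' t) ≡ renμ (ρ ∘ ρ') t
renμE-fuse : ∀ ρ ρ' e → renμE ρ (renμE ρ' e) ≡ renμE (ρ ∘ ρ') e
renμ-fuse ρ ρ' (var x) = refl
renμ-fuse ρ ρ' (lam t) = cong lam (renμ-fuse ρ ρ' t)
renμ-fuse ρ ρ' (app t e) = cong₂ app (renμ-fuse ρ ρ' t) (renμE-fuse ρ ρ' e)
renμ-fuse ρ ρ' (pair t u) = cong₂ pair (renμ-fuse ρ ρ' t) (renμ-fuse ρ ρ' u)
renμ-fuse ρ ρ' (inj i t) = cong (inj i) (renμ-fuse ρ ρ' t)
renμ-fuse ρ ρ' (mu t) = cong mu (trans (renμ-fuse _ _ t) (renμ-cong (extρ-fuse ρ ρ') t))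
renμ-fuse ρ ρ' (thr a t) = cong (thr (ρ (ρ' a))) (renμ-fuse ρ ρ' t)
renμ-fuse ρ ρ' (mark j t) = cong (mark j) (renμ-fuse ρ ρ' t)
renμE-fuse ρ ρ' (tm t) = cong tm (renμ-fuse ρ ρ' t)
renμE-fuse ρ ρ' (proj i) = refl
renμE-fuse ρ ρ' (case u v) = cong₂ case (renμ-fuse ρ ρ' u) (renμ-fuse ρ ρ' v)

renλ-renμ : ∀ ρ ρ' t → renλ ρ (renμ ρ' t) ≡ renμ ρ' (renλ ρ t)
renλE-renμE : ∀ ρ ρ' e → renλE ρ (renμE ρ' e) ≡ renμE ρ' (renλE ρ e)
renλ-renμ ρ ρ' (var x) = refl
renλ-renμ ρ ρ' (lam t) = cong lam (renλ-renμ _ ρ' t)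
renλ-renμ ρ ρ' (app t e) = cong₂ app (renλ-renμ ρ ρ' t) (renλE-renμE ρ ρ' e)
renλ-renμ ρ ρ' (pair t u) = cong₂ pair (renλ-renμ ρ ρ' t) (renλ-renμ ρ ρ' u)
renλ-renμ ρ ρ' (inj i t) = cong (inj i) (renλ-renμ ρ ρ' t)
renλ-renμ ρ ρ' (mu t) = cong mu (renλ-renμ ρ _ t)
renλ-renμ ρ ρ' (thr a t) = cong (thr (ρ' a)) (renλ-renμ ρ ρ' t)
renλ-renμ ρ ρ' (mark j t) = cong (mark j) (renλ-renμ ρ ρ' t)
renλE-renμE ρ ρ' (tm t) = cong tm (renλ-renμ ρ ρ' t)
renλE-renμE ρ ρ' (proj i) = refl
renλE-renμE ρ ρ' (case u v) = cong₂ case (renλ-renμ _ ρ' u) (renλ-renμ _ ρ' v)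

renλ-sub : ∀ ρ σ t → renλ ρ (subλ σ t) ≡ subλ (renλ ρ ∘ σ) t
renλ-subE : ∀ ρ σ e → renλE ρ (subλE σ e) ≡ subλE (renλ ρ ∘ σ) e
extσ-renλ : ∀ ρ σ x → renλ (extρ ρ) (extσ σ x) ≡ extσ (renλ ρ ∘ σ) x
extσ-renλ ρ σ zero = refl
extσ-renλ ρ σ (suc x) = trans (renλ-fuse _ _ (σ x)) (sym (renλ-fuse _ _ (σ x)))
renλ-sub ρ σ (var x) = refl
renλ-sub ρ σ (lam t) = cong lam (trans (renλ-sub _ _ t) (subλ-cong (extσ-renλ ρ σ) t))
renλ-sub ρ σ (app t e) = cong₂ app (renλ-sub ρ σ t) (renλ-subE ρ σ e)
renλ-sub ρ σ (pair t u) = cong₂ pair (renλ-sub ρ σ t) (renλ-sub ρ σ u)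
renλ-sub ρ σ (inj i t) = cong (inj i) (renλ-sub ρ σ t)
renλ-sub ρ σ (mu t) = cong mu (trans (renλ-sub _ _ t) (subλ-cong (λ n → renλ-renμ ρ suc (σ n)) t))
renλ-sub ρ σ (thr a t) = cong (thr a) (renλ-sub ρ σ t)
renλ-sub ρ σ (mark j t) = cong (mark j) (renλ-sub ρ σ t)
renλ-subE ρ σ (tm t) = cong tm (renλ-sub ρ σ t)
renλ-subE ρ σ (proj i) = refl
renλ-subE ρ σ (case u v) = cong₂ case (trans (renλ-sub _ _ u) (subλ-cong (extσ-renλ ρ σ) u))
  (trans (renλ-sub _ _ v) (subλ-cong (extσ-renλ ρ σ) v))

sub-renλ : ∀ σ ρ t → subλ σ (renλ ρ t) ≡ subλ (σ ∘ ρ) t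
sub-renλE : ∀ σ ρ e → subλE σ (renλE ρ e) ≡ subλE (σ ∘ ρ) e
extσ-extρ : ∀ σ ρ x → extσ σ (extρ ρ x) ≡ extσ (σ ∘ ρ) x
extσ-extρ σ ρ zero = refl
extσ-extρ σ ρ (suc x) = refl
sub-renλ σ ρ (var x) = refl
sub-renλ σ ρ (lam t) = cong lam (trans (sub-renλ _ _ t) (subλ-cong (extσ-extρ σ ρ) t))
sub-renλ σ ρ (app t e) = cong₂ app (sub-renλ σ ρ t) (sub-renλE σ ρ e)
sub-renλ σ ρ (pair t u) = cong₂ pair (sub-renλ σ ρ t) (sub-renλ σ ρ u)
sub-renλ σ ρ (inj i t) = cong (inj i) (sub-renλ σ ρ t)
sub-renλ σ ρ (mu t) = cong mu (sub-renλ _ ρ t)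
sub-renλ σ ρ (thr a t) = cong (thr a) (sub-renλ σ ρ t)
sub-renλ σ ρ (mark j t) = cong (mark j) (sub-renλ σ ρ t)
sub-renλE σ ρ (tm t) = cong tm (sub-renλ σ ρ t)
sub-renλE σ ρ (proj i) = refl
sub-renλE σ ρ (case u v) = cong₂ case (trans (sub-renλ _ _ u) (subλ-cong (extσ-extρ σ ρ) u))
  (trans (sub-renλ _ _ v) (subλ-cong (extσ-extρ σ ρ) v))

renμ-sub : ∀ ρ σ t → renμ ρ (subλ σ t) ≡ subλ (renμ ρ ∘ σ) (renμ ρ t)
renμ-subE : ∀ ρ σ e → renμE ρ (subλE σ e) ≡ subλE (renμ ρ ∘ σ) (renμE ρ e)
extσ-renμ : ∀ ρ σ x → renμ ρ (extσ σ x) ≡ extσ (renμ ρ ∘ σ) x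
extσ-renμ ρ σ zero = refl
extσ-renμ ρ σ (suc x) = sym (renλ-renμ suc ρ (σ x))
renμ-sub ρ σ (var x) = refl
renμ-sub ρ σ (lam t) = cong lam (trans (renμ-sub ρ _ t) (subλ-cong (extσ-renμ ρ σ) (renμ ρ t)))
renμ-sub ρ σ (app t e) = cong₂ app (renμ-sub ρ σ t) (renμ-subE ρ σ e)
renμ-sub ρ σ (pair t u) = cong₂ pair (renμ-sub ρ σ t) (renμ-sub ρ σ u)
renμ-sub ρ σ (inj i t) = cong (inj i) (renμ-sub ρ σ t)
renμ-sub ρ σ (mu t) = cong mu
  (trans (renμ-sub _ _ t) (subλ-cong (λ n → trans (renμ-fuse _ _ (σ n)) (sym (renμ-fuse _ _ (σ n)))) (renμ (extρ ρ) t)))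
renμ-sub ρ σ (thr a t) = cong (thr (ρ a)) (renμ-sub ρ σ t)
renμ-sub ρ σ (mark j t) = cong (mark j) (renμ-sub ρ σ t)
renμ-subE ρ σ (tm t) = cong tm (renμ-sub ρ σ t)
renμ-subE ρ σ (proj i) = refl
renμ-subE ρ σ (case u v) = cong₂ case (trans (renμ-sub ρ _ u) (subλ-cong (extσ-renμ ρ σ) (renμ ρ u)))
  (trans (renμ-sub ρ _ v) (subλ-cong (extσ-renμ ρ σ) (renμ ρ v)))

sub-sub : ∀ σ τ t → subλ σ (subλ τ t) ≡ subλ (subλ σ ∘ τ) t
sub-subE : ∀ σ τ e → subλE σ (subλE τ e) ≡ subλE (subλ σ ∘ τ) e
extσ-sub : ∀ σ τ x → subλ (extσ σ) (extσ τ x) ≡ extσ (subλ σ ∘ τ) x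
extσ-sub σ τ zero = refl
extσ-sub σ τ (suc x) = trans (sub-renλ _ suc (τ x)) (sym (renλ-sub suc σ (τ x)))
sub-sub σ τ (var x) = refl
sub-sub σ τ (lam t) = cong lam (trans (sub-sub _ _ t) (subλ-cong (extσ-sub σ τ) t))
sub-sub σ τ (app t e) = cong₂ app (sub-sub σ τ t) (sub-subE σ τ e)
sub-sub σ τ (pair t u) = cong₂ pair (sub-sub σ τ t) (sub-sub σ τ u)
sub-sub σ τ (inj i t) = cong (inj i) (sub-sub σ τ t)
sub-sub σ τ (mu t) = cong mu (trans (sub-sub _ _ t) (subλ-cong (λ n → sym (renμ-sub suc σ (τ n))) t))
sub-sub σ τ (thr a t) = cong (thr a) (sub-sub σ τ t)
sub-sub σ τ (mark j t) = cong (mark j) (sub-sub σ τ t)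
sub-subE σ τ (tm t) = cong tm (sub-sub σ τ t)
sub-subE σ τ (proj i) = refl
sub-subE σ τ (case u v) = cong₂ case (trans (sub-sub _ _ u) (subλ-cong (extσ-sub σ τ) u))
  (trans (sub-sub _ _ v) (subλ-cong (extσ-sub σ τ) v))

sub-id : ∀ t → subλ var t ≡ t
sub-idE : ∀ e → subλE var e ≡ e
extσ-id : ∀ x → extσ var x ≡ var x
extσ-id zero = refl
extσ-id (suc x) = refl
sub-id (var x) = refl
sub-id (lam t) = cong lam (trans (subλ-cong extσ-id t) (sub-id t))
sub-id (app t e) = cong₂ app (sub-id t) (sub-idE e)
sub-id (pair t u) = cong₂ pair (sub-id t) (sub-id u)
sub-id (inj i t) = cong (inj i) (sub-id t)
sub-id (mu t) = cong mu (sub-id t)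
sub-id (thr a t) = cong (thr a) (sub-id t)
sub-id (mark j t) = cong (mark j) (sub-id t)
sub-idE (tm t) = cong tm (sub-id t)
sub-idE (proj i) = refl
sub-idE (case u v) = cong₂ case (trans (subλ-cong extσ-id u) (sub-id u)) (trans (subλ-cong extσ-id v) (sub-id v))

σ₀-weaken : ∀ V t → (renλ suc t) [ V ] ≡ t
σ₀-weaken V t = trans (sub-renλ (σ₀ V) suc t) (sub-id t)

σ₀-weakenE : ∀ V e → subλE (σ₀ V) (renλE suc e) ≡ e
σ₀-weakenE V e = trans (sub-renλE (σ₀ V) suc e) (sub-idE e)

subλ-[] : ∀ σ t V → subλ σ (t [ V ]) ≡ (subλ (extσ σ) t) [ subλ σ V ]
subλ-[] σ t V = trans (sub-sub σ (σ₀ V) t) (trans (subλ-cong h t) (sym (sub-sub (σ₀ (subλ σ V)) (extσ σ) t)))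
  where
  h : ∀ x → subλ σ (σ₀ V x) ≡ subλ (σ₀ (subλ σ V)) (extσ σ x)
  h zero = refl
  h (suc x) = sym (σ₀-weaken (subλ σ V) (σ x))

renλ-[] : ∀ ρ t V → renλ ρ (t [ V ]) ≡ (renλ (extρ ρ) t) [ renλ ρ V ]
renλ-[] ρ t V = trans (renλ-sub ρ (σ₀ V) t) (trans (subλ-cong h t) (sym (sub-renλ (σ₀ (renλ ρ V)) (extρ ρ) t)))
  where
  h : ∀ x → renλ ρ (σ₀ V x) ≡ σ₀ (renλ ρ V) (extρ ρ x)
  h zero = refl
  h (suc x) = refl

renμ-[] : ∀ ρ t V → renμ ρ (t [ V ]) ≡ (renμ ρ t) [ renμ ρ V ]
renμ-[] ρ t V = trans (renμ-sub ρ (σ₀ V) t) (subλ-cong h (renμ ρ t))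
  where
  h : ∀ x → renμ ρ (σ₀ V x) ≡ σ₀ (renμ ρ V) x
  h zero = refl
  h (suc x) = refl

-- Data.Maybe.map goes through the dependent eliminator maybe, which makes the
-- with-abstractions over environments below far too costly to check.
mmap : {A B : Set} → (A → B) → Maybe A → Maybe B
mmap f nothing = nothing
mmap f (just x) = just (f x)

renWλ : (ℕ → ℕ) → Wrap → Wrap
renWλ ρ (wl V) = wl (renλ ρ V)
renWλ ρ (wr e) = wr (renλE ρ e)

renWμ : (ℕ → ℕ) → Wrap → Wrap
renWμ ρ (wl V) = wl (renμ ρ V)
renWμ ρ (wr e) = wr (renμE ρ e)

subW : (ℕ → Tm) → Wrap → Wrap
subW σ (wl V) = wl (subλ σ V)
subW σ (wr e) = wr (subλE σ e)

Env : Set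
Env = ℕ → Maybe Wrap

∅ : {A : Set} → ℕ → Maybe A
∅ _ = nothing

mapλ : Env → Env
mapλ Γ a = mmap wλ (Γ a)

consμ : Maybe Wrap → Env → Env
consμ e Γ zero = e
consμ e Γ (suc a) = mmap wμ (Γ a)

data SegTerm : Tm → Set where
  ∨ₛ : ∀ {s u v} → SegTerm (app s (case u v))
  ⊥ₛ : ∀ {s} → SegTerm (mu s)

-- Instead of marking acceptors with labels, Γ a ≡ just w records that the
-- μ-variable a is bound by a ⊥e-element of a segment-tree whose acceptors are
-- to be wrapped by w (applyW w); in (a v) the term v is then a segment-successor.
-- ParSeg Γ w t t' : t is a segment-successor of a tree with wrapper w; its rules
-- follow the tree through ∨e- and ⊥e-elements, and acc wraps an acceptor.
data Par (Γ : Env) : Tm → Tm → Set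
data ParE (Γ : Env) : El → El → Set
data ParSeg (Γ : Env) (w : Wrap) : Tm → Tm → Set

data Par Γ where
  var  : ∀ {x} → Par Γ (var x) (var x)
  lam  : ∀ {t t'} → Par (mapλ Γ) t t' → Par Γ (lam t) (lam t')
  mu   : ∀ {t t'} → Par (consμ nothing Γ) t t' → Par Γ (mu t) (mu t')
  thr∉ : ∀ {a t t'} → Γ a ≡ nothing → Par Γ t t' → Par Γ (thr a t) (thr a t')
  thr∈ : ∀ {a w t t'} → Γ a ≡ just w → ParSeg Γ w t t' → Par Γ (thr a t) (thr a t')
  inj  : ∀ {i t t'} → Par Γ t t' → Par Γ (inj i t) (inj i t')
  pair : ∀ {t t' u u'} → Par Γ t t' → Par Γ u u' → Par Γ (pair t u) (pair t' u')
  app  : ∀ {t t' e e'} → Par Γ t t' → ParE Γ e e' → Par Γ (app t e) (app t' e')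
  β    : ∀ {t t' V V'} → Value V → Par (mapλ Γ) t t' → Par Γ V V' →
         Par Γ (app (lam t) (tm V)) (t' [ V' ])
  π    : ∀ {i V₁ V₂ V'} → Value V₁ → Value V₂ → Par Γ (sel i V₁ V₂) V' →
         Par Γ (app (pair V₁ V₂) (proj i)) V'
  ω    : ∀ {i V V' u₁ u₂ u'} → Value V → Par Γ V V' → Par (mapλ Γ) (sel i u₁ u₂) u' →
         Par Γ (app (inj i V) (case u₁ u₂)) (u' [ V' ])
  segV : ∀ {V V' s z} → Value V → Par Γ V V' → SegTerm s → ParSeg Γ (wl V') s z →
         Par Γ (app V (tm s)) z
  segE : ∀ {t e e' z} → ParE Γ e e' → SegTerm t → ParSeg Γ (wr e') t z → Par Γ (app t e) z

data ParE Γ where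
  tm   : ∀ {t t'} → Par Γ t t' → ParE Γ (tm t) (tm t')
  proj : ∀ {i} → ParE Γ (proj i) (proj i)
  case : ∀ {u u' v v'} → Par (mapλ Γ) u u' → Par (mapλ Γ) v v' → ParE Γ (case u v) (case u' v')

data ParSeg Γ w where
  acc  : ∀ {t t'} → Par Γ t t' → ParSeg Γ w t (applyW w t')
  ∨seg : ∀ {s s' u u' v v'} → Par Γ s s' →
         ParSeg (mapλ Γ) (wλ w) u u' → ParSeg (mapλ Γ) (wλ w) v v' →
         ParSeg Γ w (app s (case u v)) (app s' (case u' v'))
  ⊥seg : ∀ {s s'} → Par (consμ (just (wμ w)) Γ) s s' → ParSeg Γ w (mu s) (mu s')
  ωseg : ∀ {i V V' u₁ u₂ u'} → Value V → Par Γ V V' → ParSeg (mapλ Γ) (wλ w) (sel i u₁ u₂) u' →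
         ParSeg Γ w (app (inj i V) (case u₁ u₂)) (u' [ V' ])
  nest : ∀ {s u u' v v' z} → SegTerm s →
         ParSeg (mapλ Γ) (wλ w) u u' → ParSeg (mapλ Γ) (wλ w) v v' →
         ParSeg Γ (wr (case u' v')) s z → ParSeg Γ w (app s (case u v)) z

mapλ-≗ : ∀ {Γ Γ'} → Γ ≗ Γ' → mapλ Γ ≗ mapλ Γ'
mapλ-≗ h a = cong (mmap wλ) (h a)

Value-renλ : ∀ ρ {V} → Value V → Value (renλ ρ V)
Value-renλ ρ var = var
Value-renλ ρ lam = lam
Value-renλ ρ (pair v w) = pair (Value-renλ ρ v) (Value-renλ ρ w)
Value-renλ ρ (inj v) = inj (Value-renλ ρ v)
Value-renλ ρ thr = thr

Value-renμ : ∀ ρ {V} → Value V → Value (renμ ρ V)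
Value-renμ ρ var = var
Value-renμ ρ lam = lam
Value-renμ ρ (pair v w) = pair (Value-renμ ρ v) (Value-renμ ρ w)
Value-renμ ρ (inj v) = inj (Value-renμ ρ v)
Value-renμ ρ thr = thr

Value-sub : ∀ {σ} → (∀ n → Value (σ n)) → ∀ {V} → Value V → Value (subλ σ V)
Value-sub h (var {x}) = h x
Value-sub h lam = lam
Value-sub h (pair v w) = pair (Value-sub h v) (Value-sub h w)
Value-sub h (inj v) = inj (Value-sub h v)
Value-sub h thr = thr

SegTerm-renλ : ∀ ρ {s} → SegTerm s → SegTerm (renλ ρ s)
SegTerm-renλ ρ ∨ₛ = ∨ₛ
SegTerm-renλ ρ ⊥ₛ = ⊥ₛ
SegTerm-renμ : ∀ ρ {s} → SegTerm s → SegTerm (renμ ρ s)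
SegTerm-renμ ρ ∨ₛ = ∨ₛ
SegTerm-renμ ρ ⊥ₛ = ⊥ₛ
SegTerm-sub : ∀ σ {s} → SegTerm s → SegTerm (subλ σ s)
SegTerm-sub σ ∨ₛ = ∨ₛ
SegTerm-sub σ ⊥ₛ = ⊥ₛ

wλ-renWλ : ∀ ρ w → wλ (renWλ ρ w) ≡ renWλ (extρ ρ) (wλ w)
wλ-renWλ ρ (wl V) = cong wl (trans (renλ-fuse suc ρ V) (sym (renλ-fuse (extρ ρ) suc V)))
wλ-renWλ ρ (wr e) = cong wr (trans (renλE-fuse suc ρ e) (sym (renλE-fuse (extρ ρ) suc e)))

wμ-renWλ : ∀ ρ w → wμ (renWλ ρ w) ≡ renWλ ρ (wμ w)
wμ-renWλ ρ (wl V) = cong wl (sym (renλ-renμ ρ suc V))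
wμ-renWλ ρ (wr e) = cong wr (sym (renλE-renμE ρ suc e))

wλ-renWμ : ∀ ρ w → wλ (renWμ ρ w) ≡ renWμ ρ (wλ w)
wλ-renWμ ρ (wl V) = cong wl (renλ-renμ suc ρ V)
wλ-renWμ ρ (wr e) = cong wr (renλE-renμE suc ρ e)

wμ-renWμ : ∀ ρ w → wμ (renWμ ρ w) ≡ renWμ (extρ ρ) (wμ w)
wμ-renWμ ρ (wl V) = cong wl (trans (renμ-fuse suc ρ V) (sym (renμ-fuse (extρ ρ) suc V)))
wμ-renWμ ρ (wr e) = cong wr (trans (renμE-fuse suc ρ e) (sym (renμE-fuse (extρ ρ) suc e)))

wλ-subW : ∀ σ w → wλ (subW σ w) ≡ subW (extσ σ) (wλ w)
wλ-subW σ (wl V) = cong wl (trans (renλ-sub suc σ V) (sym (sub-renλ (extσ σ) suc V)))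
wλ-subW σ (wr e) = cong wr (trans (renλ-subE suc σ e) (sym (sub-renλE (extσ σ) suc e)))

wμ-subW : ∀ σ w → wμ (subW σ w) ≡ subW (λ n → renμ suc (σ n)) (wμ w)
wμ-subW σ (wl V) = cong wl (renμ-sub suc σ V)
wμ-subW σ (wr e) = cong wr (renμ-subE suc σ e)

applyW-renλ : ∀ ρ w t → renλ ρ (applyW w t) ≡ applyW (renWλ ρ w) (renλ ρ t)
applyW-renλ ρ (wl V) t = refl
applyW-renλ ρ (wr e) t = refl

applyW-renμ : ∀ ρ w t → renμ ρ (applyW w t) ≡ applyW (renWμ ρ w) (renμ ρ t)
applyW-renμ ρ (wl V) t = refl
applyW-renμ ρ (wr e) t = refl

applyW-sub : ∀ σ w t → subλ σ (applyW w t) ≡ applyW (subW σ w) (subλ σ t)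
applyW-sub σ (wl V) t = refl
applyW-sub σ (wr e) t = refl

sel-renλ : ∀ ρ i a b → renλ ρ (sel i a b) ≡ sel i (renλ ρ a) (renλ ρ b)
sel-renλ ρ ι₁ a b = refl
sel-renλ ρ ι₂ a b = refl
sel-renμ : ∀ ρ i a b → renμ ρ (sel i a b) ≡ sel i (renμ ρ a) (renμ ρ b)
sel-renμ ρ ι₁ a b = refl
sel-renμ ρ ι₂ a b = refl
sel-sub : ∀ σ i a b → subλ σ (sel i a b) ≡ sel i (subλ σ a) (subλ σ b)
sel-sub σ ι₁ a b = refl
sel-sub σ ι₂ a b = refl

ParSeg-substʷ : ∀ {Γ w w' t t'} → w ≡ w' → ParSeg Γ w t t' → ParSeg Γ w' t t'
ParSeg-substʷ refl q = q

Par-substʳ : ∀ {Γ t t' t''} → t' ≡ t'' → Par Γ t t' → Par Γ t t''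
Par-substʳ refl q = q
Par-substˡ : ∀ {Γ t t' t''} → t ≡ t'' → Par Γ t t' → Par Γ t'' t'
Par-substˡ refl q = q
ParSeg-substʳ : ∀ {Γ w t t' t''} → t' ≡ t'' → ParSeg Γ w t t' → ParSeg Γ w t t''
ParSeg-substʳ refl q = q
ParSeg-substˡ : ∀ {Γ w t t' t''} → t ≡ t'' → ParSeg Γ w t t' → ParSeg Γ w t'' t'
ParSeg-substˡ refl q = q

wλ≡renWλ-suc : ∀ w → wλ w ≡ renWλ suc w
wλ≡renWλ-suc (wl V) = refl
wλ≡renWλ-suc (wr e) = refl
wμ≡renWμ-suc : ∀ w → wμ w ≡ renWμ suc w
wμ≡renWμ-suc (wl V) = refl
wμ≡renWμ-suc (wr e) = refl

RenλEnv : (ℕ → ℕ) → Env → Env → Set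
RenλEnv ρ Γ Γ' = ∀ a → Γ' a ≡ mmap (renWλ ρ) (Γ a)

RenλEnv-λ : ∀ {ρ Γ Γ'} → RenλEnv ρ Γ Γ' → RenλEnv (extρ ρ) (mapλ Γ) (mapλ Γ')
RenλEnv-λ {ρ} {Γ} {Γ'} h a with Γ a | h a
... | nothing | e = cong (mmap wλ) e
... | just w | e = trans (cong (mmap wλ) e) (cong just (wλ-renWλ ρ w))

RenλEnv-μ : ∀ {ρ Γ Γ' e e'} → e' ≡ mmap (renWλ ρ) e → RenλEnv ρ Γ Γ' → RenλEnv ρ (consμ e Γ) (consμ e' Γ')
RenλEnv-μ h0 h zero = h0
RenλEnv-μ {ρ} {Γ} {Γ'} h0 h (suc a) with Γ a | h a
... | nothing | e = cong (mmap wμ) e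
... | just w | e = trans (cong (mmap wμ) e) (cong just (wμ-renWλ ρ w))

Par-renλ : ∀ {Γ Γ' t t'} ρ → RenλEnv ρ Γ Γ' → Par Γ t t' → Par Γ' (renλ ρ t) (renλ ρ t')
ParE-renλ : ∀ {Γ Γ' t t'} ρ → RenλEnv ρ Γ Γ' → ParE Γ t t' → ParE Γ' (renλE ρ t) (renλE ρ t')
ParSeg-renλ : ∀ {Γ Γ' w t t'} ρ → RenλEnv ρ Γ Γ' → ParSeg Γ w t t' → ParSeg Γ' (renWλ ρ w) (renλ ρ t) (renλ ρ t')
Par-renλ ρ h var = var
Par-renλ ρ h (lam q) = lam (Par-renλ (extρ ρ) (RenλEnv-λ h) q)
Par-renλ ρ h (mu q) = mu (Par-renλ ρ (RenλEnv-μ refl h) q)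
Par-renλ ρ h (thr∉ {a = a} e q) = thr∉ (trans (h a) (cong (mmap _) e)) (Par-renλ ρ h q)
Par-renλ ρ h (thr∈ {a = a} e q) = thr∈ (trans (h a) (cong (mmap _) e)) (ParSeg-renλ ρ h q)
Par-renλ ρ h (inj q) = inj (Par-renλ ρ h q)
Par-renλ ρ h (pair q q₁) = pair (Par-renλ ρ h q) (Par-renλ ρ h q₁)
Par-renλ ρ h (app q x) = app (Par-renλ ρ h q) (ParE-renλ ρ h x)
Par-renλ ρ h (β {t' = t'} {V' = V'} x q q₁) =
  Par-substʳ (sym (renλ-[] ρ t' V')) (β (Value-renλ ρ x) (Par-renλ (extρ ρ) (RenλEnv-λ h) q) (Par-renλ ρ h q₁))
Par-renλ ρ h (π {i = i} {V₁ = V₁} {V₂ = V₂} x x₁ q) =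
  π (Value-renλ ρ x) (Value-renλ ρ x₁) (Par-substˡ (sel-renλ ρ i V₁ V₂) (Par-renλ ρ h q))
Par-renλ ρ h (ω {i = i} {V' = V'} {u₁ = u₁} {u₂ = u₂} {u' = u'} x q q₁) =
  Par-substʳ (sym (renλ-[] ρ u' V'))
    (ω (Value-renλ ρ x) (Par-renλ ρ h q) (Par-substˡ (sel-renλ (extρ ρ) i u₁ u₂) (Par-renλ (extρ ρ) (RenλEnv-λ h) q₁)))
Par-renλ ρ h (segV x q x₁ x₂) = segV (Value-renλ ρ x) (Par-renλ ρ h q) (SegTerm-renλ ρ x₁) (ParSeg-renλ ρ h x₂)
Par-renλ ρ h (segE x x₁ x₂) = segE (ParE-renλ ρ h x) (SegTerm-renλ ρ x₁) (ParSeg-renλ ρ h x₂)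
ParE-renλ ρ h (tm x) = tm (Par-renλ ρ h x)
ParE-renλ ρ h proj = proj
ParE-renλ ρ h (case x x₁) = case (Par-renλ (extρ ρ) (RenλEnv-λ h) x) (Par-renλ (extρ ρ) (RenλEnv-λ h) x₁)
ParSeg-renλ {w = w} ρ h (acc {t' = t'} x) = ParSeg-substʳ (sym (applyW-renλ ρ w t')) (acc (Par-renλ ρ h x))
ParSeg-renλ {w = w} ρ h (∨seg x q q₁) =
  ∨seg (Par-renλ ρ h x) (ParSeg-substʷ (sym (wλ-renWλ ρ w)) (ParSeg-renλ (extρ ρ) (RenλEnv-λ h) q))
                     (ParSeg-substʷ (sym (wλ-renWλ ρ w)) (ParSeg-renλ (extρ ρ) (RenλEnv-λ h) q₁))
ParSeg-renλ {w = w} ρ h (⊥seg x) = ⊥seg (Par-renλ ρ (RenλEnv-μ (cong just (wμ-renWλ ρ w)) h) x)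
ParSeg-renλ {w = w} ρ h (ωseg {i = i} {V' = V'} {u₁ = u₁} {u₂ = u₂} {u' = u'} x x₁ q) =
  ParSeg-substʳ (sym (renλ-[] ρ u' V')) (ωseg (Value-renλ ρ x) (Par-renλ ρ h x₁)
    (ParSeg-substʷ (sym (wλ-renWλ ρ w)) (ParSeg-substˡ (sel-renλ (extρ ρ) i u₁ u₂) (ParSeg-renλ (extρ ρ) (RenλEnv-λ h) q))))
ParSeg-renλ {w = w} ρ h (nest x q q₁ q₂) =
  nest (SegTerm-renλ ρ x) (ParSeg-substʷ (sym (wλ-renWλ ρ w)) (ParSeg-renλ (extρ ρ) (RenλEnv-λ h) q))
     (ParSeg-substʷ (sym (wλ-renWλ ρ w)) (ParSeg-renλ (extρ ρ) (RenλEnv-λ h) q₁)) (ParSeg-renλ ρ h q₂)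

record RenμEnv (ρ : ℕ → ℕ) (Γ Γ' : Env) : Set where
  constructor renμEnv
  field renμEnv-at : ∀ a → Γ' (ρ a) ≡ mmap (renWμ ρ) (Γ a)
open RenμEnv

RenμEnv-λ : ∀ {ρ Γ Γ'} → RenμEnv ρ Γ Γ' → RenμEnv ρ (mapλ Γ) (mapλ Γ')
renμEnv-at (RenμEnv-λ {ρ} {Γ} {Γ'} h) a with Γ a | renμEnv-at h a
... | nothing | e = cong (mmap wλ) e
... | just w | e = trans (cong (mmap wλ) e) (cong just (wλ-renWμ ρ w))

RenμEnv-μ : ∀ {ρ Γ Γ' e e'} → e' ≡ mmap (renWμ (extρ ρ)) e → RenμEnv ρ Γ Γ' → RenμEnv (extρ ρ) (consμ e Γ) (consμ e' Γ')
renμEnv-at (RenμEnv-μ h0 h) zero = h0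
renμEnv-at (RenμEnv-μ {ρ} {Γ} {Γ'} h0 h) (suc a) with Γ a | renμEnv-at h a
... | nothing | e = cong (mmap wμ) e
... | just w | e = trans (cong (mmap wμ) e) (cong just (wμ-renWμ ρ w))

Par-renμ : ∀ {Γ Γ' t t'} ρ → RenμEnv ρ Γ Γ' → Par Γ t t' → Par Γ' (renμ ρ t) (renμ ρ t')
ParE-renμ : ∀ {Γ Γ' t t'} ρ → RenμEnv ρ Γ Γ' → ParE Γ t t' → ParE Γ' (renμE ρ t) (renμE ρ t')
ParSeg-renμ : ∀ {Γ Γ' w t t'} ρ → RenμEnv ρ Γ Γ' → ParSeg Γ w t t' → ParSeg Γ' (renWμ ρ w) (renμ ρ t) (renμ ρ t')
Par-renμ ρ h var = var
Par-renμ ρ h (lam q) = lam (Par-renμ ρ (RenμEnv-λ h) q)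
Par-renμ ρ h (mu q) = mu (Par-renμ (extρ ρ) (RenμEnv-μ refl h) q)
Par-renμ ρ h (thr∉ {a = a} e q) = thr∉ (trans (renμEnv-at h a) (cong (mmap _) e)) (Par-renμ ρ h q)
Par-renμ ρ h (thr∈ {a = a} e q) = thr∈ (trans (renμEnv-at h a) (cong (mmap _) e)) (ParSeg-renμ ρ h q)
Par-renμ ρ h (inj q) = inj (Par-renμ ρ h q)
Par-renμ ρ h (pair q q₁) = pair (Par-renμ ρ h q) (Par-renμ ρ h q₁)
Par-renμ ρ h (app q x) = app (Par-renμ ρ h q) (ParE-renμ ρ h x)
Par-renμ ρ h (β {t' = t'} {V' = V'} x q q₁) =
  Par-substʳ (sym (renμ-[] ρ t' V')) (β (Value-renμ ρ x) (Par-renμ ρ (RenμEnv-λ h) q) (Par-renμ ρ h q₁))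
Par-renμ ρ h (π {i = i} {V₁ = V₁} {V₂ = V₂} x x₁ q) =
  π (Value-renμ ρ x) (Value-renμ ρ x₁) (Par-substˡ (sel-renμ ρ i V₁ V₂) (Par-renμ ρ h q))
Par-renμ ρ h (ω {i = i} {V' = V'} {u₁ = u₁} {u₂ = u₂} {u' = u'} x q q₁) =
  Par-substʳ (sym (renμ-[] ρ u' V'))
    (ω (Value-renμ ρ x) (Par-renμ ρ h q) (Par-substˡ (sel-renμ ρ i u₁ u₂) (Par-renμ ρ (RenμEnv-λ h) q₁)))
Par-renμ ρ h (segV x q x₁ x₂) = segV (Value-renμ ρ x) (Par-renμ ρ h q) (SegTerm-renμ ρ x₁) (ParSeg-renμ ρ h x₂)
Par-renμ ρ h (segE x x₁ x₂) = segE (ParE-renμ ρ h x) (SegTerm-renμ ρ x₁) (ParSeg-renμ ρ h x₂)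
ParE-renμ ρ h (tm x) = tm (Par-renμ ρ h x)
ParE-renμ ρ h proj = proj
ParE-renμ ρ h (case x x₁) = case (Par-renμ ρ (RenμEnv-λ h) x) (Par-renμ ρ (RenμEnv-λ h) x₁)
ParSeg-renμ {w = w} ρ h (acc {t' = t'} x) = ParSeg-substʳ (sym (applyW-renμ ρ w t')) (acc (Par-renμ ρ h x))
ParSeg-renμ {w = w} ρ h (∨seg x q q₁) =
  ∨seg (Par-renμ ρ h x) (ParSeg-substʷ (sym (wλ-renWμ ρ w)) (ParSeg-renμ ρ (RenμEnv-λ h) q))
                     (ParSeg-substʷ (sym (wλ-renWμ ρ w)) (ParSeg-renμ ρ (RenμEnv-λ h) q₁))
ParSeg-renμ {w = w} ρ h (⊥seg x) = ⊥seg (Par-renμ (extρ ρ) (RenμEnv-μ (cong just (wμ-renWμ ρ w)) h) x)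
ParSeg-renμ {w = w} ρ h (ωseg {i = i} {V' = V'} {u₁ = u₁} {u₂ = u₂} {u' = u'} x x₁ q) =
  ParSeg-substʳ (sym (renμ-[] ρ u' V')) (ωseg (Value-renμ ρ x) (Par-renμ ρ h x₁)
    (ParSeg-substʷ (sym (wλ-renWμ ρ w)) (ParSeg-substˡ (sel-renμ ρ i u₁ u₂) (ParSeg-renμ ρ (RenμEnv-λ h) q))))
ParSeg-renμ {w = w} ρ h (nest x q q₁ q₂) =
  nest (SegTerm-renμ ρ x) (ParSeg-substʷ (sym (wλ-renWμ ρ w)) (ParSeg-renμ ρ (RenμEnv-λ h) q))
     (ParSeg-substʷ (sym (wλ-renWμ ρ w)) (ParSeg-renμ ρ (RenμEnv-λ h) q₁)) (ParSeg-renμ ρ h q₂)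

Par-wkλ : ∀ {Γ t t'} → Par Γ t t' → Par (mapλ Γ) (renλ suc t) (renλ suc t')
Par-wkλ {Γ} = Par-renλ suc h
  where
  h : RenλEnv suc Γ (mapλ Γ)
  h a with Γ a
  ... | nothing = refl
  ... | just w = cong just (wλ≡renWλ-suc w)

Par-wkμ : ∀ {Γ t t'} e → Par Γ t t' → Par (consμ e Γ) (renμ suc t) (renμ suc t')
Par-wkμ {Γ} e = Par-renμ suc (renμEnv h)
  where
  h : ∀ a → consμ e Γ (suc a) ≡ mmap (renWμ suc) (Γ a)
  h a with Γ a
  ... | nothing = refl
  ... | just w = cong just (wμ≡renWμ-suc w)

record SubEnv (σ σ' : ℕ → Tm) (Γ Γ' : Env) : Set where
  field
    sub-env : ∀ a → Γ' a ≡ mmap (subW σ') (Γ a)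
    sub-value : ∀ n → Value (σ n)
    sub-par : ∀ n → Par Γ' (σ n) (σ' n)
open SubEnv

SubEnv-λ : ∀ {σ σ' Γ Γ'} → SubEnv σ σ' Γ Γ' → SubEnv (extσ σ) (extσ σ') (mapλ Γ) (mapλ Γ')
sub-env (SubEnv-λ {σ} {σ'} {Γ} {Γ'} h) a with Γ a | sub-env h a
... | nothing | e = cong (mmap wλ) e
... | just w | e = trans (cong (mmap wλ) e) (cong just (wλ-subW σ' w))
sub-value (SubEnv-λ h) zero = var
sub-value (SubEnv-λ h) (suc n) = Value-renλ suc (sub-value h n)
sub-par (SubEnv-λ h) zero = var
sub-par (SubEnv-λ h) (suc n) = Par-wkλ (sub-par h n)

SubEnv-μ : ∀ {σ σ' Γ Γ' e e'} → e' ≡ mmap (subW (λ n → renμ suc (σ' n))) e → SubEnv σ σ' Γ Γ' →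
          SubEnv (λ n → renμ suc (σ n)) (λ n → renμ suc (σ' n)) (consμ e Γ) (consμ e' Γ')
sub-env (SubEnv-μ h0 h) zero = h0
sub-env (SubEnv-μ {σ} {σ'} {Γ} {Γ'} h0 h) (suc a) with Γ a | sub-env h a
... | nothing | e = cong (mmap wμ) e
... | just w | e = trans (cong (mmap wμ) e) (cong just (wμ-subW σ' w))
sub-value (SubEnv-μ h0 h) n = Value-renμ suc (sub-value h n)
sub-par (SubEnv-μ {e' = e'} h0 h) n = Par-wkμ e' (sub-par h n)

Par-sub : ∀ {Γ Γ' σ σ' t t'} → SubEnv σ σ' Γ Γ' → Par Γ t t' → Par Γ' (subλ σ t) (subλ σ' t')
ParE-sub : ∀ {Γ Γ' σ σ' t t'} → SubEnv σ σ' Γ Γ' → ParE Γ t t' → ParE Γ' (subλE σ t) (subλE σ' t')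
ParSeg-sub : ∀ {Γ Γ' σ σ' w t t'} → SubEnv σ σ' Γ Γ' → ParSeg Γ w t t' → ParSeg Γ' (subW σ' w) (subλ σ t) (subλ σ' t')
Par-sub h (var {x}) = sub-par h x
Par-sub h (lam q) = lam (Par-sub (SubEnv-λ h) q)
Par-sub h (mu q) = mu (Par-sub (SubEnv-μ refl h) q)
Par-sub h (thr∉ {a = a} e q) = thr∉ (trans (sub-env h a) (cong (mmap _) e)) (Par-sub h q)
Par-sub h (thr∈ {a = a} e q) = thr∈ (trans (sub-env h a) (cong (mmap _) e)) (ParSeg-sub h q)
Par-sub h (inj q) = inj (Par-sub h q)
Par-sub h (pair q q₁) = pair (Par-sub h q) (Par-sub h q₁)
Par-sub h (app q x) = app (Par-sub h q) (ParE-sub h x)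
Par-sub {σ' = σ'} h (β {t' = t'} {V' = V'} x q q₁) =
  Par-substʳ (sym (subλ-[] σ' t' V')) (β (Value-sub (sub-value h) x) (Par-sub (SubEnv-λ h) q) (Par-sub h q₁))
Par-sub {σ = σ} h (π {i = i} {V₁ = V₁} {V₂ = V₂} x x₁ q) =
  π (Value-sub (sub-value h) x) (Value-sub (sub-value h) x₁) (Par-substˡ (sel-sub σ i V₁ V₂) (Par-sub h q))
Par-sub {σ = σ} {σ' = σ'} h (ω {i = i} {V' = V'} {u₁ = u₁} {u₂ = u₂} {u' = u'} x q q₁) =
  Par-substʳ (sym (subλ-[] σ' u' V'))
    (ω (Value-sub (sub-value h) x) (Par-sub h q) (Par-substˡ (sel-sub (extσ σ) i u₁ u₂) (Par-sub (SubEnv-λ h) q₁)))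
Par-sub h (segV x q x₁ x₂) = segV (Value-sub (sub-value h) x) (Par-sub h q) (SegTerm-sub _ x₁) (ParSeg-sub h x₂)
Par-sub h (segE x x₁ x₂) = segE (ParE-sub h x) (SegTerm-sub _ x₁) (ParSeg-sub h x₂)
ParE-sub h (tm x) = tm (Par-sub h x)
ParE-sub h proj = proj
ParE-sub h (case x x₁) = case (Par-sub (SubEnv-λ h) x) (Par-sub (SubEnv-λ h) x₁)
ParSeg-sub {σ' = σ'} {w = w} h (acc {t' = t'} x) = ParSeg-substʳ (sym (applyW-sub σ' w t')) (acc (Par-sub h x))
ParSeg-sub {σ' = σ'} {w = w} h (∨seg x q q₁) =
  ∨seg (Par-sub h x) (ParSeg-substʷ (sym (wλ-subW σ' w)) (ParSeg-sub (SubEnv-λ h) q))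
                  (ParSeg-substʷ (sym (wλ-subW σ' w)) (ParSeg-sub (SubEnv-λ h) q₁))
ParSeg-sub {σ' = σ'} {w = w} h (⊥seg x) = ⊥seg (Par-sub (SubEnv-μ (cong just (wμ-subW σ' w)) h) x)
ParSeg-sub {σ = σ} {σ' = σ'} {w = w} h (ωseg {i = i} {V' = V'} {u₁ = u₁} {u₂ = u₂} {u' = u'} x x₁ q) =
  ParSeg-substʳ (sym (subλ-[] σ' u' V')) (ωseg (Value-sub (sub-value h) x) (Par-sub h x₁)
    (ParSeg-substʷ (sym (wλ-subW σ' w)) (ParSeg-substˡ (sel-sub (extσ σ) i u₁ u₂) (ParSeg-sub (SubEnv-λ h) q))))
ParSeg-sub {σ' = σ'} {w = w} h (nest x q q₁ q₂) =
  nest (SegTerm-sub _ x) (ParSeg-substʷ (sym (wλ-subW σ' w)) (ParSeg-sub (SubEnv-λ h) q))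
     (ParSeg-substʷ (sym (wλ-subW σ' w)) (ParSeg-sub (SubEnv-λ h) q₁)) (ParSeg-sub h q₂)

SubEnv-σ₀ : ∀ {Γ V V'} → Value V → Par Γ V V' → SubEnv (σ₀ V) (σ₀ V') (mapλ Γ) Γ
sub-env (SubEnv-σ₀ {Γ} {V} {V'} v q) a with Γ a
... | nothing = refl
... | just w = cong just (sym (sub0W w))
  where
  sub0W : ∀ w → subW (σ₀ V') (wλ w) ≡ w
  sub0W (wl U) = cong wl (σ₀-weaken V' U)
  sub0W (wr e) = cong wr (σ₀-weakenE V' e)
sub-value (SubEnv-σ₀ v q) zero = v
sub-value (SubEnv-σ₀ v q) (suc n) = var
sub-par (SubEnv-σ₀ v q) zero = q
sub-par (SubEnv-σ₀ v q) (suc n) = var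

Par-[] : ∀ {Γ t t' V V'} → Value V → Par (mapλ Γ) t t' → Par Γ V V' → Par Γ (t [ V ]) (t' [ V' ])
Par-[] v q qv = Par-sub (SubEnv-σ₀ v qv) q

subW-σ₀-wλ : ∀ V' w → subW (σ₀ V') (wλ w) ≡ w
subW-σ₀-wλ V' (wl U) = cong wl (σ₀-weaken V' U)
subW-σ₀-wλ V' (wr e) = cong wr (σ₀-weakenE V' e)

ParSeg-[] : ∀ {Γ w t t' V V'} → Value V → ParSeg (mapλ Γ) (wλ w) t t' → Par Γ V V' → ParSeg Γ w (t [ V ]) (t' [ V' ])
ParSeg-[] {w = w} {V' = V'} v q qv = ParSeg-substʷ (subW-σ₀-wλ V' w) (ParSeg-sub (SubEnv-σ₀ v qv) q)

-- Label-free complete development and the triangle property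

-- Like star, but following the maximal segment-trees through the environment.
develop : Env → Tm → Tm
developE : Env → El → El
developSeg : Env → Wrap → Tm → Tm
developThr : Env → Maybe Wrap → Tm → Tm
developApp : Env → Tm → El → Tm
developDef : Env → Tm → El → Tm
developSegE : Env → Tm → El → Tm
developNode : Env → Wrap → Tm → Tm → Tm → Tm
developNodeDef : Env → Wrap → Tm → Tm → Tm → Tm
developSel : Env → Ix → Tm → Tm → Tm
developSegSel : Env → Wrap → Ix → Tm → Tm → Tm

develop G (var x) = var x
develop G (lam t) = lam (develop (mapλ G) t)
develop G (app t e) = developApp G t e
develop G (pair t u) = pair (develop G t) (develop G u)
develop G (inj i t) = inj i (develop G t)
develop G (mu t) = mu (develop (consμ nothing G) t)
develop G (thr a t) = thr a (developThr G (G a) t)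
develop G (mark j t) = mark j (develop G t)
developThr G nothing t = develop G t
developThr G (just w) t = developSeg G w t
developE G (tm t) = tm (develop G t)
developE G (proj i) = proj i
developE G (case u v) = case (develop (mapλ G) u) (develop (mapλ G) v)
developSel G ι₁ a b = develop G a
developSel G ι₂ a b = develop G b
developSegSel G w ι₁ a b = developSeg G w a
developSegSel G w ι₂ a b = developSeg G w b
developApp G (lam b) (tm V) =
  if isValue V then develop (mapλ G) b [ develop G V ] else developDef G (lam b) (tm V)
developApp G (pair V₁ V₂) (proj i) =
  if isValue V₁ ∧ isValue V₂ then developSel G i V₁ V₂ else developDef G (pair V₁ V₂) (proj i)
developApp G (inj i V) (case u₁ u₂) =
  if isValue V then developSel (mapλ G) i u₁ u₂ [ develop G V ] else developDef G (inj i V) (case u₁ u₂)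
developApp G t e = developDef G t e
developDef G t (tm s) =
  if isValue t ∧ isSeg s then developSeg G (wl (develop G t)) s else developSegE G t (tm s)
developDef G t e = developSegE G t e
developSegE G t e =
  if isSeg t then developSeg G (wr (developE G e)) t else app (develop G t) (developE G e)
developSeg G w (app s (case u v)) = developNode G w s u v
developSeg G w (mu s) = mu (develop (consμ (just (wμ w)) G) s)
developSeg G w t = applyW w (develop G t)
developNode G w (inj i V) u v =
  if isValue V then developSegSel (mapλ G) (wλ w) i u v [ develop G V ] else developNodeDef G w (inj i V) u v
developNode G w s u v = developNodeDef G w s u v
developNodeDef G w s u v =
  if isSeg s then developSeg G (wr branches) s else app (develop G s) branches
  where
  branches : El
  branches = case (developSeg (mapλ G) (wλ w) u) (developSeg (mapλ G) (wλ w) v)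

data AppView : Tm → El → Set where
  vβ : ∀ b V → AppView (lam b) (tm V)
  vπ : ∀ i V₁ V₂ → AppView (pair V₁ V₂) (proj i)
  vω : ∀ i V u₁ u₂ → AppView (inj i V) (case u₁ u₂)
  vd : ∀ {t e} → (∀ G → developApp G t e ≡ developDef G t e) → AppView t e

appView : ∀ t e → AppView t e
appView (var x) (tm x₁) = vd (λ G → refl)
appView (var x) (proj x₁) = vd (λ G → refl)
appView (var x) (case x₁ x₂) = vd (λ G → refl)
appView (lam t) (tm x) = vβ t x
appView (lam t) (proj x) = vd (λ G → refl)
appView (lam t) (case x x₁) = vd (λ G → refl)
appView (app t x) (tm x₁) = vd (λ G → refl)
appView (app t x) (proj x₁) = vd (λ G → refl)
appView (app t x) (case x₁ x₂) = vd (λ G → refl)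
appView (pair t t₁) (tm x) = vd (λ G → refl)
appView (pair t t₁) (proj x) = vπ x t t₁
appView (pair t t₁) (case x x₁) = vd (λ G → refl)
appView (inj x t) (tm x₁) = vd (λ G → refl)
appView (inj x t) (proj x₁) = vd (λ G → refl)
appView (inj x t) (case x₁ x₂) = vω x t x₁ x₂
appView (mu t) (tm x) = vd (λ G → refl)
appView (mu t) (proj x) = vd (λ G → refl)
appView (mu t) (case x x₁) = vd (λ G → refl)
appView (thr x t) (tm x₁) = vd (λ G → refl)
appView (thr x t) (proj x₁) = vd (λ G → refl)
appView (thr x t) (case x₁ x₂) = vd (λ G → refl)
appView (mark x t) (tm x₁) = vd (λ G → refl)
appView (mark x t) (proj x₁) = vd (λ G → refl)
appView (mark x t) (case x₁ x₂) = vd (λ G → refl)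

data NodeView : Tm → Set where
  vinj : ∀ i V → NodeView (inj i V)
  vdef : ∀ {s} → (∀ G w u v → developNode G w s u v ≡ developNodeDef G w s u v) → NodeView s

nodeView : ∀ s → NodeView s
nodeView (var x) = vdef (λ G w u v → refl)
nodeView (lam s) = vdef (λ G w u v → refl)
nodeView (app s x) = vdef (λ G w u v → refl)
nodeView (pair s s₁) = vdef (λ G w u v → refl)
nodeView (inj x s) = vinj x s
nodeView (mu s) = vdef (λ G w u v → refl)
nodeView (thr x s) = vdef (λ G w u v → refl)
nodeView (mark x s) = vdef (λ G w u v → refl)

Value⇒isValue : ∀ {V} → Value V → isValue V ≡ true
Value⇒isValue var = refl
Value⇒isValue lam = refl
Value⇒isValue (pair v w) rewrite Value⇒isValue v | Value⇒isValue w = refl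
Value⇒isValue (inj v) = Value⇒isValue v
Value⇒isValue thr = refl

isValue⇒Value : ∀ {V} → isValue V ≡ true → Value V
isValue⇒Value {var x} e = var
isValue⇒Value {lam V} e = lam
isValue⇒Value {pair V V₁} e = pair (isValue⇒Value (∧-conicalˡ _ _ e)) (isValue⇒Value (∧-conicalʳ (isValue V) _ e))
isValue⇒Value {inj x V} e = inj (isValue⇒Value e)
isValue⇒Value {thr x V} e = thr
isValue⇒Value {app V x} ()
isValue⇒Value {mu V} ()
isValue⇒Value {mark x V} ()

developApp-segV : ∀ G {V s} → Value V → SegTerm s → developApp G V (tm s) ≡ developSeg G (wl (develop G V)) s
developApp-segV G var ∨ₛ = refl
developApp-segV G var ⊥ₛ = refl
developApp-segV G lam ∨ₛ = refl
developApp-segV G lam ⊥ₛ = refl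
developApp-segV G (pair v w) ∨ₛ rewrite Value⇒isValue v | Value⇒isValue w = refl
developApp-segV G (pair v w) ⊥ₛ rewrite Value⇒isValue v | Value⇒isValue w = refl
developApp-segV G (inj v) ∨ₛ rewrite Value⇒isValue v = refl
developApp-segV G (inj v) ⊥ₛ rewrite Value⇒isValue v = refl
developApp-segV G thr ∨ₛ = refl
developApp-segV G thr ⊥ₛ = refl

developApp-segE : ∀ G {t} e → SegTerm t → developApp G t e ≡ developSeg G (wr (developE G e)) t
developApp-segE G (tm x) ∨ₛ = refl
developApp-segE G (proj x) ∨ₛ = refl
developApp-segE G (case x x₁) ∨ₛ = refl
developApp-segE G (tm x) ⊥ₛ = refl
developApp-segE G (proj x) ⊥ₛ = refl
developApp-segE G (case x x₁) ⊥ₛ = refl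

developNode-seg : ∀ G w {s} u v → SegTerm s → developNode G w s u v ≡ developSeg G
  (wr (case (developSeg (mapλ G) (wλ w) u) (developSeg (mapλ G) (wλ w) v))) s
developNode-seg G w u v ∨ₛ = refl
developNode-seg G w u v ⊥ₛ = refl

Par-Value : ∀ {Γ V V'} → Value V → Par Γ V V' → Value V'
Par-Value var var = var
Par-Value lam (lam q) = lam
Par-Value (pair v w) (pair q q₁) = pair (Par-Value v q) (Par-Value w q₁)
Par-Value (inj v) (inj q) = inj (Par-Value v q)
Par-Value thr (thr∉ x q) = thr
Par-Value thr (thr∈ x x₁) = thr

data ParWrap (Γ : Env) : Wrap → Wrap → Set where
  qwl : ∀ {V V*} → Value V → Par Γ V V* → ParWrap Γ (wl V) (wl V*)
  qwr : ∀ {e e*} → ParE Γ e e* → ParWrap Γ (wr e) (wr e*)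

data ParCaseWrap (Γ : Env) (W : Wrap) : Wrap → Wrap → Set where
  caseWrap : ∀ {y₁ y₂ T₁ T₂} → ParSeg (mapλ Γ) (wλ W) y₁ T₁ → ParSeg (mapλ Γ) (wλ W) y₂ T₂ →
       ParCaseWrap Γ W (wr (case y₁ y₂)) (wr (case T₁ T₂))

-- Source, target and development environments at one μ-variable: a segment-tree
-- there is used by the reduction only (iR), by the development only (iL), or by
-- both (iRL); the tree of the reduction is then part of the maximal one.
data TriangleAt (Γ' : Env) : Maybe Wrap → Maybe Wrap → Maybe Wrap → Set where
  iN  : TriangleAt Γ' nothing nothing nothing
  iR  : ∀ {w W} → ParWrap Γ' w W → TriangleAt Γ' (just w) nothing (just W)
  iL  : ∀ {W} → TriangleAt Γ' nothing (just W) (just W)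
  iRL : ∀ {w W Wt} → ParCaseWrap Γ' W w Wt → TriangleAt Γ' (just w) (just W) (just Wt)

record Triangle (Γ Γ' G : Env) : Set where
  constructor triangle
  field triangleAt : ∀ a → TriangleAt Γ' (Γ a) (Γ' a) (G a)
open Triangle

RenλEnv-wk : ∀ Γ → RenλEnv suc Γ (mapλ Γ)
RenλEnv-wk Γ a with Γ a
... | nothing = refl
... | just w = cong just (wλ≡renWλ-suc w)

ParE-wkλ : ∀ {Γ e e'} → ParE Γ e e' → ParE (mapλ Γ) (renλE suc e) (renλE suc e')
ParE-wkλ {Γ} = ParE-renλ suc (RenλEnv-wk Γ)

ParE-wkμ : ∀ {Γ e e'} x → ParE Γ e e' → ParE (consμ x Γ) (renμE suc e) (renμE suc e')
ParE-wkμ {Γ} x = ParE-renμ suc (renμEnv h)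
  where
  h : ∀ a → consμ x Γ (suc a) ≡ mmap (renWμ suc) (Γ a)
  h a with Γ a
  ... | nothing = refl
  ... | just w = cong just (wμ≡renWμ-suc w)

ParWrap-wkλ : ∀ {Γ w W} → ParWrap Γ w W → ParWrap (mapλ Γ) (wλ w) (wλ W)
ParWrap-wkλ (qwl v q) = qwl (Value-renλ suc v) (Par-wkλ q)
ParWrap-wkλ (qwr q) = qwr (ParE-wkλ q)

ParWrap-wkμ : ∀ {Γ w W} x → ParWrap Γ w W → ParWrap (consμ x Γ) (wμ w) (wμ W)
ParWrap-wkμ x (qwl v q) = qwl (Value-renμ suc v) (Par-wkμ x q)
ParWrap-wkμ x (qwr q) = qwr (ParE-wkμ x q)

renWλ-extρ-wλ : ∀ W → renWλ (extρ suc) (wλ W) ≡ wλ (wλ W)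
renWλ-extρ-wλ W = trans (sym (wλ-renWλ suc W)) (cong wλ (sym (wλ≡renWλ-suc W)))

ParCaseWrap-wkλ : ∀ {Γ W w Wt} → ParCaseWrap Γ W w Wt → ParCaseWrap (mapλ Γ) (wλ W) (wλ w) (wλ Wt)
ParCaseWrap-wkλ {Γ} {W} (caseWrap p₁ p₂) =
  caseWrap (ParSeg-substʷ (renWλ-extρ-wλ W) (ParSeg-renλ (extρ suc) (RenλEnv-λ (RenλEnv-wk Γ)) p₁))
     (ParSeg-substʷ (renWλ-extρ-wλ W) (ParSeg-renλ (extρ suc) (RenλEnv-λ (RenλEnv-wk Γ)) p₂))

renWμ-wλ : ∀ W → renWμ suc (wλ W) ≡ wλ (wμ W)
renWμ-wλ W = trans (sym (wλ-renWμ suc W)) (cong wλ (sym (wμ≡renWμ-suc W)))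

ParCaseWrap-wkμ : ∀ {Γ W w Wt} x → ParCaseWrap Γ W w Wt → ParCaseWrap (consμ x Γ) (wμ W) (wμ w) (wμ Wt)
ParCaseWrap-wkμ {Γ} {W} x (caseWrap p₁ p₂) = caseWrap (ParSeg-substʷ (renWμ-wλ W) (ParSeg-renμ suc (renμEnv h) p₁))
  (ParSeg-substʷ (renWμ-wλ W) (ParSeg-renμ suc (renμEnv h) p₂))
  where
  h : ∀ a → mapλ (consμ x Γ) (suc a) ≡ mmap (renWμ suc) (mapλ Γ a)
  h a with Γ a
  ... | nothing = refl
  ... | just w = cong just (sym (renWμ-wλ w))

TriangleAt-wkλ : ∀ {Γ' x y z} → TriangleAt Γ' x y z → TriangleAt (mapλ Γ') (mmap wλ x) (mmap wλ y) (mmap wλ z)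
TriangleAt-wkλ iN = iN
TriangleAt-wkλ (iR q) = iR (ParWrap-wkλ q)
TriangleAt-wkλ iL = iL
TriangleAt-wkλ (iRL r) = iRL (ParCaseWrap-wkλ r)

TriangleAt-wkμ : ∀ {Γ' x y z} e → TriangleAt Γ' x y z → TriangleAt (consμ e Γ') (mmap wμ x) (mmap wμ y) (mmap wμ z)
TriangleAt-wkμ e iN = iN
TriangleAt-wkμ e (iR q) = iR (ParWrap-wkμ e q)
TriangleAt-wkμ e iL = iL
TriangleAt-wkμ e (iRL r) = iRL (ParCaseWrap-wkμ e r)

Triangle-λ : ∀ {Γ Γ' G} → Triangle Γ Γ' G → Triangle (mapλ Γ) (mapλ Γ') (mapλ G)
triangleAt (Triangle-λ h) a = TriangleAt-wkλ (triangleAt h a)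

Triangle-μ : ∀ {Γ Γ' G e e' e''} → Triangle Γ Γ' G → TriangleAt (consμ e' Γ') e e' e''
  → Triangle (consμ e Γ) (consμ e' Γ') (consμ e'' G)
triangleAt (Triangle-μ h i0) zero = i0
triangleAt (Triangle-μ {e' = e'} h i0) (suc a) = TriangleAt-wkμ e' (triangleAt h a)

Triangle-empty : Triangle ∅ ∅ ∅
triangleAt Triangle-empty a = iN

ParSeg⇒ParWrap : ∀ {Γ' w W y z} → ParSeg Γ' W y z → ParWrap Γ' w W → Par Γ' (applyW w y) z
ParSeg⇒ParWrap (acc q) (qwl v qV) = app qV (tm q)
ParSeg⇒ParWrap (acc q) (qwr qe) = app q qe
ParSeg⇒ParWrap qs@(∨seg _ _ _) (qwl v qV) = segV v qV ∨ₛ qs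
ParSeg⇒ParWrap qs@(∨seg _ _ _) (qwr qe) = segE qe ∨ₛ qs
ParSeg⇒ParWrap qs@(⊥seg _) (qwl v qV) = segV v qV ⊥ₛ qs
ParSeg⇒ParWrap qs@(⊥seg _) (qwr qe) = segE qe ⊥ₛ qs
ParSeg⇒ParWrap qs@(ωseg _ _ _) (qwl v qV) = segV v qV ∨ₛ qs
ParSeg⇒ParWrap qs@(ωseg _ _ _) (qwr qe) = segE qe ∨ₛ qs
ParSeg⇒ParWrap qs@(nest _ _ _ _) (qwl v qV) = segV v qV ∨ₛ qs
ParSeg⇒ParWrap qs@(nest _ _ _ _) (qwr qe) = segE qe ∨ₛ qs

ParSeg⇒ParCase : ∀ {Γ' W y₁ y₂ T₁ T₂ t' z} → ParSeg Γ' (wr (case T₁ T₂)) t' z →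
          ParSeg (mapλ Γ') (wλ W) y₁ T₁ → ParSeg (mapλ Γ') (wλ W) y₂ T₂ → ParSeg Γ' W (app t' (case y₁ y₂)) z
ParSeg⇒ParCase (acc q) p₁ p₂ = ∨seg q p₁ p₂
ParSeg⇒ParCase qs@(∨seg _ _ _) p₁ p₂ = nest ∨ₛ p₁ p₂ qs
ParSeg⇒ParCase qs@(⊥seg _) p₁ p₂ = nest ⊥ₛ p₁ p₂ qs
ParSeg⇒ParCase qs@(ωseg _ _ _) p₁ p₂ = nest ∨ₛ p₁ p₂ qs
ParSeg⇒ParCase qs@(nest _ _ _ _) p₁ p₂ = nest ∨ₛ p₁ p₂ qs

TriangleAt-nothing : ∀ {Γ' x y z} → TriangleAt Γ' x y z → x ≡ nothing
  → (y ≡ nothing × z ≡ nothing) ⊎ Σ Wrap (λ W → y ≡ just W × z ≡ just W)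
TriangleAt-nothing iN e = inj₁ (refl , refl)
TriangleAt-nothing iL e = inj₂ (_ , refl , refl)
TriangleAt-nothing (iR _) ()
TriangleAt-nothing (iRL _) ()

TriangleAt-just : ∀ {Γ' x y z w} → TriangleAt Γ' x y z → x ≡ just w →
        (Σ Wrap λ W → y ≡ nothing × z ≡ just W × ParWrap Γ' w W) ⊎
        (Σ Wrap λ W → Σ Wrap λ Wt → y ≡ just W × z ≡ just Wt × ParCaseWrap Γ' W w Wt)
TriangleAt-just (iR q) refl = inj₁ (_ , refl , refl , q)
TriangleAt-just (iRL r) refl = inj₂ (_ , _ , refl , refl , r)
TriangleAt-just iN ()
TriangleAt-just iL ()

-- The mutually recursive statements follow the position of x: outside the trees
-- (triangle-par), in a tree of the reduction (triangle-seg), in a tree of the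
-- development only (triangle-max), or in a tree of the reduction whose wrapper is a
-- case belonging to a tree of the development (triangle-nested).
triangle-par : ∀ {Γ Γ' G x y} → Triangle Γ Γ' G → Par Γ x y → Par Γ' y (develop G x)
triangle-parE : ∀ {Γ Γ' G e e'} → Triangle Γ Γ' G → ParE Γ e e' → ParE Γ' e' (developE G e)
triangle-seg : ∀ {Γ Γ' G w W x y} → Triangle Γ Γ' G → ParSeg Γ w x y → ParWrap Γ' w W → Par Γ' y (developSeg G W x)
triangle-nested : ∀ {Γ Γ' G w W Wt x y} → Triangle Γ Γ' G → ParSeg Γ w x y → ParCaseWrap Γ' W w Wt
  → ParSeg Γ' W y (developSeg G Wt x)
triangle-max : ∀ {Γ Γ' G W x y} → Triangle Γ Γ' G → Par Γ x y → ParSeg Γ' W y (developSeg G W x)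
triangle-wrap : ∀ {Γ Γ' G w W x y} → Triangle Γ Γ' G → Par Γ x y → ParWrap Γ' w W → Par Γ' (applyW w y) (developSeg G W x)
triangle-app : ∀ {Γ Γ' G t t' e e'} → Triangle Γ Γ' G → AppView t e → Par Γ t t' → ParE Γ e e'
  → Par Γ' (app t' e') (developApp G t e)
triangle-def : ∀ {Γ Γ' G t t' e e'} → Triangle Γ Γ' G → Par Γ t t' → ParE Γ e e' → Par Γ' (app t' e') (developDef G t e)
triangle-segE : ∀ {Γ Γ' G t t' e e'} → Triangle Γ Γ' G → Par Γ t t' → ParE Γ e e' → Par Γ' (app t' e') (developSegE G t e)
triangle-seg-node : ∀ {Γ Γ' G w W s s' u u' v v'} → Triangle Γ Γ' G → NodeView s → Par Γ s s' →
        ParSeg (mapλ Γ) (wλ w) u u' → ParSeg (mapλ Γ) (wλ w) v v' → ParWrap Γ' w W →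
        Par Γ' (app s' (case u' v')) (developNode G W s u v)
triangle-seg-nodeDef : ∀ {Γ Γ' G w W s s' u u' v v'} → Triangle Γ Γ' G → Par Γ s s' →
        ParSeg (mapλ Γ) (wλ w) u u' → ParSeg (mapλ Γ) (wλ w) v v' → ParWrap Γ' w W →
        Par Γ' (app s' (case u' v')) (developNodeDef G W s u v)
triangle-nested-node : ∀ {Γ Γ' G w W Wt s s' u u' v v'} → Triangle Γ Γ' G → NodeView s → Par Γ s s' →
         ParSeg (mapλ Γ) (wλ w) u u' → ParSeg (mapλ Γ) (wλ w) v v' → ParCaseWrap Γ' W w Wt →
         ParSeg Γ' W (app s' (case u' v')) (developNode G Wt s u v)
triangle-nested-nodeDef : ∀ {Γ Γ' G w W Wt s s' u u' v v'} → Triangle Γ Γ' G → Par Γ s s' →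
         ParSeg (mapλ Γ) (wλ w) u u' → ParSeg (mapλ Γ) (wλ w) v v' → ParCaseWrap Γ' W w Wt →
         ParSeg Γ' W (app s' (case u' v')) (developNodeDef G Wt s u v)
triangle-max-node : ∀ {Γ Γ' G W s s' u u' v v'} → Triangle Γ Γ' G → NodeView s → Par Γ s s' →
       Par (mapλ Γ) u u' → Par (mapλ Γ) v v' → ParSeg Γ' W (app s' (case u' v')) (developNode G W s u v)
triangle-max-nodeDef : ∀ {Γ Γ' G W s s' u u' v v'} → Triangle Γ Γ' G → Par Γ s s' →
        Par (mapλ Γ) u u' → Par (mapλ Γ) v v' → ParSeg Γ' W (app s' (case u' v')) (developNodeDef G W s u v)

triangle-β : ∀ {Γ Γ' G b t' V e'} → Triangle Γ Γ' G → Par Γ (lam b) t' → ParE Γ (tm V) e' → (c : Bool) → isValue V ≡ c →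
      Par Γ' (app t' e') (if c then (develop (mapλ G) b) [ develop G V ] else developDef G (lam b) (tm V))
triangle-π : ∀ {Γ Γ' G V₁ V₂ t' e'} i → Triangle Γ Γ' G → Par Γ (pair V₁ V₂) t' → ParE Γ (proj i) e' → (c : Bool)
  → isValue V₁ ∧ isValue V₂ ≡ c →
      Par Γ' (app t' e') (if c then developSel G i V₁ V₂ else developDef G (pair V₁ V₂) (proj i))
triangle-ω : ∀ {Γ Γ' G V u₁ u₂ t' e'} i → Triangle Γ Γ' G → Par Γ (inj i V) t' → ParE Γ (case u₁ u₂) e' → (c : Bool)
  → isValue V ≡ c →
      Par Γ' (app t' e') (if c then (developSel (mapλ G) i u₁ u₂) [ develop G V ] else developDef G (inj i V) (case u₁ u₂))
triangle-defV : ∀ {Γ Γ' G t t' s e'} → Triangle Γ Γ' G → Par Γ t t' → ParE Γ (tm s) e' → (c : Bool) → isValue t ∧ isSeg s ≡ c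
         → Par Γ' (app t' e') (if c then developSeg G (wl (develop G t)) s else developSegE G t (tm s))
triangle-seg-ω : ∀ {Γ Γ' G w W V s' u u' v v'} i → Triangle Γ Γ' G → Par Γ (inj i V) s' →
        ParSeg (mapλ Γ) (wλ w) u u' → ParSeg (mapλ Γ) (wλ w) v v' → ParWrap Γ' w W → (c : Bool) → isValue V ≡ c →
        Par Γ' (app s' (case u' v'))
          (if c then (developSegSel (mapλ G) (wλ W) i u v) [ develop G V ] else developNodeDef G W (inj i V) u v)
triangle-nested-ω : ∀ {Γ Γ' G w W Wt V s' u u' v v'} i → Triangle Γ Γ' G → Par Γ (inj i V) s' →
         ParSeg (mapλ Γ) (wλ w) u u' → ParSeg (mapλ Γ) (wλ w) v v' → ParCaseWrap Γ' W w Wt → (c : Bool) → isValue V ≡ c →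
         ParSeg Γ' W (app s' (case u' v'))
           (if c then (developSegSel (mapλ G) (wλ Wt) i u v) [ develop G V ] else developNodeDef G Wt (inj i V) u v)
triangle-max-ω : ∀ {Γ Γ' G W V s' u u' v v'} i → Triangle Γ Γ' G → Par Γ (inj i V) s' →
        Par (mapλ Γ) u u' → Par (mapλ Γ) v v' → (c : Bool) → isValue V ≡ c →
        ParSeg Γ' W (app s' (case u' v'))
          (if c then (developSegSel (mapλ G) (wλ W) i u v) [ develop G V ] else developNodeDef G W (inj i V) u v)

triangle-par h var = var
triangle-par h (lam q) = lam (triangle-par (Triangle-λ h) q)
triangle-par h (mu q) = mu (triangle-par (Triangle-μ h iN) q)
triangle-par h (thr∉ {a = a} e q) with TriangleAt-nothing (triangleAt h a) e
... | inj₁ (e1 , e2) rewrite e2 = thr∉ e1 (triangle-par h q)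
... | inj₂ (W , e1 , e2) rewrite e2 = thr∈ e1 (triangle-max h q)
triangle-par h (thr∈ {a = a} e q) with TriangleAt-just (triangleAt h a) e
... | inj₁ (W , e1 , e2 , qw) rewrite e2 = thr∉ e1 (triangle-seg h q qw)
... | inj₂ (W , Wt , e1 , e2 , r) rewrite e2 = thr∈ e1 (triangle-nested h q r)
triangle-par h (inj q) = inj (triangle-par h q)
triangle-par h (pair q q₁) = pair (triangle-par h q) (triangle-par h q₁)
triangle-par h (app {t = t} {e = e} q qe) = triangle-app h (appView t e) q qe
triangle-par h (β v q qV) rewrite Value⇒isValue v = Par-[] (Par-Value v qV) (triangle-par (Triangle-λ h) q)
  (triangle-par h qV)
triangle-par h (π {i = ι₁} v1 v2 q) rewrite Value⇒isValue v1 | Value⇒isValue v2 = triangle-par h q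
triangle-par h (π {i = ι₂} v1 v2 q) rewrite Value⇒isValue v1 | Value⇒isValue v2 = triangle-par h q
triangle-par h (ω {i = ι₁} v qV q) rewrite Value⇒isValue v = Par-[] (Par-Value v qV) (triangle-par (Triangle-λ h) q)
  (triangle-par h qV)
triangle-par h (ω {i = ι₂} v qV q) rewrite Value⇒isValue v = Par-[] (Par-Value v qV) (triangle-par (Triangle-λ h) q)
  (triangle-par h qV)
triangle-par {G = G} h (segV v qV el qs) rewrite developApp-segV G v el =
  triangle-seg h qs (qwl (Par-Value v qV) (triangle-par h qV))
triangle-par {G = G} h (segE {e = e} qe el qs) rewrite developApp-segE G e el = triangle-seg h qs (qwr (triangle-parE h qe))

triangle-parE h (tm q) = tm (triangle-par h q)
triangle-parE h proj = proj
triangle-parE h (case q q₁) = case (triangle-par (Triangle-λ h) q) (triangle-par (Triangle-λ h) q₁)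

triangle-wrap h q qw = ParSeg⇒ParWrap (triangle-max h q) qw

triangle-app h (vβ b V) q qe = triangle-β h q qe (isValue V) refl
triangle-app h (vπ i V₁ V₂) q qe = triangle-π i h q qe (isValue V₁ ∧ isValue V₂) refl
triangle-app h (vω i V u₁ u₂) q qe = triangle-ω i h q qe (isValue V) refl
triangle-app {G = G} h (vd eq) q qe rewrite eq G = triangle-def h q qe

triangle-β h (lam qb) (tm qV) true eq = β (Par-Value (isValue⇒Value eq) qV) (triangle-par (Triangle-λ h) qb)
  (triangle-par h qV)
triangle-β h q qe false eq = triangle-def h q qe

triangle-π ι₁ h (pair {t = V₁} q₁ q₂) proj true eq = π (Par-Value (isValue⇒Value (∧-conicalˡ _ _ eq)) q₁)
  (Par-Value (isValue⇒Value (∧-conicalʳ (isValue V₁) _ eq)) q₂) (triangle-par h q₁)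
triangle-π ι₂ h (pair {t = V₁} q₁ q₂) proj true eq = π (Par-Value (isValue⇒Value (∧-conicalˡ _ _ eq)) q₁)
  (Par-Value (isValue⇒Value (∧-conicalʳ (isValue V₁) _ eq)) q₂) (triangle-par h q₂)
triangle-π i h q qe false eq = triangle-def h q qe

triangle-ω ι₁ h (inj qV) (case q₁ q₂) true eq = ω (Par-Value (isValue⇒Value eq) qV) (triangle-par h qV)
  (triangle-par (Triangle-λ h) q₁)
triangle-ω ι₂ h (inj qV) (case q₁ q₂) true eq = ω (Par-Value (isValue⇒Value eq) qV) (triangle-par h qV)
  (triangle-par (Triangle-λ h) q₂)
triangle-ω i h q qe false eq = triangle-def h q qe

triangle-def {t = t} h q qe@(tm {t = s} qs) = triangle-defV h q qe (isValue t ∧ isSeg s) refl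
triangle-def h q qe@proj = triangle-segE h q qe
triangle-def h q qe@(case _ _) = triangle-segE h q qe

triangle-defV h q (tm qs) true eq = triangle-wrap h qs
  (qwl (Par-Value (isValue⇒Value (∧-conicalˡ _ _ eq)) q) (triangle-par h q))
triangle-defV h q qe false eq = triangle-segE h q qe

triangle-segE {t = t} h q qe with isSeg t
... | true = triangle-wrap h q (qwr (triangle-parE h qe))
... | false = app (triangle-par h q) (triangle-parE h qe)

triangle-seg h (acc q) qw = triangle-wrap h q qw
triangle-seg h (∨seg {s = s} q0 q₁ q₂) qw = triangle-seg-node h (nodeView s) q0 q₁ q₂ qw
triangle-seg h (⊥seg q) qw = mu (triangle-par (Triangle-μ h (iR (ParWrap-wkμ nothing qw))) q)
triangle-seg h (ωseg {i = ι₁} v qV q) qw rewrite Value⇒isValue v =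
  Par-[] (Par-Value v qV) (triangle-seg (Triangle-λ h) q (ParWrap-wkλ qw)) (triangle-par h qV)
triangle-seg h (ωseg {i = ι₂} v qV q) qw rewrite Value⇒isValue v =
  Par-[] (Par-Value v qV) (triangle-seg (Triangle-λ h) q (ParWrap-wkλ qw)) (triangle-par h qV)
triangle-seg {G = G} {W = W} h (nest {u = u} {v = v} el q₁ q₂ qs) qw rewrite developNode-seg G W u v el =
  triangle-seg h qs
    (qwr (case (triangle-seg (Triangle-λ h) q₁ (ParWrap-wkλ qw)) (triangle-seg (Triangle-λ h) q₂ (ParWrap-wkλ qw))))

triangle-seg-node h (vinj i V) q0 q₁ q₂ qw = triangle-seg-ω i h q0 q₁ q₂ qw (isValue V) refl
triangle-seg-node {G = G} {W = W} {u = u} {v = v} h (vdef eq) q0 q₁ q₂ qw rewrite eq G W u v =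
  triangle-seg-nodeDef h q0 q₁ q₂ qw
triangle-seg-ω ι₁ h (inj qV) q₁ q₂ qw true eq = ω (Par-Value (isValue⇒Value eq) qV) (triangle-par h qV)
  (triangle-seg (Triangle-λ h) q₁ (ParWrap-wkλ qw))
triangle-seg-ω ι₂ h (inj qV) q₁ q₂ qw true eq = ω (Par-Value (isValue⇒Value eq) qV) (triangle-par h qV)
  (triangle-seg (Triangle-λ h) q₂ (ParWrap-wkλ qw))
triangle-seg-ω i h q0 q₁ q₂ qw false eq = triangle-seg-nodeDef h q0 q₁ q₂ qw

triangle-seg-nodeDef {s = s} h q0 q₁ q₂ qw with isSeg s
... | true = triangle-wrap h q0
  (qwr (case (triangle-seg (Triangle-λ h) q₁ (ParWrap-wkλ qw)) (triangle-seg (Triangle-λ h) q₂ (ParWrap-wkλ qw))))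
... | false = app (triangle-par h q0)
  (case (triangle-seg (Triangle-λ h) q₁ (ParWrap-wkλ qw)) (triangle-seg (Triangle-λ h) q₂ (ParWrap-wkλ qw)))

triangle-nested h (acc q) (caseWrap p₁ p₂) = ParSeg⇒ParCase (triangle-max h q) p₁ p₂
triangle-nested h (∨seg {s = s} q0 q₁ q₂) r = triangle-nested-node h (nodeView s) q0 q₁ q₂ r
triangle-nested h (⊥seg q) r = ⊥seg (triangle-par (Triangle-μ h (iRL (ParCaseWrap-wkμ _ r))) q)
triangle-nested h (ωseg {i = ι₁} v qV q) r rewrite Value⇒isValue v =
  ParSeg-[] (Par-Value v qV) (triangle-nested (Triangle-λ h) q (ParCaseWrap-wkλ r)) (triangle-par h qV)
triangle-nested h (ωseg {i = ι₂} v qV q) r rewrite Value⇒isValue v =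
  ParSeg-[] (Par-Value v qV) (triangle-nested (Triangle-λ h) q (ParCaseWrap-wkλ r)) (triangle-par h qV)
triangle-nested {G = G} {Wt = Wt} h (nest {u = u} {v = v} el q₁ q₂ qs) r rewrite developNode-seg G Wt u v el =
  triangle-nested h qs
    (caseWrap (triangle-nested (Triangle-λ h) q₁ (ParCaseWrap-wkλ r))
    (triangle-nested (Triangle-λ h) q₂ (ParCaseWrap-wkλ r)))

triangle-nested-node h (vinj i V) q0 q₁ q₂ r = triangle-nested-ω i h q0 q₁ q₂ r (isValue V) refl
triangle-nested-node {G = G} {Wt = Wt} {u = u} {v = v} h (vdef eq) q0 q₁ q₂ r rewrite eq G Wt u v =
  triangle-nested-nodeDef h q0 q₁ q₂ r
triangle-nested-ω ι₁ h (inj qV) q₁ q₂ r true eq = ωseg (Par-Value (isValue⇒Value eq) qV) (triangle-par h qV)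
  (triangle-nested (Triangle-λ h) q₁ (ParCaseWrap-wkλ r))
triangle-nested-ω ι₂ h (inj qV) q₁ q₂ r true eq = ωseg (Par-Value (isValue⇒Value eq) qV) (triangle-par h qV)
  (triangle-nested (Triangle-λ h) q₂ (ParCaseWrap-wkλ r))
triangle-nested-ω i h q0 q₁ q₂ r false eq = triangle-nested-nodeDef h q0 q₁ q₂ r

triangle-nested-nodeDef {s = s} h q0 q₁ q₂ r with isSeg s
... | true = ParSeg⇒ParCase (triangle-max h q0) (triangle-nested (Triangle-λ h) q₁ (ParCaseWrap-wkλ r))
  (triangle-nested (Triangle-λ h) q₂ (ParCaseWrap-wkλ r))
... | false = ∨seg (triangle-par h q0) (triangle-nested (Triangle-λ h) q₁ (ParCaseWrap-wkλ r))
  (triangle-nested (Triangle-λ h) q₂ (ParCaseWrap-wkλ r))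

triangle-max h q@var = acc (triangle-par h q)
triangle-max h q@(lam _) = acc (triangle-par h q)
triangle-max h (mu q) = ⊥seg (triangle-par (Triangle-μ h iL) q)
triangle-max h q@(thr∉ _ _) = acc (triangle-par h q)
triangle-max h q@(thr∈ _ _) = acc (triangle-par h q)
triangle-max h q@(inj _) = acc (triangle-par h q)
triangle-max h q@(pair _ _) = acc (triangle-par h q)
triangle-max h q@(app _ (tm _)) = acc (triangle-par h q)
triangle-max h q@(app _ proj) = acc (triangle-par h q)
triangle-max h (app {t = s} q0 (case q₁ q₂)) = triangle-max-node h (nodeView s) q0 q₁ q₂
triangle-max h q@(β _ _ _) = acc (triangle-par h q)
triangle-max h q@(π _ _ _) = acc (triangle-par h q)
triangle-max h (ω {i = ι₁} v qV q) rewrite Value⇒isValue v = ParSeg-[] (Par-Value v qV) (triangle-max (Triangle-λ h) q)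
  (triangle-par h qV)
triangle-max h (ω {i = ι₂} v qV q) rewrite Value⇒isValue v = ParSeg-[] (Par-Value v qV) (triangle-max (Triangle-λ h) q)
  (triangle-par h qV)
triangle-max h q@(segV _ _ _ _) = acc (triangle-par h q)
triangle-max h q@(segE (tm _) _ _) = acc (triangle-par h q)
triangle-max h q@(segE proj _ _) = acc (triangle-par h q)
triangle-max {G = G} {W = W} h (segE (case {u = u₁} {v = u₂} q₁ q₂) el qs) rewrite developNode-seg G W u₁ u₂ el =
  triangle-nested h qs (caseWrap (triangle-max (Triangle-λ h) q₁) (triangle-max (Triangle-λ h) q₂))

triangle-max-node h (vinj i V) q0 q₁ q₂ = triangle-max-ω i h q0 q₁ q₂ (isValue V) refl
triangle-max-node {G = G} {W = W} {u = u} {v = v} h (vdef eq) q0 q₁ q₂ rewrite eq G W u v = triangle-max-nodeDef h q0 q₁ q₂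
triangle-max-ω ι₁ h (inj qV) q₁ q₂ true eq = ωseg (Par-Value (isValue⇒Value eq) qV) (triangle-par h qV)
  (triangle-max (Triangle-λ h) q₁)
triangle-max-ω ι₂ h (inj qV) q₁ q₂ true eq = ωseg (Par-Value (isValue⇒Value eq) qV) (triangle-par h qV)
  (triangle-max (Triangle-λ h) q₂)
triangle-max-ω i h q0 q₁ q₂ false eq = triangle-max-nodeDef h q0 q₁ q₂

triangle-max-nodeDef {s = s} h q0 q₁ q₂ with isSeg s
... | true = ParSeg⇒ParCase (triangle-max h q0) (triangle-max (Triangle-λ h) q₁) (triangle-max (Triangle-λ h) q₂)
... | false = ∨seg (triangle-par h q0) (triangle-max (Triangle-λ h) q₁) (triangle-max (Triangle-λ h) q₂)

-- Here an Env is indexed by labels rather than μ-variables; under binders only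
-- its wrappers are weakened.
mapμ : Env → Env
mapμ Ψ j = mmap wμ (Ψ j)

fillMark : ℕ → Maybe Wrap → Tm → Tm
fillMark j nothing t = mark j t
fillMark j (just w) t = applyW w t

fillAll : Env → Tm → Tm
fillAllE : Env → El → El
fillAll Ψ (var x) = var x
fillAll Ψ (lam t) = lam (fillAll (mapλ Ψ) t)
fillAll Ψ (app t e) = app (fillAll Ψ t) (fillAllE Ψ e)
fillAll Ψ (pair t u) = pair (fillAll Ψ t) (fillAll Ψ u)
fillAll Ψ (inj i t) = inj i (fillAll Ψ t)
fillAll Ψ (mu t) = mu (fillAll (mapμ Ψ) t)
fillAll Ψ (thr a t) = thr a (fillAll Ψ t)
fillAll Ψ (mark j t) = fillMark j (Ψ j) (fillAll Ψ t)
fillAllE Ψ (tm t) = tm (fillAll Ψ t)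
fillAllE Ψ (proj i) = proj i
fillAllE Ψ (case u v) = case (fillAll (mapλ Ψ) u) (fillAll (mapλ Ψ) v)

fillAllW : Env → Wrap → Wrap
fillAllW Ψ (wl V) = wl (fillAll Ψ V)
fillAllW Ψ (wr e) = wr (fillAllE Ψ e)

fillAll-≗ : ∀ {Ψ Ψ'} → Ψ ≗ Ψ' → ∀ t → fillAll Ψ t ≡ fillAll Ψ' t
fillAllE-≗ : ∀ {Ψ Ψ'} → Ψ ≗ Ψ' → ∀ e → fillAllE Ψ e ≡ fillAllE Ψ' e
fillAll-≗ h (var x) = refl
fillAll-≗ h (lam t) = cong lam (fillAll-≗ (mapλ-≗ h) t)
fillAll-≗ h (app t e) = cong₂ app (fillAll-≗ h t) (fillAllE-≗ h e)
fillAll-≗ h (pair t u) = cong₂ pair (fillAll-≗ h t) (fillAll-≗ h u)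
fillAll-≗ h (inj i t) = cong (inj i) (fillAll-≗ h t)
fillAll-≗ h (mu t) = cong mu (fillAll-≗ (λ j → cong (mmap wμ) (h j)) t)
fillAll-≗ h (thr a t) = cong (thr a) (fillAll-≗ h t)
fillAll-≗ h (mark j t) = cong₂ (fillMark j) (h j) (fillAll-≗ h t)
fillAllE-≗ h (tm t) = cong tm (fillAll-≗ h t)
fillAllE-≗ h (proj i) = refl
fillAllE-≗ h (case u v) = cong₂ case (fillAll-≗ (mapλ-≗ h) u) (fillAll-≗ (mapλ-≗ h) v)

fillAll-applyW : ∀ Ψ w t → fillAll Ψ (applyW w t) ≡ applyW (fillAllW Ψ w) (fillAll Ψ t)
fillAll-applyW Ψ (wl V) t = refl
fillAll-applyW Ψ (wr e) t = refl

fillAll-renλ : ∀ {Ψ₁ Ψ₂} ρ → (∀ j → Ψ₂ j ≡ mmap (renWλ ρ) (Ψ₁ j)) → ∀ t → fillAll Ψ₂ (renλ ρ t) ≡ renλ ρ (fillAll Ψ₁ t)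
fillAllE-renλ : ∀ {Ψ₁ Ψ₂} ρ → (∀ j → Ψ₂ j ≡ mmap (renWλ ρ) (Ψ₁ j)) → ∀ e → fillAllE Ψ₂ (renλE ρ e) ≡ renλE ρ (fillAllE Ψ₁ e)
fillAll-renλ ρ h (var x) = refl
fillAll-renλ ρ h (lam t) = cong lam (fillAll-renλ (extρ ρ) (RenλEnv-λ h) t)
fillAll-renλ ρ h (app t e) = cong₂ app (fillAll-renλ ρ h t) (fillAllE-renλ ρ h e)
fillAll-renλ ρ h (pair t u) = cong₂ pair (fillAll-renλ ρ h t) (fillAll-renλ ρ h u)
fillAll-renλ ρ h (inj i t) = cong (inj i) (fillAll-renλ ρ h t)
fillAll-renλ {Ψ₁} {Ψ₂} ρ h (mu t) = cong mu (fillAll-renλ ρ h' t)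
  where
  h' : ∀ j → mapμ Ψ₂ j ≡ mmap (renWλ ρ) (mapμ Ψ₁ j)
  h' j with Ψ₁ j | h j
  ... | nothing | e = cong (mmap wμ) e
  ... | just w | e = trans (cong (mmap wμ) e) (cong just (wμ-renWλ ρ w))
fillAll-renλ ρ h (thr a t) = cong (thr a) (fillAll-renλ ρ h t)
fillAll-renλ {Ψ₁} {Ψ₂} ρ h (mark j t) with Ψ₁ j | h j
... | nothing | e rewrite e = cong (mark j) (fillAll-renλ ρ h t)
... | just w | e rewrite e = trans (cong (applyW (renWλ ρ w)) (fillAll-renλ ρ h t)) (sym (applyW-renλ ρ w _))
fillAllE-renλ ρ h (tm t) = cong tm (fillAll-renλ ρ h t)
fillAllE-renλ ρ h (proj i) = refl
fillAllE-renλ ρ h (case u v) = cong₂ case (fillAll-renλ (extρ ρ) (RenλEnv-λ h) u) (fillAll-renλ (extρ ρ) (RenλEnv-λ h) v)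

fillAll-renμ : ∀ {Ψ₁ Ψ₂} ρ → (∀ j → Ψ₂ j ≡ mmap (renWμ ρ) (Ψ₁ j)) → ∀ t → fillAll Ψ₂ (renμ ρ t) ≡ renμ ρ (fillAll Ψ₁ t)
fillAllE-renμ : ∀ {Ψ₁ Ψ₂} ρ → (∀ j → Ψ₂ j ≡ mmap (renWμ ρ) (Ψ₁ j)) → ∀ e → fillAllE Ψ₂ (renμE ρ e) ≡ renμE ρ (fillAllE Ψ₁ e)
fillAll-renμ ρ h (var x) = refl
fillAll-renμ {Ψ₁} {Ψ₂} ρ h (lam t) = cong lam (fillAll-renμ ρ h' t)
  where
  h' : ∀ j → mapλ Ψ₂ j ≡ mmap (renWμ ρ) (mapλ Ψ₁ j)
  h' j with Ψ₁ j | h j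
  ... | nothing | e = cong (mmap wλ) e
  ... | just w | e = trans (cong (mmap wλ) e) (cong just (wλ-renWμ ρ w))
fillAll-renμ ρ h (app t e) = cong₂ app (fillAll-renμ ρ h t) (fillAllE-renμ ρ h e)
fillAll-renμ ρ h (pair t u) = cong₂ pair (fillAll-renμ ρ h t) (fillAll-renμ ρ h u)
fillAll-renμ ρ h (inj i t) = cong (inj i) (fillAll-renμ ρ h t)
fillAll-renμ {Ψ₁} {Ψ₂} ρ h (mu t) = cong mu (fillAll-renμ (extρ ρ) h' t)
  where
  h' : ∀ j → mapμ Ψ₂ j ≡ mmap (renWμ (extρ ρ)) (mapμ Ψ₁ j)
  h' j with Ψ₁ j | h j
  ... | nothing | e = cong (mmap wμ) e
  ... | just w | e = trans (cong (mmap wμ) e) (cong just (wμ-renWμ ρ w))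
fillAll-renμ ρ h (thr a t) = cong (thr (ρ a)) (fillAll-renμ ρ h t)
fillAll-renμ {Ψ₁} {Ψ₂} ρ h (mark j t) with Ψ₁ j | h j
... | nothing | e rewrite e = cong (mark j) (fillAll-renμ ρ h t)
... | just w | e rewrite e = trans (cong (applyW (renWμ ρ w)) (fillAll-renμ ρ h t)) (sym (applyW-renμ ρ w _))
fillAllE-renμ ρ h (tm t) = cong tm (fillAll-renμ ρ h t)
fillAllE-renμ ρ h (proj i) = refl
fillAllE-renμ {Ψ₁} {Ψ₂} ρ h (case u v) = cong₂ case (fillAll-renμ ρ h' u) (fillAll-renμ ρ h' v)
  where
  h' : ∀ j → mapλ Ψ₂ j ≡ mmap (renWμ ρ) (mapλ Ψ₁ j)
  h' j with Ψ₁ j | h j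
  ... | nothing | e = cong (mmap wλ) e
  ... | just w | e = trans (cong (mmap wλ) e) (cong just (wλ-renWμ ρ w))

fillAll-wkλ : ∀ Ψ t → fillAll (mapλ Ψ) (renλ suc t) ≡ renλ suc (fillAll Ψ t)
fillAll-wkλ Ψ = fillAll-renλ suc (RλOK-wk' Ψ)
  where
  RλOK-wk' : ∀ Ψ j → mapλ Ψ j ≡ mmap (renWλ suc) (Ψ j)
  RλOK-wk' Ψ j with Ψ j
  ... | nothing = refl
  ... | just w = cong just (wλ≡renWλ-suc w)

fillAll-wkμ : ∀ Ψ t → fillAll (mapμ Ψ) (renμ suc t) ≡ renμ suc (fillAll Ψ t)
fillAll-wkμ Ψ = fillAll-renμ suc h
  where
  h : ∀ j → mapμ Ψ j ≡ mmap (renWμ suc) (Ψ j)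
  h j with Ψ j
  ... | nothing = refl
  ... | just w = cong just (wμ≡renWμ-suc w)

fillAllE-wkλ : ∀ Ψ e → fillAllE (mapλ Ψ) (renλE suc e) ≡ renλE suc (fillAllE Ψ e)
fillAllE-wkλ Ψ = fillAllE-renλ suc h
  where
  h : ∀ j → mapλ Ψ j ≡ mmap (renWλ suc) (Ψ j)
  h j with Ψ j
  ... | nothing = refl
  ... | just w = cong just (wλ≡renWλ-suc w)

fillAllE-wkμ : ∀ Ψ e → fillAllE (mapμ Ψ) (renμE suc e) ≡ renμE suc (fillAllE Ψ e)
fillAllE-wkμ Ψ = fillAllE-renμ suc h
  where
  h : ∀ j → mapμ Ψ j ≡ mmap (renWμ suc) (Ψ j)
  h j with Ψ j
  ... | nothing = refl
  ... | just w = cong just (wμ≡renWμ-suc w)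

fillAllW-wkλ : ∀ Ψ w → fillAllW (mapλ Ψ) (wλ w) ≡ wλ (fillAllW Ψ w)
fillAllW-wkλ Ψ (wl V) = cong wl (fillAll-wkλ Ψ V)
fillAllW-wkλ Ψ (wr e) = cong wr (fillAllE-wkλ Ψ e)

fillAllW-wkμ : ∀ Ψ w → fillAllW (mapμ Ψ) (wμ w) ≡ wμ (fillAllW Ψ w)
fillAllW-wkμ Ψ (wl V) = cong wl (fillAll-wkμ Ψ V)
fillAllW-wkμ Ψ (wr e) = cong wr (fillAllE-wkμ Ψ e)

fillAll-sub : ∀ {Ψ₁ Ψ₂ σ σ'} → (∀ j → Ψ₂ j ≡ mmap (subW σ') (Ψ₁ j)) → (∀ n → fillAll Ψ₂ (σ n) ≡ σ' n) →
            ∀ t → fillAll Ψ₂ (subλ σ t) ≡ subλ σ' (fillAll Ψ₁ t)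
fillAllE-sub : ∀ {Ψ₁ Ψ₂ σ σ'} → (∀ j → Ψ₂ j ≡ mmap (subW σ') (Ψ₁ j)) → (∀ n → fillAll Ψ₂ (σ n) ≡ σ' n) →
            ∀ e → fillAllE Ψ₂ (subλE σ e) ≡ subλE σ' (fillAllE Ψ₁ e)
fillAll-sub-env-λ : ∀ {Ψ₁ Ψ₂ σ'} → (∀ j → Ψ₂ j ≡ mmap (subW σ') (Ψ₁ j)) → ∀ j → mapλ Ψ₂ j ≡ mmap (subW (extσ σ')) (mapλ Ψ₁ j)
fillAll-sub-env-λ {Ψ₁} {Ψ₂} {σ'} h j with Ψ₁ j | h j
... | nothing | e = cong (mmap wλ) e
... | just w | e = trans (cong (mmap wλ) e) (cong just (wλ-subW σ' w))
fillAll-sub-σ-λ : ∀ {Ψ₂ σ σ'} → (∀ n → fillAll Ψ₂ (σ n) ≡ σ' n) → ∀ n → fillAll (mapλ Ψ₂) (extσ σ n) ≡ extσ σ' n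
fillAll-sub-σ-λ h zero = refl
fillAll-sub-σ-λ {Ψ₂} {σ} h (suc n) = trans (fillAll-wkλ Ψ₂ (σ n)) (cong (renλ suc) (h n))
fillAll-sub h1 h2 (var x) = h2 x
fillAll-sub h1 h2 (lam t) = cong lam (fillAll-sub (fillAll-sub-env-λ h1) (fillAll-sub-σ-λ h2) t)
fillAll-sub h1 h2 (app t e) = cong₂ app (fillAll-sub h1 h2 t) (fillAllE-sub h1 h2 e)
fillAll-sub h1 h2 (pair t u) = cong₂ pair (fillAll-sub h1 h2 t) (fillAll-sub h1 h2 u)
fillAll-sub h1 h2 (inj i t) = cong (inj i) (fillAll-sub h1 h2 t)
fillAll-sub {Ψ₁} {Ψ₂} {σ} {σ'} h1 h2 (mu t) = cong mu (fillAll-sub h1' h2' t)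
  where
  h1' : ∀ j → mapμ Ψ₂ j ≡ mmap (subW (λ n → renμ suc (σ' n))) (mapμ Ψ₁ j)
  h1' j with Ψ₁ j | h1 j
  ... | nothing | e = cong (mmap wμ) e
  ... | just w | e = trans (cong (mmap wμ) e) (cong just (wμ-subW σ' w))
  h2' : ∀ n → fillAll (mapμ Ψ₂) (renμ suc (σ n)) ≡ renμ suc (σ' n)
  h2' n = trans (fillAll-wkμ Ψ₂ (σ n)) (cong (renμ suc) (h2 n))
fillAll-sub h1 h2 (thr a t) = cong (thr a) (fillAll-sub h1 h2 t)
fillAll-sub {Ψ₁} {Ψ₂} {σ} {σ'} h1 h2 (mark j t) with Ψ₁ j | h1 j
... | nothing | e rewrite e = cong (mark j) (fillAll-sub h1 h2 t)
... | just w | e rewrite e = trans (cong (applyW (subW σ' w)) (fillAll-sub h1 h2 t)) (sym (applyW-sub σ' w _))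
fillAllE-sub h1 h2 (tm t) = cong tm (fillAll-sub h1 h2 t)
fillAllE-sub h1 h2 (proj i) = refl
fillAllE-sub h1 h2 (case u v) = cong₂ case (fillAll-sub (fillAll-sub-env-λ h1) (fillAll-sub-σ-λ h2) u)
  (fillAll-sub (fillAll-sub-env-λ h1) (fillAll-sub-σ-λ h2) v)

fillAll-[] : ∀ Ψ t V → fillAll Ψ (t [ V ]) ≡ (fillAll (mapλ Ψ) t) [ fillAll Ψ V ]
fillAll-[] Ψ t V = fillAll-sub h1 h2 t
  where
  h1 : ∀ j → Ψ j ≡ mmap (subW (σ₀ (fillAll Ψ V))) (mapλ Ψ j)
  h1 j with Ψ j
  ... | nothing = refl
  ... | just w = cong just (sym (subW-σ₀-wλ (fillAll Ψ V) w))
  h2 : ∀ n → fillAll Ψ (σ₀ V n) ≡ σ₀ (fillAll Ψ V) n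
  h2 zero = refl
  h2 (suc n) = refl

update : Env → ℕ → Wrap → Env
update Ψ k w j with j ≟ k
... | yes _ = just w
... | no _ = Ψ j

update-mapλ : ∀ Ψ k w → update (mapλ Ψ) k (fillAllW (mapλ Ψ) (wλ w)) ≗ mapλ (update Ψ k (fillAllW Ψ w))
update-mapλ Ψ k w j with j ≟ k
... | yes _ = cong just (fillAllW-wkλ Ψ w)
... | no _ = refl

update-mapμ : ∀ Ψ k w → update (mapμ Ψ) k (fillAllW (mapμ Ψ) (wμ w)) ≗ mapμ (update Ψ k (fillAllW Ψ w))
update-mapμ Ψ k w j with j ≟ k
... | yes _ = cong just (fillAllW-wkμ Ψ w)
... | no _ = refl

fillAll-fill : ∀ Ψ k w t → fillAll Ψ (fill k w t) ≡ fillAll (update Ψ k (fillAllW Ψ w)) t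
fillAllE-fill : ∀ Ψ k w e → fillAllE Ψ (fillE k w e) ≡ fillAllE (update Ψ k (fillAllW Ψ w)) e
fillAll-fill Ψ k w (var x) = refl
fillAll-fill Ψ k w (lam t) = cong lam (trans (fillAll-fill (mapλ Ψ) k (wλ w) t) (fillAll-≗ (update-mapλ Ψ k w) t))
fillAll-fill Ψ k w (app t e) = cong₂ app (fillAll-fill Ψ k w t) (fillAllE-fill Ψ k w e)
fillAll-fill Ψ k w (pair t u) = cong₂ pair (fillAll-fill Ψ k w t) (fillAll-fill Ψ k w u)
fillAll-fill Ψ k w (inj i t) = cong (inj i) (fillAll-fill Ψ k w t)
fillAll-fill Ψ k w (mu t) = cong mu (trans (fillAll-fill (mapμ Ψ) k (wμ w) t) (fillAll-≗ (update-mapμ Ψ k w) t))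
fillAll-fill Ψ k w (thr a t) = cong (thr a) (fillAll-fill Ψ k w t)
fillAll-fill Ψ k w (mark j t) with j ≟ k
... | yes refl = trans (fillAll-applyW Ψ w (fill j w t)) (cong (applyW (fillAllW Ψ w)) (fillAll-fill Ψ j w t))
... | no _ = cong (fillMark j (Ψ j)) (fillAll-fill Ψ k w t)
fillAllE-fill Ψ k w (tm t) = cong tm (fillAll-fill Ψ k w t)
fillAllE-fill Ψ k w (proj i) = refl
fillAllE-fill Ψ k w (case u v) =
  cong₂ case (trans (fillAll-fill (mapλ Ψ) k (wλ w) u) (fillAll-≗ (update-mapλ Ψ k w) u))
             (trans (fillAll-fill (mapλ Ψ) k (wλ w) v) (fillAll-≗ (update-mapλ Ψ k w) v))

fillAll-empty : ∀ {Ψ} → (∀ j → Ψ j ≡ nothing) → ∀ t → fillAll Ψ t ≡ t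
fillAllE-empty : ∀ {Ψ} → (∀ j → Ψ j ≡ nothing) → ∀ e → fillAllE Ψ e ≡ e
fillAll-empty h (var x) = refl
fillAll-empty {Ψ} h (lam t) = cong lam (fillAll-empty h' t)
  where h' : ∀ j → mapλ Ψ j ≡ nothing
        h' j rewrite h j = refl
fillAll-empty h (app t e) = cong₂ app (fillAll-empty h t) (fillAllE-empty h e)
fillAll-empty h (pair t u) = cong₂ pair (fillAll-empty h t) (fillAll-empty h u)
fillAll-empty h (inj i t) = cong (inj i) (fillAll-empty h t)
fillAll-empty {Ψ} h (mu t) = cong mu (fillAll-empty h' t)
  where h' : ∀ j → mapμ Ψ j ≡ nothing
        h' j rewrite h j = refl
fillAll-empty h (thr a t) = cong (thr a) (fillAll-empty h t)
fillAll-empty {Ψ} h (mark j t) rewrite h j = cong (mark j) (fillAll-empty h t)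
fillAllE-empty h (tm t) = cong tm (fillAll-empty h t)
fillAllE-empty h (proj i) = refl
fillAllE-empty {Ψ} h (case u v) = cong₂ case (fillAll-empty h' u) (fillAll-empty h' v)
  where h' : ∀ j → mapλ Ψ j ≡ nothing
        h' j rewrite h j = refl

AllMarks : (ℕ → Set) → Tm → Set
AllMarksE : (ℕ → Set) → El → Set
AllMarks P (var x) = ⊤
AllMarks P (lam t) = AllMarks P t
AllMarks P (app t e) = AllMarks P t × AllMarksE P e
AllMarks P (pair t u) = AllMarks P t × AllMarks P u
AllMarks P (inj i t) = AllMarks P t
AllMarks P (mu t) = AllMarks P t
AllMarks P (thr a t) = AllMarks P t
AllMarks P (mark j t) = P j × AllMarks P t
AllMarksE P (tm t) = AllMarks P t
AllMarksE P (proj i) = ⊤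
AllMarksE P (case u v) = AllMarks P u × AllMarks P v

bound≤⇒AllMarks< : ∀ {b} t → bound t ≤ b → AllMarks (λ j → j < b) t
boundE≤⇒AllMarksE< : ∀ {b} e → boundE e ≤ b → AllMarksE (λ j → j < b) e
bound≤⇒AllMarks< (var x) h = _
bound≤⇒AllMarks< (lam t) h = bound≤⇒AllMarks< t h
bound≤⇒AllMarks< (app t e) h = bound≤⇒AllMarks< t (m⊔n≤o⇒m≤o (bound t) (boundE e) h) , boundE≤⇒AllMarksE< e
  (m⊔n≤o⇒n≤o (bound t) (boundE e) h)
bound≤⇒AllMarks< (pair t u) h = bound≤⇒AllMarks< t (m⊔n≤o⇒m≤o (bound t) (bound u) h) , bound≤⇒AllMarks< u
  (m⊔n≤o⇒n≤o (bound t) (bound u) h)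
bound≤⇒AllMarks< (inj i t) h = bound≤⇒AllMarks< t h
bound≤⇒AllMarks< (mu t) h = bound≤⇒AllMarks< t h
bound≤⇒AllMarks< (thr a t) h = bound≤⇒AllMarks< t h
bound≤⇒AllMarks< (mark j t) h = m⊔n≤o⇒m≤o (suc j) (bound t) h , bound≤⇒AllMarks< t (m⊔n≤o⇒n≤o (suc j) (bound t) h)
boundE≤⇒AllMarksE< (tm t) h = bound≤⇒AllMarks< t h
boundE≤⇒AllMarksE< (proj i) h = _
boundE≤⇒AllMarksE< (case u v) h = bound≤⇒AllMarks< u (m⊔n≤o⇒m≤o (bound u) (bound v) h) , bound≤⇒AllMarks< v
  (m⊔n≤o⇒n≤o (bound u) (bound v) h)

AllMarks<⇒bound≤ : ∀ {b} t → AllMarks (λ j → j < b) t → bound t ≤ b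
AllMarksE<⇒boundE≤ : ∀ {b} e → AllMarksE (λ j → j < b) e → boundE e ≤ b
AllMarks<⇒bound≤ (var x) h = z≤n
AllMarks<⇒bound≤ (lam t) h = AllMarks<⇒bound≤ t h
AllMarks<⇒bound≤ (app t e) (h , h') = ⊔-lub (AllMarks<⇒bound≤ t h) (AllMarksE<⇒boundE≤ e h')
AllMarks<⇒bound≤ (pair t u) (h , h') = ⊔-lub (AllMarks<⇒bound≤ t h) (AllMarks<⇒bound≤ u h')
AllMarks<⇒bound≤ (inj i t) h = AllMarks<⇒bound≤ t h
AllMarks<⇒bound≤ (mu t) h = AllMarks<⇒bound≤ t h
AllMarks<⇒bound≤ (thr a t) h = AllMarks<⇒bound≤ t h
AllMarks<⇒bound≤ (mark j t) (h , h') = ⊔-lub h (AllMarks<⇒bound≤ t h')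
AllMarksE<⇒boundE≤ (tm t) h = AllMarks<⇒bound≤ t h
AllMarksE<⇒boundE≤ (proj i) h = z≤n
AllMarksE<⇒boundE≤ (case u v) (h , h') = ⊔-lub (AllMarks<⇒bound≤ u h) (AllMarks<⇒bound≤ v h')

AllMarks-mono : ∀ {P P' : ℕ → Set} → (∀ {j} → P j → P' j) → ∀ t → AllMarks P t → AllMarks P' t
AllMarksE-mono : ∀ {P P' : ℕ → Set} → (∀ {j} → P j → P' j) → ∀ e → AllMarksE P e → AllMarksE P' e
AllMarks-mono f (var x) h = h
AllMarks-mono f (lam t) h = AllMarks-mono f t h
AllMarks-mono f (app t e) (h , h') = AllMarks-mono f t h , AllMarksE-mono f e h'
AllMarks-mono f (pair t u) (h , h') = AllMarks-mono f t h , AllMarks-mono f u h'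
AllMarks-mono f (inj i t) h = AllMarks-mono f t h
AllMarks-mono f (mu t) h = AllMarks-mono f t h
AllMarks-mono f (thr a t) h = AllMarks-mono f t h
AllMarks-mono f (mark j t) (h , h') = f h , AllMarks-mono f t h'
AllMarksE-mono f (tm t) h = AllMarks-mono f t h
AllMarksE-mono f (proj i) h = h
AllMarksE-mono f (case u v) (h , h') = AllMarks-mono f u h , AllMarks-mono f v h'

NoMark : Tm → Set
NoMark = AllMarks (λ _ → ⊥)
NoMarkE : El → Set
NoMarkE = AllMarksE (λ _ → ⊥)

bound≡0⇒NoMark : ∀ t → bound t ≡ 0 → NoMark t
bound≡0⇒NoMark t e = AllMarks-mono (λ { () }) t (bound≤⇒AllMarks< t (≤-reflexive' e))
  where
  ≤-reflexive' : ∀ {n} → n ≡ 0 → n ≤ 0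
  ≤-reflexive' refl = z≤n

AllMarks-renλ : ∀ {P} ρ t → AllMarks P t → AllMarks P (renλ ρ t)
AllMarksE-renλ : ∀ {P} ρ e → AllMarksE P e → AllMarksE P (renλE ρ e)
AllMarks-renλ ρ (var x) h = tt
AllMarks-renλ ρ (lam t) h = AllMarks-renλ (extρ ρ) t h
AllMarks-renλ ρ (app t e) (h , h') = AllMarks-renλ ρ t h , AllMarksE-renλ ρ e h'
AllMarks-renλ ρ (pair t u) (h , h') = AllMarks-renλ ρ t h , AllMarks-renλ ρ u h'
AllMarks-renλ ρ (inj i t) h = AllMarks-renλ ρ t h
AllMarks-renλ ρ (mu t) h = AllMarks-renλ ρ t h
AllMarks-renλ ρ (thr a t) h = AllMarks-renλ ρ t h
AllMarks-renλ ρ (mark j t) (h , h') = h , AllMarks-renλ ρ t h'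
AllMarksE-renλ ρ (tm t) h = AllMarks-renλ ρ t h
AllMarksE-renλ ρ (proj i) h = h
AllMarksE-renλ ρ (case u v) (h , h') = AllMarks-renλ (extρ ρ) u h , AllMarks-renλ (extρ ρ) v h'

AllMarks-renμ : ∀ {P} ρ t → AllMarks P t → AllMarks P (renμ ρ t)
AllMarksE-renμ : ∀ {P} ρ e → AllMarksE P e → AllMarksE P (renμE ρ e)
AllMarks-renμ ρ (var x) h = tt
AllMarks-renμ ρ (lam t) h = AllMarks-renμ ρ t h
AllMarks-renμ ρ (app t e) (h , h') = AllMarks-renμ ρ t h , AllMarksE-renμ ρ e h'
AllMarks-renμ ρ (pair t u) (h , h') = AllMarks-renμ ρ t h , AllMarks-renμ ρ u h'
AllMarks-renμ ρ (inj i t) h = AllMarks-renμ ρ t h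
AllMarks-renμ ρ (mu t) h = AllMarks-renμ (extρ ρ) t h
AllMarks-renμ ρ (thr a t) h = AllMarks-renμ ρ t h
AllMarks-renμ ρ (mark j t) (h , h') = h , AllMarks-renμ ρ t h'
AllMarksE-renμ ρ (tm t) h = AllMarks-renμ ρ t h
AllMarksE-renμ ρ (proj i) h = h
AllMarksE-renμ ρ (case u v) (h , h') = AllMarks-renμ ρ u h , AllMarks-renμ ρ v h'

AllMarks-sub : ∀ {P σ} → (∀ n → AllMarks P (σ n)) → ∀ t → AllMarks P t → AllMarks P (subλ σ t)
AllMarksE-sub : ∀ {P σ} → (∀ n → AllMarks P (σ n)) → ∀ e → AllMarksE P e → AllMarksE P (subλE σ e)
AllMarks-extσ : ∀ {P σ} → (∀ n → AllMarks P (σ n)) → ∀ n → AllMarks P (extσ σ n)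
AllMarks-extσ h zero = tt
AllMarks-extσ {σ = σ} h (suc n) = AllMarks-renλ suc (σ n) (h n)
AllMarks-sub h (var x) a = h x
AllMarks-sub h (lam t) a = AllMarks-sub (AllMarks-extσ h) t a
AllMarks-sub h (app t e) (a , b) = AllMarks-sub h t a , AllMarksE-sub h e b
AllMarks-sub h (pair t u) (a , b) = AllMarks-sub h t a , AllMarks-sub h u b
AllMarks-sub h (inj i t) a = AllMarks-sub h t a
AllMarks-sub {σ = σ} h (mu t) a = AllMarks-sub (λ n → AllMarks-renμ suc (σ n) (h n)) t a
AllMarks-sub h (thr x t) a = AllMarks-sub h t a
AllMarks-sub h (mark j t) (a , b) = a , AllMarks-sub h t b
AllMarksE-sub h (tm t) a = AllMarks-sub h t a
AllMarksE-sub h (proj i) a = a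
AllMarksE-sub h (case u v) (a , b) = AllMarks-sub (AllMarks-extσ h) u a , AllMarks-sub (AllMarks-extσ h) v b

AllMarks-[] : ∀ {P} t V → AllMarks P t → AllMarks P V → AllMarks P (t [ V ])
AllMarks-[] t V a b = AllMarks-sub h t a
  where
  h : ∀ n → AllMarks _ (σ₀ V n)
  h zero = b
  h (suc n) = tt

-- Layered mx Λ y ŷ : ŷ is y with the acceptors of segment-trees marked.  Λ a is
-- nothing (a is not bound by an element of a tree), just nothing (a tree without
-- acceptors) or just (just j) (a tree whose acceptors are marked j).  With
-- mx ≡ true the trees are maximal.
LayerEnv : Set
LayerEnv = ℕ → Maybe (Maybe ℕ)

consL : Maybe (Maybe ℕ) → LayerEnv → LayerEnv
consL x Λ zero = x
consL x Λ (suc a) = Λ a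

consL-≗ : ∀ {Λ Λ'} x → Λ ≗ Λ' → consL x Λ ≗ consL x Λ'
consL-≗ x h zero = refl
consL-≗ x h (suc a) = h a

data Layered (mx : Bool) (Λ : LayerEnv) : Tm → Tm → Set
data LayeredE (mx : Bool) (Λ : LayerEnv) : El → El → Set
data LayeredSucc (mx : Bool) (Λ : LayerEnv) (ml : Maybe ℕ) : Tm → Tm → Set
data LayeredElem (mx : Bool) (Λ : LayerEnv) (ml : Maybe ℕ) : Tm → Tm → Set

data Layered mx Λ where
  rvar  : ∀ {x} → Layered mx Λ (var x) (var x)
  rlam  : ∀ {t t̂} → Layered mx Λ t t̂ → Layered mx Λ (lam t) (lam t̂)
  rapp  : ∀ {t t̂ e ê} → Layered mx Λ t t̂ → LayeredE mx Λ e ê → Layered mx Λ (app t e) (app t̂ ê)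
  rpair : ∀ {t t̂ u û} → Layered mx Λ t t̂ → Layered mx Λ u û → Layered mx Λ (pair t u) (pair t̂ û)
  rinj  : ∀ {i t t̂} → Layered mx Λ t t̂ → Layered mx Λ (inj i t) (inj i t̂)
  rmu   : ∀ {t t̂} → Layered mx (consL nothing Λ) t t̂ → Layered mx Λ (mu t) (mu t̂)
  rthr∉ : ∀ {a t t̂} → Λ a ≡ nothing → Layered mx Λ t t̂ → Layered mx Λ (thr a t) (thr a t̂)
  rthr∈ : ∀ {a ml t t̂} → Λ a ≡ just ml → LayeredSucc mx Λ ml t t̂ → Layered mx Λ (thr a t) (thr a t̂)

data LayeredE mx Λ where
  rtm   : ∀ {t t̂} → Layered mx Λ t t̂ → LayeredE mx Λ (tm t) (tm t̂)
  rproj : ∀ {i} → LayeredE mx Λ (proj i) (proj i)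
  rcase : ∀ {u û v v̂} → Layered mx Λ u û → Layered mx Λ v v̂ → LayeredE mx Λ (case u v) (case û v̂)

data LayeredSucc mx Λ ml where
  rel  : ∀ {t t̂} → LayeredElem mx Λ ml t t̂ → LayeredSucc mx Λ ml t t̂
  racc : ∀ {j t t̂} → ml ≡ just j → (mx ≡ true → isSeg t ≡ false) → Layered mx Λ t t̂ → LayeredSucc mx Λ ml t (mark j t̂)

data LayeredElem mx Λ ml where
  relor  : ∀ {s ŝ u û v v̂} → Layered mx Λ s ŝ → LayeredSucc mx Λ ml u û → LayeredSucc mx Λ ml v v̂ →
           LayeredElem mx Λ ml (app s (case u v)) (app ŝ (case û v̂))
  relbot : ∀ {s ŝ} → Layered mx (consL (just ml) Λ) s ŝ → LayeredElem mx Λ ml (mu s) (mu ŝ)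

Layered-≗ : ∀ {mx Λ Λ' y ŷ} → Λ ≗ Λ' → Layered mx Λ y ŷ → Layered mx Λ' y ŷ
LayeredE-≗ : ∀ {mx Λ Λ' y ŷ} → Λ ≗ Λ' → LayeredE mx Λ y ŷ → LayeredE mx Λ' y ŷ
LayeredSucc-≗ : ∀ {mx Λ Λ' ml y ŷ} → Λ ≗ Λ' → LayeredSucc mx Λ ml y ŷ → LayeredSucc mx Λ' ml y ŷ
LayeredElem-≗ : ∀ {mx Λ Λ' ml y ŷ} → Λ ≗ Λ' → LayeredElem mx Λ ml y ŷ → LayeredElem mx Λ' ml y ŷ
Layered-≗ h rvar = rvar
Layered-≗ h (rlam r) = rlam (Layered-≗ h r)
Layered-≗ h (rapp r x) = rapp (Layered-≗ h r) (LayeredE-≗ h x)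
Layered-≗ h (rpair r r₁) = rpair (Layered-≗ h r) (Layered-≗ h r₁)
Layered-≗ h (rinj r) = rinj (Layered-≗ h r)
Layered-≗ h (rmu r) = rmu (Layered-≗ (consL-≗ nothing h) r)
Layered-≗ h (rthr∉ {a = a} x r) = rthr∉ (trans (sym (h a)) x) (Layered-≗ h r)
Layered-≗ h (rthr∈ {a = a} x x₁) = rthr∈ (trans (sym (h a)) x) (LayeredSucc-≗ h x₁)
LayeredE-≗ h (rtm x) = rtm (Layered-≗ h x)
LayeredE-≗ h rproj = rproj
LayeredE-≗ h (rcase x x₁) = rcase (Layered-≗ h x) (Layered-≗ h x₁)
LayeredSucc-≗ h (rel x) = rel (LayeredElem-≗ h x)
LayeredSucc-≗ h (racc e f x) = racc e f (Layered-≗ h x)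
LayeredElem-≗ h (relor x x₁ x₂) = relor (Layered-≗ h x) (LayeredSucc-≗ h x₁) (LayeredSucc-≗ h x₂)
LayeredElem-≗ h (relbot x) = relbot (Layered-≗ (consL-≗ _ h) x)

Layered-refl : ∀ {mx Λ} → (∀ a → Λ a ≡ nothing) → ∀ y → NoMark y → Layered mx Λ y y
LayeredE-refl : ∀ {mx Λ} → (∀ a → Λ a ≡ nothing) → ∀ e → NoMarkE e → LayeredE mx Λ e e
Layered-refl h (var x) nm = rvar
Layered-refl h (lam y) nm = rlam (Layered-refl h y nm)
Layered-refl h (app y e) (n1 , n2) = rapp (Layered-refl h y n1) (LayeredE-refl h e n2)
Layered-refl h (pair y y₁) (n1 , n2) = rpair (Layered-refl h y n1) (Layered-refl h y₁ n2)
Layered-refl h (inj x y) nm = rinj (Layered-refl h y nm)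
Layered-refl {Λ = Λ} h (mu y) nm = rmu (Layered-refl h' y nm)
  where h' : ∀ a → consL nothing Λ a ≡ nothing
        h' zero = refl
        h' (suc a) = h a
Layered-refl h (thr x y) nm = rthr∉ (h x) (Layered-refl h y nm)
Layered-refl h (mark x y) (() , _)
LayeredE-refl h (tm x) nm = rtm (Layered-refl h x nm)
LayeredE-refl h (proj x) nm = rproj
LayeredE-refl h (case x x₁) (n1 , n2) = rcase (Layered-refl h x n1) (Layered-refl h x₁ n2)

Layered-empty : ∀ {mx Λ y ŷ} → (∀ a → Λ a ≡ nothing) → Layered mx Λ y ŷ → ŷ ≡ y
LayeredE-empty : ∀ {mx Λ y ŷ} → (∀ a → Λ a ≡ nothing) → LayeredE mx Λ y ŷ → ŷ ≡ y
Layered-empty h rvar = refl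
Layered-empty h (rlam r) = cong lam (Layered-empty h r)
Layered-empty h (rapp r x) = cong₂ app (Layered-empty h r) (LayeredE-empty h x)
Layered-empty h (rpair r r₁) = cong₂ pair (Layered-empty h r) (Layered-empty h r₁)
Layered-empty h (rinj r) = cong (inj _) (Layered-empty h r)
Layered-empty {Λ = Λ} h (rmu r) = cong mu (Layered-empty h' r)
  where h' : ∀ a → consL nothing Λ a ≡ nothing
        h' zero = refl
        h' (suc a) = h a
Layered-empty h (rthr∉ x r) = cong (thr _) (Layered-empty h r)
Layered-empty h (rthr∈ {a = a} x x₁) with trans (sym (h a)) x
... | ()

LayeredE-empty h (rtm x) = cong tm (Layered-empty h x)
LayeredE-empty h rproj = refl
LayeredE-empty h (rcase x x₁) = cong₂ case (Layered-empty h x) (Layered-empty h x₁)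

Layered-isValue : ∀ {mx Λ y ŷ} → Layered mx Λ y ŷ → isValue ŷ ≡ isValue y
Layered-isValue rvar = refl
Layered-isValue (rlam r) = refl
Layered-isValue (rapp r x) = refl
Layered-isValue (rpair r r₁) = cong₂ _∧_ (Layered-isValue r) (Layered-isValue r₁)
Layered-isValue (rinj r) = Layered-isValue r
Layered-isValue (rmu r) = refl
Layered-isValue (rthr∉ x r) = refl
Layered-isValue (rthr∈ x x₁) = refl

Layered-isSeg : ∀ {mx Λ y ŷ} → Layered mx Λ y ŷ → isSeg ŷ ≡ isSeg y
Layered-isSeg rvar = refl
Layered-isSeg (rlam r) = refl
Layered-isSeg (rapp r (rtm x)) = refl
Layered-isSeg (rapp r rproj) = refl
Layered-isSeg (rapp r (rcase x x₁)) = refl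
Layered-isSeg (rpair r r₁) = refl
Layered-isSeg (rinj r) = refl
Layered-isSeg (rmu r) = refl
Layered-isSeg (rthr∉ x r) = refl
Layered-isSeg (rthr∈ x x₁) = refl

Layered-Value : ∀ {mx Λ y ŷ} → Layered mx Λ y ŷ → Value y → Value ŷ
Layered-Value rvar var = var
Layered-Value (rlam r) lam = lam
Layered-Value (rpair r r₁) (pair v v₁) = pair (Layered-Value r v) (Layered-Value r₁ v₁)
Layered-Value (rinj r) (inj v) = inj (Layered-Value r v)
Layered-Value (rthr∉ x r) thr = thr
Layered-Value (rthr∈ x x₁) thr = thr

Layered-Value⁻ : ∀ {mx Λ y ŷ} → Layered mx Λ y ŷ → Value ŷ → Value y
Layered-Value⁻ rvar var = var
Layered-Value⁻ (rlam r) lam = lam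
Layered-Value⁻ (rpair r r₁) (pair v v₁) = pair (Layered-Value⁻ r v) (Layered-Value⁻ r₁ v₁)
Layered-Value⁻ (rinj r) (inj v) = inj (Layered-Value⁻ r v)
Layered-Value⁻ (rthr∉ x r) thr = thr
Layered-Value⁻ (rthr∈ x x₁) thr = thr

Layered-SegTerm : ∀ {mx Λ y ŷ} → Layered mx Λ y ŷ → SegTerm y → SegTerm ŷ
Layered-SegTerm (rapp r (rcase _ _)) ∨ₛ = ∨ₛ
Layered-SegTerm (rmu r) ⊥ₛ = ⊥ₛ

LayeredElem-SegTerm : ∀ {mx Λ ml y ŷ} → LayeredElem mx Λ ml y ŷ → SegTerm y
LayeredElem-SegTerm (relor _ _ _) = ∨ₛ
LayeredElem-SegTerm (relbot _) = ⊥ₛ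

killᵐ : ℕ → Maybe ℕ → Maybe ℕ
killᵐ k nothing = nothing
killᵐ k (just j) with j ≟ k
... | yes _ = nothing
... | no _ = just j

killˣ : ℕ → Maybe (Maybe ℕ) → Maybe (Maybe ℕ)
killˣ k nothing = nothing
killˣ k (just ml) = just (killᵐ k ml)

kill : ℕ → LayerEnv → LayerEnv
kill k Λ a = killˣ k (Λ a)

kill-consL : ∀ k Λ x → kill k (consL x Λ) ≗ consL (killˣ k x) (kill k Λ)
kill-consL k Λ x zero = refl
kill-consL k Λ x (suc a) = refl

killᵐ-≢ : ∀ {j k} → j ≢ k → killᵐ k (just j) ≡ just j
killᵐ-≢ {j} {k} ne with j ≟ k
... | yes e = ⊥-elim (ne e)
... | no _ = refl

kill-just : ∀ {k Λ a ml} → Λ a ≡ just ml → kill k Λ a ≡ just (killᵐ k ml)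
kill-just {k} e = cong (killˣ k) e

kill-nothing : ∀ {k Λ a} → Λ a ≡ nothing → kill k Λ a ≡ nothing
kill-nothing {k} e = cong (killˣ k) e

Avoids : ℕ → Tm → Set
Avoids k = AllMarks (λ j → j ≢ k)

Layered-kill : ∀ {mx Λ y ŷ} k → Layered mx Λ y ŷ → Avoids k ŷ → Layered mx (kill k Λ) y ŷ
LayeredE-kill : ∀ {mx Λ y ŷ} k → LayeredE mx Λ y ŷ → AllMarksE (λ j → j ≢ k) ŷ → LayeredE mx (kill k Λ) y ŷ
LayeredSucc-kill : ∀ {mx Λ ml y ŷ} k → LayeredSucc mx Λ ml y ŷ → Avoids k ŷ → LayeredSucc mx (kill k Λ) (killᵐ k ml) y ŷ
LayeredElem-kill : ∀ {mx Λ ml y ŷ} k → LayeredElem mx Λ ml y ŷ → Avoids k ŷ → LayeredElem mx (kill k Λ) (killᵐ k ml) y ŷ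
Layered-kill k rvar nk = rvar
Layered-kill k (rlam r) nk = rlam (Layered-kill k r nk)
Layered-kill k (rapp r x) (n1 , n2) = rapp (Layered-kill k r n1) (LayeredE-kill k x n2)
Layered-kill k (rpair r r₁) (n1 , n2) = rpair (Layered-kill k r n1) (Layered-kill k r₁ n2)
Layered-kill k (rinj r) nk = rinj (Layered-kill k r nk)
Layered-kill {Λ = Λ} k (rmu r) nk = rmu (Layered-≗ (kill-consL k Λ nothing) (Layered-kill k r nk))
Layered-kill {Λ = Λ} k (rthr∉ {a = a} x r) nk = rthr∉ (kill-nothing {k} {Λ} {a} x) (Layered-kill k r nk)
Layered-kill {Λ = Λ} k (rthr∈ {a = a} x x₁) nk = rthr∈ (kill-just {k} {Λ} {a} x) (LayeredSucc-kill k x₁ nk)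
LayeredE-kill k (rtm x) nk = rtm (Layered-kill k x nk)
LayeredE-kill k rproj nk = rproj
LayeredE-kill k (rcase x x₁) (n1 , n2) = rcase (Layered-kill k x n1) (Layered-kill k x₁ n2)
LayeredSucc-kill k (rel x) nk = rel (LayeredElem-kill k x nk)
LayeredSucc-kill k (racc refl f x) (ne , nk) rewrite killᵐ-≢ {k = k} ne = racc refl f (Layered-kill k x nk)
LayeredElem-kill k (relor x x₁ x₂) (n1 , (n2 , n3)) = relor (Layered-kill k x n1) (LayeredSucc-kill k x₁ n2)
  (LayeredSucc-kill k x₂ n3)
LayeredElem-kill {Λ = Λ} {ml = ml} k (relbot x) nk = relbot (Layered-≗ (kill-consL k Λ (just ml)) (Layered-kill k x nk))

erase : ℕ → Tm → Tm
eraseE : ℕ → El → El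
erase k (var x) = var x
erase k (lam t) = lam (erase k t)
erase k (app t e) = app (erase k t) (eraseE k e)
erase k (pair t u) = pair (erase k t) (erase k u)
erase k (inj i t) = inj i (erase k t)
erase k (mu t) = mu (erase k t)
erase k (thr a t) = thr a (erase k t)
erase k (mark j t) with j ≟ k
... | yes _ = erase k t
... | no _ = mark j (erase k t)
eraseE k (tm t) = tm (erase k t)
eraseE k (proj i) = proj i
eraseE k (case u v) = case (erase k u) (erase k v)

erase-mark-≡ : ∀ k t → erase k (mark k t) ≡ erase k t
erase-mark-≡ k t with k ≟ k
... | yes _ = refl
... | no ne = ⊥-elim (ne refl)

erase-mark-≢ : ∀ {j k} t → j ≢ k → erase k (mark j t) ≡ mark j (erase k t)
erase-mark-≢ {j} {k} t ne with j ≟ k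
... | yes e = ⊥-elim (ne e)
... | no _ = refl

data LabelView (k : ℕ) : Maybe ℕ → Set where
  same : LabelView k (just k)
  other : ∀ {ml} → ml ≢ just k → LabelView k ml

labelView : ∀ k ml → LabelView k ml
labelView k nothing = other (λ ())
labelView k (just j) with j ≟ k
... | yes refl = same
... | no ne = other (λ { refl → ne refl })

dropˣ : ℕ → Maybe (Maybe ℕ) → Maybe (Maybe ℕ)
dropˣ k (just (just j)) with j ≟ k
... | yes _ = nothing
... | no _ = just (just j)
dropˣ k x = x

dropLabel : ℕ → LayerEnv → LayerEnv
dropLabel k Λ a = dropˣ k (Λ a)

dropˣ-≡ : ∀ k → dropˣ k (just (just k)) ≡ nothing
dropˣ-≡ k with k ≟ k
... | yes _ = refl
... | no ne = ⊥-elim (ne refl)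

dropˣ-≢ : ∀ {k ml} → ml ≢ just k → dropˣ k (just ml) ≡ just ml
dropˣ-≢ {k} {nothing} ne = refl
dropˣ-≢ {k} {just j} ne with j ≟ k
... | yes refl = ⊥-elim (ne refl)
... | no _ = refl

dropLabel-consL : ∀ k Λ x → dropLabel k (consL x Λ) ≗ consL (dropˣ k x) (dropLabel k Λ)
dropLabel-consL k Λ x zero = refl
dropLabel-consL k Λ x (suc a) = refl

Layered-erase : ∀ {mx Λ y ŷ} k → Layered mx Λ y ŷ → Layered mx (dropLabel k Λ) y (erase k ŷ)
LayeredE-erase : ∀ {mx Λ y ŷ} k → LayeredE mx Λ y ŷ → LayeredE mx (dropLabel k Λ) y (eraseE k ŷ)
LayeredSucc-erase-≡ : ∀ {mx Λ y ŷ} k → LayeredSucc mx Λ (just k) y ŷ → Layered mx (dropLabel k Λ) y (erase k ŷ)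
LayeredElem-erase-≡ : ∀ {mx Λ y ŷ} k → LayeredElem mx Λ (just k) y ŷ → Layered mx (dropLabel k Λ) y (erase k ŷ)
LayeredSucc-erase-≢ : ∀ {mx Λ ml y ŷ} k → ml ≢ just k → LayeredSucc mx Λ ml y ŷ
  → LayeredSucc mx (dropLabel k Λ) ml y (erase k ŷ)
LayeredElem-erase-≢ : ∀ {mx Λ ml y ŷ} k → ml ≢ just k → LayeredElem mx Λ ml y ŷ
  → LayeredElem mx (dropLabel k Λ) ml y (erase k ŷ)
Layered-erase k rvar = rvar
Layered-erase k (rlam r) = rlam (Layered-erase k r)
Layered-erase k (rapp r x) = rapp (Layered-erase k r) (LayeredE-erase k x)
Layered-erase k (rpair r r₁) = rpair (Layered-erase k r) (Layered-erase k r₁)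
Layered-erase k (rinj r) = rinj (Layered-erase k r)
Layered-erase {Λ = Λ} k (rmu r) = rmu (Layered-≗ (dropLabel-consL k Λ nothing) (Layered-erase k r))
Layered-erase k (rthr∉ x r) = rthr∉ (cong (dropˣ k) x) (Layered-erase k r)
Layered-erase k (rthr∈ {ml = ml} x x₁) with labelView k ml
... | same = rthr∉ (trans (cong (dropˣ k) x) (dropˣ-≡ k)) (LayeredSucc-erase-≡ k x₁)
... | other ne = rthr∈ (trans (cong (dropˣ k) x) (dropˣ-≢ ne)) (LayeredSucc-erase-≢ k ne x₁)
LayeredE-erase k (rtm x) = rtm (Layered-erase k x)
LayeredE-erase k rproj = rproj
LayeredE-erase k (rcase x x₁) = rcase (Layered-erase k x) (Layered-erase k x₁)
LayeredSucc-erase-≡ k (rel x) = LayeredElem-erase-≡ k x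
LayeredSucc-erase-≡ k (racc {t̂ = t̂} refl f x) rewrite erase-mark-≡ k t̂ = Layered-erase k x
LayeredElem-erase-≡ k (relor x x₁ x₂) = rapp (Layered-erase k x)
  (rcase (LayeredSucc-erase-≡ k x₁) (LayeredSucc-erase-≡ k x₂))
LayeredElem-erase-≡ {Λ = Λ} k (relbot x) =
  rmu (Layered-≗ (λ a → trans (dropLabel-consL k Λ (just (just k)) a) (h a)) (Layered-erase k x))
  where
  h : ∀ a → consL (dropˣ k (just (just k))) (dropLabel k Λ) a ≡ consL nothing (dropLabel k Λ) a
  h zero = dropˣ-≡ k
  h (suc a) = refl
LayeredSucc-erase-≢ k ne (rel x) = rel (LayeredElem-erase-≢ k ne x)
LayeredSucc-erase-≢ k ne (racc {t̂ = t̂} refl f x) rewrite erase-mark-≢ t̂ (λ e → ne (cong just e)) =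
  racc refl f (Layered-erase k x)
LayeredElem-erase-≢ k ne (relor x x₁ x₂) = relor (Layered-erase k x) (LayeredSucc-erase-≢ k ne x₁)
  (LayeredSucc-erase-≢ k ne x₂)
LayeredElem-erase-≢ {Λ = Λ} {ml = ml} k ne (relbot x) =
  relbot (Layered-≗ (λ a → trans (dropLabel-consL k Λ (just ml) a) (h a)) (Layered-erase k x))
  where
  h : ∀ a → consL (dropˣ k (just ml)) (dropLabel k Λ) a ≡ consL (just ml) (dropLabel k Λ) a
  h zero = dropˣ-≢ ne
  h (suc a) = refl

MkT-≗ : ∀ {k S S' x y} → (∀ a → S a ≡ S' a) → MkT k S x y → MkT k S' x y
MkE-≗ : ∀ {k S S' x y} → (∀ a → S a ≡ S' a) → MkE k S x y → MkE k S' x y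
MkSucc-≗ : ∀ {k S S' x y} → (∀ a → S a ≡ S' a) → MkSucc k S x y → MkSucc k S' x y
MkElem-≗ : ∀ {k S S' x y} → (∀ a → S a ≡ S' a) → MkElem k S x y → MkElem k S' x y
∷ᵇ-≗ : ∀ {S S' : ℕ → Bool} b → (∀ a → S a ≡ S' a) → ∀ a → (b ∷ᵇ S) a ≡ (b ∷ᵇ S') a
∷ᵇ-≗ b h zero = refl
∷ᵇ-≗ b h (suc a) = h a
MkT-≗ h var = var
MkT-≗ h (lam m) = lam (MkT-≗ h m)
MkT-≗ h (app m x) = app (MkT-≗ h m) (MkE-≗ h x)
MkT-≗ h (pair m m₁) = pair (MkT-≗ h m) (MkT-≗ h m₁)
MkT-≗ h (inj m) = inj (MkT-≗ h m)
MkT-≗ h (mu m) = mu (MkT-≗ (∷ᵇ-≗ false h) m)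
MkT-≗ h (thrO {a = a} x m) = thrO (trans (sym (h a)) x) (MkT-≗ h m)
MkT-≗ h (thrI {a = a} x x₁) = thrI (trans (sym (h a)) x) (MkSucc-≗ h x₁)
MkT-≗ h (mark m) = mark (MkT-≗ h m)
MkE-≗ h (tm x) = tm (MkT-≗ h x)
MkE-≗ h proj = proj
MkE-≗ h (case x x₁) = case (MkT-≗ h x) (MkT-≗ h x₁)
MkSucc-≗ h (elem x) = elem (MkElem-≗ h x)
MkSucc-≗ h (acc x) = acc (MkT-≗ h x)
MkElem-≗ h (∨e x x₁ x₂) = ∨e (MkT-≗ h x) (MkSucc-≗ h x₁) (MkSucc-≗ h x₂)
MkElem-≗ h (⊥e x) = ⊥e (MkT-≗ (∷ᵇ-≗ true h) x)

isLabel : ℕ → Maybe (Maybe ℕ) → Bool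
isLabel k (just (just j)) with j ≟ k
... | yes _ = true
... | no _ = false
isLabel k _ = false

isLabel-≡ : ∀ k → isLabel k (just (just k)) ≡ true
isLabel-≡ k with k ≟ k
... | yes _ = refl
... | no ne = ⊥-elim (ne refl)

isLabel-≢ : ∀ {k ml} → ml ≢ just k → isLabel k (just ml) ≡ false
isLabel-≢ {k} {nothing} ne = refl
isLabel-≢ {k} {just j} ne with j ≟ k
... | yes refl = ⊥-elim (ne refl)
... | no _ = refl

layerOf : ℕ → LayerEnv → ℕ → Bool
layerOf k Λ a = isLabel k (Λ a)

Layered-MkT : ∀ {mx Λ y ŷ} k → Layered mx Λ y ŷ → MkT k (layerOf k Λ) (erase k ŷ) ŷ
LayeredE-MkE : ∀ {mx Λ y ŷ} k → LayeredE mx Λ y ŷ → MkE k (layerOf k Λ) (eraseE k ŷ) ŷ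
LayeredSucc-MkSucc : ∀ {mx Λ y ŷ} k → LayeredSucc mx Λ (just k) y ŷ → MkSucc k (layerOf k Λ) (erase k ŷ) ŷ
LayeredElem-MkElem : ∀ {mx Λ y ŷ} k → LayeredElem mx Λ (just k) y ŷ → MkElem k (layerOf k Λ) (erase k ŷ) ŷ
LayeredSucc-MkT : ∀ {mx Λ ml y ŷ} k → ml ≢ just k → LayeredSucc mx Λ ml y ŷ → MkT k (layerOf k Λ) (erase k ŷ) ŷ
Layered-MkT k rvar = var
Layered-MkT k (rlam r) = lam (Layered-MkT k r)
Layered-MkT k (rapp r x) = app (Layered-MkT k r) (LayeredE-MkE k x)
Layered-MkT k (rpair r r₁) = pair (Layered-MkT k r) (Layered-MkT k r₁)
Layered-MkT k (rinj r) = inj (Layered-MkT k r)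
Layered-MkT {Λ = Λ} k (rmu r) = mu (MkT-≗ h (Layered-MkT k r))
  where
  h : ∀ a → layerOf k (consL nothing Λ) a ≡ (false ∷ᵇ layerOf k Λ) a
  h zero = refl
  h (suc a) = refl
Layered-MkT k (rthr∉ x r) = thrO (cong (isLabel k) x) (Layered-MkT k r)
Layered-MkT k (rthr∈ {ml = ml} x x₁) with labelView k ml
... | same = thrI (trans (cong (isLabel k) x) (isLabel-≡ k)) (LayeredSucc-MkSucc k x₁)
... | other ne = thrO (trans (cong (isLabel k) x) (isLabel-≢ ne)) (LayeredSucc-MkT k ne x₁)
LayeredE-MkE k (rtm x) = tm (Layered-MkT k x)
LayeredE-MkE k rproj = proj
LayeredE-MkE k (rcase x x₁) = case (Layered-MkT k x) (Layered-MkT k x₁)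
LayeredSucc-MkSucc k (rel x) = elem (LayeredElem-MkElem k x)
LayeredSucc-MkSucc k (racc {t̂ = t̂} refl f x) rewrite erase-mark-≡ k t̂ = acc (Layered-MkT k x)
LayeredElem-MkElem k (relor x x₁ x₂) = ∨e (Layered-MkT k x) (LayeredSucc-MkSucc k x₁) (LayeredSucc-MkSucc k x₂)
LayeredElem-MkElem {Λ = Λ} k (relbot x) = ⊥e (MkT-≗ h (Layered-MkT k x))
  where
  h : ∀ a → layerOf k (consL (just (just k)) Λ) a ≡ (true ∷ᵇ layerOf k Λ) a
  h zero = isLabel-≡ k
  h (suc a) = refl
LayeredSucc-MkT k ne (rel (relor x x₁ x₂)) = app (Layered-MkT k x) (case (LayeredSucc-MkT k ne x₁) (LayeredSucc-MkT k ne x₂))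
LayeredSucc-MkT {Λ = Λ} {ml = ml} k ne (rel (relbot x)) = mu (MkT-≗ h (Layered-MkT k x))
  where
  h : ∀ a → layerOf k (consL (just ml) Λ) a ≡ (false ∷ᵇ layerOf k Λ) a
  h zero = isLabel-≢ ne
  h (suc a) = refl
LayeredSucc-MkT k ne (racc {t̂ = t̂} refl f x) rewrite erase-mark-≢ t̂ (λ e → ne (cong just e)) = mark (Layered-MkT k x)

addLayer : ℕ → (ℕ → Bool) → LayerEnv → LayerEnv
addLayer k S Λ a = if S a then just (just k) else Λ a

Disjoint : (ℕ → Bool) → LayerEnv → Set
Disjoint S Λ = ∀ a → S a ≡ true → Λ a ≡ nothing

Disjoint-∷false : ∀ {S Λ} x → Disjoint S Λ → Disjoint (false ∷ᵇ S) (consL x Λ)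
Disjoint-∷false x c zero ()
Disjoint-∷false x c (suc a) e = c a e

Disjoint-∷true : ∀ {S Λ} → Disjoint S Λ → Disjoint (true ∷ᵇ S) (consL nothing Λ)
Disjoint-∷true c zero e = refl
Disjoint-∷true c (suc a) e = c a e

addLayer-∷false : ∀ k S Λ x → addLayer k (false ∷ᵇ S) (consL x Λ) ≗ consL x (addLayer k S Λ)
addLayer-∷false k S Λ x zero = refl
addLayer-∷false k S Λ x (suc a) = refl

addLayer-∷true : ∀ k S Λ → addLayer k (true ∷ᵇ S) (consL nothing Λ) ≗ consL (just (just k)) (addLayer k S Λ)
addLayer-∷true k S Λ zero = refl
addLayer-∷true k S Λ (suc a) = refl

addLayer-false : ∀ k S Λ a → S a ≡ false → addLayer k S Λ a ≡ Λ a
addLayer-false k S Λ a e rewrite e = refl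

addLayer-true : ∀ k S Λ a → S a ≡ true → addLayer k S Λ a ≡ just (just k)
addLayer-true k S Λ a e rewrite e = refl

Layered-addLayer : ∀ {Λ y ŷ ỹ k S} → Layered false Λ y ŷ → MkT k S ŷ ỹ → Disjoint S Λ → Layered false (addLayer k S Λ) y ỹ
LayeredE-addLayer : ∀ {Λ y ŷ ỹ k S} → LayeredE false Λ y ŷ → MkE k S ŷ ỹ → Disjoint S Λ → LayeredE false (addLayer k S Λ) y ỹ
LayeredSucc-addLayer : ∀ {Λ ml y ŷ ỹ k S} → LayeredSucc false Λ ml y ŷ → MkT k S ŷ ỹ → Disjoint S Λ
  → LayeredSucc false (addLayer k S Λ) ml y ỹ
LayeredElem-addLayer : ∀ {Λ ml y ŷ ỹ k S} → LayeredElem false Λ ml y ŷ → MkT k S ŷ ỹ → Disjoint S Λ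
  → LayeredElem false (addLayer k S Λ) ml y ỹ
Layered-addLayerSucc : ∀ {Λ y ŷ ỹ k S} → Layered false Λ y ŷ → MkSucc k S ŷ ỹ → Disjoint S Λ
  → LayeredSucc false (addLayer k S Λ) (just k) y ỹ
Layered-addLayerElem : ∀ {Λ y ŷ ỹ k S} → Layered false Λ y ŷ → MkElem k S ŷ ỹ → Disjoint S Λ
  → LayeredElem false (addLayer k S Λ) (just k) y ỹ
Layered-addLayer rvar var c = rvar
Layered-addLayer (rlam r) (lam m) c = rlam (Layered-addLayer r m c)
Layered-addLayer (rapp r x) (app m x₁) c = rapp (Layered-addLayer r m c) (LayeredE-addLayer x x₁ c)
Layered-addLayer (rpair r r₁) (pair m m₁) c = rpair (Layered-addLayer r m c) (Layered-addLayer r₁ m₁ c)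
Layered-addLayer (rinj r) (inj m) c = rinj (Layered-addLayer r m c)
Layered-addLayer {Λ = Λ} {k = k} {S = S} (rmu r) (mu m) c = rmu
  (Layered-≗ (addLayer-∷false k S Λ nothing) (Layered-addLayer r m (Disjoint-∷false nothing c)))
Layered-addLayer {Λ = Λ} {k = k} {S = S} (rthr∉ {a = a} x r) (thrO x₁ m) c =
  rthr∉ (trans (addLayer-false k S Λ a x₁) x) (Layered-addLayer r m c)
Layered-addLayer {Λ = Λ} {k = k} {S = S} (rthr∉ {a = a} x r) (thrI x₁ x₂) c =
  rthr∈ (addLayer-true k S Λ a x₁) (Layered-addLayerSucc r x₂ c)
Layered-addLayer {Λ = Λ} {k = k} {S = S} (rthr∈ {a = a} x x₁) (thrO x₂ m) c =
  rthr∈ (trans (addLayer-false k S Λ a x₂) x) (LayeredSucc-addLayer x₁ m c)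
Layered-addLayer (rthr∈ {a = a} x x₁) (thrI x₂ x₃) c with trans (sym x) (c a x₂)
... | ()
LayeredE-addLayer (rtm x) (tm x₁) c = rtm (Layered-addLayer x x₁ c)
LayeredE-addLayer rproj proj c = rproj
LayeredE-addLayer (rcase x x₁) (case x₂ x₃) c = rcase (Layered-addLayer x x₂ c) (Layered-addLayer x₁ x₃ c)
LayeredSucc-addLayer (rel x) m c = rel (LayeredElem-addLayer x m c)
LayeredSucc-addLayer (racc e f x) (mark m) c = racc e f (Layered-addLayer x m c)
LayeredElem-addLayer (relor x x₁ x₂) (app m (case x₃ x₄)) c = relor (Layered-addLayer x m c) (LayeredSucc-addLayer x₁ x₃ c)
  (LayeredSucc-addLayer x₂ x₄ c)
LayeredElem-addLayer {Λ = Λ} {ml = ml} {k = k} {S = S} (relbot x) (mu m) c =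
  relbot (Layered-≗ (addLayer-∷false k S Λ (just ml)) (Layered-addLayer x m (Disjoint-∷false (just ml) c)))
Layered-addLayerSucc r (elem x) c = rel (Layered-addLayerElem r x c)
Layered-addLayerSucc r (acc x) c = racc refl (λ ()) (Layered-addLayer r x c)
Layered-addLayerElem (rapp r (rcase x x₁)) (∨e x₂ x₃ x₄) c = relor (Layered-addLayer r x₂ c) (Layered-addLayerSucc x x₃ c)
  (Layered-addLayerSucc x₁ x₄ c)
Layered-addLayerElem {Λ = Λ} {k = k} {S = S} (rmu r) (⊥e x) c =
  relbot (Layered-≗ (addLayer-∷true k S Λ) (Layered-addLayer r x (Disjoint-∷true c)))

Layered-mmT : ∀ {Λ y ŷ} k S → Layered true Λ y ŷ → Disjoint S Λ → Layered true (addLayer k S Λ) y (mmT k S ŷ)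
LayeredE-mmE : ∀ {Λ y ŷ} k S → LayeredE true Λ y ŷ → Disjoint S Λ → LayeredE true (addLayer k S Λ) y (mmE k S ŷ)
LayeredSucc-mmT : ∀ {Λ ml y ŷ} k S → LayeredSucc true Λ ml y ŷ → Disjoint S Λ
  → LayeredSucc true (addLayer k S Λ) ml y (mmT k S ŷ)
Layered-mmSucc : ∀ {Λ y ŷ} k S → Layered true Λ y ŷ → Disjoint S Λ
  → LayeredSucc true (addLayer k S Λ) (just k) y (mmSucc k S ŷ)
Layered-mmT k S rvar c = rvar
Layered-mmT k S (rlam r) c = rlam (Layered-mmT k S r c)
Layered-mmT k S (rapp r x) c = rapp (Layered-mmT k S r c) (LayeredE-mmE k S x c)
Layered-mmT k S (rpair r r₁) c = rpair (Layered-mmT k S r c) (Layered-mmT k S r₁ c)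
Layered-mmT k S (rinj r) c = rinj (Layered-mmT k S r c)
Layered-mmT {Λ = Λ} k S (rmu r) c = rmu
  (Layered-≗ (addLayer-∷false k S Λ nothing) (Layered-mmT k (false ∷ᵇ S) r (Disjoint-∷false nothing c)))
Layered-mmT {Λ = Λ} k S (rthr∉ {a = a} x r) c with S a in eq
... | true = rthr∈ (addLayer-true k S Λ a eq) (Layered-mmSucc k S r c)
... | false = rthr∉ (trans (addLayer-false k S Λ a eq) x) (Layered-mmT k S r c)
Layered-mmT {Λ = Λ} k S (rthr∈ {a = a} x x₁) c with S a in eq
... | true with trans (sym x) (c a eq)
...   | ()
Layered-mmT {Λ = Λ} k S (rthr∈ {a = a} x x₁) c | false = rthr∈ (trans (addLayer-false k S Λ a eq) x)
  (LayeredSucc-mmT k S x₁ c)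
LayeredE-mmE k S (rtm x) c = rtm (Layered-mmT k S x c)
LayeredE-mmE k S rproj c = rproj
LayeredE-mmE k S (rcase x x₁) c = rcase (Layered-mmT k S x c) (Layered-mmT k S x₁ c)
LayeredSucc-mmT k S (rel (relor x x₁ x₂)) c = rel
  (relor (Layered-mmT k S x c) (LayeredSucc-mmT k S x₁ c) (LayeredSucc-mmT k S x₂ c))
LayeredSucc-mmT {Λ = Λ} {ml = ml} k S (rel (relbot x)) c =
  rel (relbot (Layered-≗ (addLayer-∷false k S Λ (just ml)) (Layered-mmT k (false ∷ᵇ S) x (Disjoint-∷false (just ml) c))))
LayeredSucc-mmT k S (racc e f x) c = racc e f (Layered-mmT k S x c)
Layered-mmSucc k S r@rvar c = racc refl (λ _ → refl) (Layered-mmT k S r c)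
Layered-mmSucc k S r@(rlam _) c = racc refl (λ _ → refl) (Layered-mmT k S r c)
Layered-mmSucc k S r@(rapp _ (rtm _)) c = racc refl (λ _ → refl) (Layered-mmT k S r c)
Layered-mmSucc k S r@(rapp _ rproj) c = racc refl (λ _ → refl) (Layered-mmT k S r c)
Layered-mmSucc k S (rapp r (rcase x x₁)) c = rel
  (relor (Layered-mmT k S r c) (Layered-mmSucc k S x c) (Layered-mmSucc k S x₁ c))
Layered-mmSucc k S r@(rpair _ _) c = racc refl (λ _ → refl) (Layered-mmT k S r c)
Layered-mmSucc k S r@(rinj _) c = racc refl (λ _ → refl) (Layered-mmT k S r c)
Layered-mmSucc {Λ = Λ} k S (rmu r) c = rel
  (relbot (Layered-≗ (addLayer-∷true k S Λ) (Layered-mmT k (true ∷ᵇ S) r (Disjoint-∷true c))))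
Layered-mmSucc k S r@(rthr∉ _ _) c = racc refl (λ _ → refl) (Layered-mmT k S r c)
Layered-mmSucc k S r@(rthr∈ _ _) c = racc refl (λ _ → refl) (Layered-mmT k S r c)

NoDeadLayer : LayerEnv → Set
NoDeadLayer Λ = ∀ a → Λ a ≡ just nothing → ⊥

NoDeadLayer-consL : ∀ {Λ} → NoDeadLayer Λ → NoDeadLayer (consL nothing Λ)
NoDeadLayer-consL h zero ()
NoDeadLayer-consL h (suc a) e = h a e

canonical : ∀ {Λ} → NoDeadLayer Λ → ∀ y → NoMark y → Σ Tm (Layered false Λ y)
canonicalE : ∀ {Λ} → NoDeadLayer Λ → ∀ e → NoMarkE e → Σ El (LayeredE false Λ e)
canonical h (var x) nm = var x , rvar
canonical h (lam y) nm with canonical h y nm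
... | ŷ , r = lam ŷ , rlam r
canonical h (app y e) (n1 , n2) with canonical h y n1 | canonicalE h e n2
... | ŷ , r | ê , re = app ŷ ê , rapp r re
canonical h (pair y y₁) (n1 , n2) with canonical h y n1 | canonical h y₁ n2
... | ŷ , r | ŷ₁ , r₁ = pair ŷ ŷ₁ , rpair r r₁
canonical h (inj x y) nm with canonical h y nm
... | ŷ , r = inj x ŷ , rinj r
canonical h (mu y) nm with canonical (NoDeadLayer-consL h) y nm
... | ŷ , r = mu ŷ , rmu r
canonical {Λ} h (thr a y) nm with Λ a in eq | canonical h y nm
... | nothing | ŷ , r = thr a ŷ , rthr∉ eq r
... | just nothing | _ = ⊥-elim (h a eq)
... | just (just j) | ŷ , r = thr a (mark j ŷ) , rthr∈ eq (racc refl (λ ()) r)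
canonical h (mark j y) (() , _)
canonicalE h (tm x) nm with canonical h x nm
... | ŷ , r = tm ŷ , rtm r
canonicalE h (proj x) nm = proj x , rproj
canonicalE h (case u v) (n1 , n2) with canonical h u n1 | canonical h v n2
... | û , r | v̂ , r' = case û v̂ , rcase r r'

canonicalSucc : ∀ {Λ} → NoDeadLayer Λ → ∀ j y → NoMark y → Σ Tm (LayeredSucc false Λ (just j) y)
canonicalSucc h j y nm with canonical h y nm
... | ŷ , r = mark j ŷ , racc refl (λ ()) r

-- From parallel reduction to the label-free relation

-- Consistent Γ Λ Ψ : filling the labels of Λ by Ψ yields the wrappers of Γ.
data ConsistentAt (Ψ : Env) : Maybe Wrap → Maybe (Maybe ℕ) → Set where
  cN : ConsistentAt Ψ nothing nothing
  cD : ∀ {w} → ConsistentAt Ψ (just w) (just nothing)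
  cL : ∀ {w j} → Ψ j ≡ just w → ConsistentAt Ψ (just w) (just (just j))

record Consistent (Γ : Env) (Λ : LayerEnv) (Ψ : Env) : Set where
  constructor consistent
  field consistentAt : ∀ a → ConsistentAt Ψ (Γ a) (Λ a)
open Consistent

ConsistentAt-λ : ∀ {Ψ g l} → ConsistentAt Ψ g l → ConsistentAt (mapλ Ψ) (mmap wλ g) l
ConsistentAt-λ cN = cN
ConsistentAt-λ cD = cD
ConsistentAt-λ (cL e) = cL (cong (mmap wλ) e)

ConsistentAt-μ : ∀ {Ψ g l} → ConsistentAt Ψ g l → ConsistentAt (mapμ Ψ) (mmap wμ g) l
ConsistentAt-μ cN = cN
ConsistentAt-μ cD = cD
ConsistentAt-μ (cL e) = cL (cong (mmap wμ) e)

Consistent-λ : ∀ {Γ Λ Ψ} → Consistent Γ Λ Ψ → Consistent (mapλ Γ) Λ (mapλ Ψ)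
consistentAt (Consistent-λ c) a = ConsistentAt-λ (consistentAt c a)

Consistent-μ : ∀ {Γ Λ Ψ x y} → ConsistentAt (mapμ Ψ) x y → Consistent Γ Λ Ψ → Consistent (consμ x Γ) (consL y Λ) (mapμ Ψ)
consistentAt (Consistent-μ c0 c) zero = c0
consistentAt (Consistent-μ c0 c) (suc a) = ConsistentAt-μ (consistentAt c a)

update-≢ : ∀ Ψ {k j} w → j ≢ k → update Ψ k w j ≡ Ψ j
update-≢ Ψ {k} {j} w ne with j ≟ k
... | yes e = ⊥-elim (ne e)
... | no _ = refl

update-≡ : ∀ Ψ k w → update Ψ k w k ≡ just w
update-≡ Ψ k w with k ≟ k
... | yes _ = refl
... | no ne = ⊥-elim (ne refl)

ConsistentAt-kill : ∀ {Ψ g l} k w → ConsistentAt Ψ g l → ConsistentAt (update Ψ k w) g (killˣ k l)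
ConsistentAt-kill k w cN = cN
ConsistentAt-kill k w cD = cD
ConsistentAt-kill {Ψ} k w (cL {j = j} e) with j ≟ k
... | yes _ = cD
... | no ne = cL (trans (update-≢ Ψ w ne) e)

Consistent-kill : ∀ {Γ Λ Ψ} k w → Consistent Γ Λ Ψ → Consistent Γ (kill k Λ) (update Ψ k w)
consistentAt (Consistent-kill k w c) a = ConsistentAt-kill k w (consistentAt c a)

ConsistentAt-nothing : ∀ {Ψ g l} → ConsistentAt Ψ g l → l ≡ nothing → g ≡ nothing
ConsistentAt-nothing cN e = refl
ConsistentAt-nothing cD ()
ConsistentAt-nothing (cL x) ()

LabelWraps : Env → Maybe ℕ → Wrap → Set
LabelWraps Ψ ml w = ∀ j → ml ≡ just j → Ψ j ≡ just w

ConsistentAt-just : ∀ {Ψ g l ml} → ConsistentAt Ψ g l → l ≡ just ml → Σ Wrap λ w → g ≡ just w × LabelWraps Ψ ml w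
ConsistentAt-just cD refl = _ , refl , λ j ()
ConsistentAt-just (cL e) refl = _ , refl , λ { j refl → e }

Disjoint-none : ∀ Λ → Disjoint noneᵇ Λ
Disjoint-none Λ a ()

bound≤⇒Avoids : ∀ {k} t → bound t ≤ k → Avoids k t
bound≤⇒Avoids t b = AllMarks-mono <⇒≢ t (bound≤⇒AllMarks< t b)

segTree-layer : ∀ {Λ s ŝ s̃ k} → Layered false Λ s ŝ → bound ŝ ≤ k → SegTree k ŝ s̃
  → LayeredElem false (kill k Λ) (just k) s s̃
segTree-layer {Λ} {ŝ = ŝ} {k = k} r b st =
  Layered-addLayerElem (Layered-kill k r (bound≤⇒Avoids ŝ b)) st (Disjoint-none (kill k Λ))

Layered-sel : ∀ {mx Λ a b â b̂} i → Layered mx Λ a â → Layered mx Λ b b̂ → Layered mx Λ (sel i a b) (sel i â b̂)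
Layered-sel ι₁ r r' = r
Layered-sel ι₂ r r' = r'

LayeredSucc-sel : ∀ {mx Λ ml a b â b̂} i → LayeredSucc mx Λ ml a â → LayeredSucc mx Λ ml b b̂
  → LayeredSucc mx Λ ml (sel i a b) (sel i â b̂)
LayeredSucc-sel ι₁ r r' = r
LayeredSucc-sel ι₂ r r' = r'

LabelWraps-λ : ∀ {Ψ ml w} → LabelWraps Ψ ml w → LabelWraps (mapλ Ψ) ml (wλ w)
LabelWraps-λ h j e = cong (mmap wλ) (h j e)

ConsistentAt-wμ : ∀ {Ψ ml w} → LabelWraps Ψ ml w → ConsistentAt (mapμ Ψ) (just (wμ w)) (just ml)
ConsistentAt-wμ {ml = nothing} h = cD
ConsistentAt-wμ {ml = just j} h = cL (cong (mmap wμ) (h j refl))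

≻⇒Par : ∀ {Γ Λ Ψ x x̂ x̂'} → Consistent Γ Λ Ψ → Layered false Λ x x̂ → x̂ ≻ x̂' → Par Γ x (fillAll Ψ x̂')
≻ₑ⇒ParE : ∀ {Γ Λ Ψ x x̂ x̂'} → Consistent Γ Λ Ψ → LayeredE false Λ x x̂ → x̂ ≻ₑ x̂' → ParE Γ x (fillAllE Ψ x̂')
≻⇒ParSeg : ∀ {Γ Λ Ψ ml w x x̂ x̂'} → Consistent Γ Λ Ψ → LabelWraps Ψ ml w →
      LayeredSucc false Λ ml x x̂ → x̂ ≻ x̂' → ParSeg Γ w x (fillAll Ψ x̂')
≻⇒ParSegElem : ∀ {Γ Λ Ψ ml w x x̂ x̂'} → Consistent Γ Λ Ψ → LabelWraps Ψ ml w →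
       LayeredElem false Λ ml x x̂ → x̂ ≻ x̂' → ParSeg Γ w x (fillAll Ψ x̂')

≻⇒Par c rvar var = var
≻⇒Par c (rlam r) (lam d) = lam (≻⇒Par (Consistent-λ c) r d)
≻⇒Par c (rmu r) (mu d) = mu (≻⇒Par (Consistent-μ cN c) r d)
≻⇒Par c (rthr∉ {a = a} e r) (thr d) = thr∉ (ConsistentAt-nothing (consistentAt c a) e) (≻⇒Par c r d)
≻⇒Par c (rthr∈ {a = a} e rs) (thr d) with ConsistentAt-just (consistentAt c a) e
... | w , eg , hj = thr∈ eg (≻⇒ParSeg c hj rs d)
≻⇒Par c (rinj r) (inj d) = inj (≻⇒Par c r d)
≻⇒Par c (rpair r r₁) (pair d d₁) = pair (≻⇒Par c r d) (≻⇒Par c r₁ d₁)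
≻⇒Par c (rapp r re) (app d de) = app (≻⇒Par c r d) (≻ₑ⇒ParE c re de)
≻⇒Par {Ψ = Ψ} c (rapp (rlam rb) (rtm rV)) (β {t' = t'} {V' = V'} v db dV) =
  Par-substʳ (sym (fillAll-[] Ψ t' V')) (β (Layered-Value⁻ rV v) (≻⇒Par (Consistent-λ c) rb db) (≻⇒Par c rV dV))
≻⇒Par c (rapp (rpair r1 r2) rproj) (π {i = i} v1 v2 d) =
  π (Layered-Value⁻ r1 v1) (Layered-Value⁻ r2 v2) (≻⇒Par c (Layered-sel i r1 r2) d)
≻⇒Par {Ψ = Ψ} c (rapp (rinj rV) (rcase r1 r2)) (ω {i = i} {V' = V'} {u' = u'} v dV d) =
  Par-substʳ (sym (fillAll-[] Ψ u' V'))
    (ω (Layered-Value⁻ rV v) (≻⇒Par c rV dV) (≻⇒Par (Consistent-λ c) (Layered-sel i r1 r2) d))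
≻⇒Par {Ψ = Ψ} c (rapp rV (rtm rs)) (segV {V' = V'} {t̂' = t̂'} {k = k} v dV b st d1) =
  Par-substʳ (sym (fillAll-fill Ψ k (wl V') t̂'))
    (segV (Layered-Value⁻ rV v) (≻⇒Par c rV dV) (LayeredElem-SegTerm (segTree-layer rs b st))
      (≻⇒ParSegElem (Consistent-kill k (wl (fillAll Ψ V')) c) (λ { j refl → update-≡ Ψ k _ }) (segTree-layer rs b st) d1))
≻⇒Par {Ψ = Ψ} c (rapp rt re) (segE {e' = e'} {t̂' = t̂'} {k = k} de b st d1) =
  Par-substʳ (sym (fillAll-fill Ψ k (wr e') t̂'))
    (segE (≻ₑ⇒ParE c re de) (LayeredElem-SegTerm (segTree-layer rt b st))
      (≻⇒ParSegElem (Consistent-kill k (wr (fillAllE Ψ e')) c) (λ { j refl → update-≡ Ψ k _ }) (segTree-layer rt b st) d1))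

≻ₑ⇒ParE c (rtm x) (tm d) = tm (≻⇒Par c x d)
≻ₑ⇒ParE c rproj proj = proj
≻ₑ⇒ParE c (rcase x x₁) (case d d₁) = case (≻⇒Par (Consistent-λ c) x d) (≻⇒Par (Consistent-λ c) x₁ d₁)

≻⇒ParSeg {Ψ = Ψ} c hj (racc {j = j} refl f r) (mark {t' = t'} d) rewrite hj j refl = acc (≻⇒Par c r d)
≻⇒ParSeg c hj (rel x) d = ≻⇒ParSegElem c hj x d

≻⇒ParSegElem c hj (relor rs ru rv) (app d (case du dv)) =
  ∨seg (≻⇒Par c rs d) (≻⇒ParSeg (Consistent-λ c) (LabelWraps-λ hj) ru du) (≻⇒ParSeg (Consistent-λ c) (LabelWraps-λ hj) rv dv)
≻⇒ParSegElem {Ψ = Ψ} {w = w} c hj (relor (rinj rV) ru rv) (ω {i = i} {V' = V'} {u' = u'} v dV d) =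
  ParSeg-substʳ (sym (fillAll-[] Ψ u' V'))
    (ωseg (Layered-Value⁻ rV v) (≻⇒Par c rV dV) (≻⇒ParSeg (Consistent-λ c) (LabelWraps-λ hj) (LayeredSucc-sel i ru rv) d))
≻⇒ParSegElem {Ψ = Ψ} c hj (relor rs ru rv) (segE {e' = case u' v'} {t̂' = t̂'} {k = k} (case du dv) b st d1) =
  ParSeg-substʳ (sym (fillAll-fill Ψ k (wr (case u' v')) t̂'))
    (nest (LayeredElem-SegTerm (segTree-layer rs b st)) (≻⇒ParSeg (Consistent-λ c) (LabelWraps-λ hj) ru du)
      (≻⇒ParSeg (Consistent-λ c) (LabelWraps-λ hj) rv dv)
      (≻⇒ParSegElem (Consistent-kill k (wr (fillAllE Ψ (case u' v'))) c) (λ { j refl → update-≡ Ψ k _ })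
        (segTree-layer rs b st) d1))
≻⇒ParSegElem c hj (relbot r) (mu d) = ⊥seg (≻⇒Par (Consistent-μ (ConsistentAt-wμ hj) c) r d)

Consistent-empty : Consistent ∅ ∅ ∅
consistentAt Consistent-empty a = cN

≻⇒Par-closed : ∀ {t t'} → NoMark t → t ≻ t' → Par ∅ t t'
≻⇒Par-closed {t} {t'} nm d =
  Par-substʳ (fillAll-empty (λ _ → refl) t') (≻⇒Par Consistent-empty (Layered-refl (λ _ → refl) t nm) d)

-- From the label-free relation back to parallel reduction

NoMarkW : Wrap → Set
NoMarkW (wl V) = NoMark V
NoMarkW (wr e) = NoMarkE e

NoMarkW-λ : ∀ w → NoMarkW w → NoMarkW (wλ w)
NoMarkW-λ (wl V) h = AllMarks-renλ suc V h
NoMarkW-λ (wr e) h = AllMarksE-renλ suc e h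

NoMarkW-μ : ∀ w → NoMarkW w → NoMarkW (wμ w)
NoMarkW-μ (wl V) h = AllMarks-renμ suc V h
NoMarkW-μ (wr e) h = AllMarksE-renμ suc e h

NoMarkEnv : Env → Set
NoMarkEnv Γ = ∀ a w → Γ a ≡ just w → NoMarkW w

NoMarkEnv-λ : ∀ {Γ} → NoMarkEnv Γ → NoMarkEnv (mapλ Γ)
NoMarkEnv-λ {Γ} h a w e with Γ a in eq
NoMarkEnv-λ {Γ} h a .(wλ w') refl | just w' = NoMarkW-λ w' (h a w' eq)

NoMarkEnv-μ : ∀ {Γ x} → (∀ w → x ≡ just w → NoMarkW w) → NoMarkEnv Γ → NoMarkEnv (consμ x Γ)
NoMarkEnv-μ h0 h zero w e = h0 w e
NoMarkEnv-μ {Γ} h0 h (suc a) w e with Γ a in eq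
NoMarkEnv-μ {Γ} h0 h (suc a) .(wμ w') refl | just w' = NoMarkW-μ w' (h a w' eq)

NoMark-sel : ∀ i a b → NoMark a → NoMark b → NoMark (sel i a b)
NoMark-sel ι₁ a b h h' = h
NoMark-sel ι₂ a b h h' = h'

NoMark-applyW : ∀ w t → NoMarkW w → NoMark t → NoMark (applyW w t)
NoMark-applyW (wl V) t h h' = h , h'
NoMark-applyW (wr e) t h h' = h' , h

Par-NoMark : ∀ {Γ y z} → NoMarkEnv Γ → NoMark y → Par Γ y z → NoMark z
ParE-NoMark : ∀ {Γ y z} → NoMarkEnv Γ → NoMarkE y → ParE Γ y z → NoMarkE z
ParSeg-NoMark : ∀ {Γ w y z} → NoMarkEnv Γ → NoMarkW w → NoMark y → ParSeg Γ w y z → NoMark z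
Par-NoMark h n var = tt
Par-NoMark h n (lam q) = Par-NoMark (NoMarkEnv-λ h) n q
Par-NoMark h n (mu q) = Par-NoMark (NoMarkEnv-μ (λ w ()) h) n q
Par-NoMark h n (thr∉ x q) = Par-NoMark h n q
Par-NoMark h n (thr∈ {a = a} {w = w} x x₁) = ParSeg-NoMark h (h a w x) n x₁
Par-NoMark h n (inj q) = Par-NoMark h n q
Par-NoMark h (n1 , n2) (pair q q₁) = Par-NoMark h n1 q , Par-NoMark h n2 q₁
Par-NoMark h (n1 , n2) (app q x) = Par-NoMark h n1 q , ParE-NoMark h n2 x
Par-NoMark h (n1 , n2) (β {t' = t'} {V' = V'} x q q₁) = AllMarks-[] t' V' (Par-NoMark (NoMarkEnv-λ h) n1 q)
  (Par-NoMark h n2 q₁)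
Par-NoMark h ((n1 , n2) , _) (π {i = i} {V₁ = V₁} {V₂ = V₂} x x₁ q) = Par-NoMark h (NoMark-sel i V₁ V₂ n1 n2) q
Par-NoMark h (n1 , (n2 , n3)) (ω {i = i} {V' = V'} {u₁ = u₁} {u₂ = u₂} {u' = u'} x q q₁) =
  AllMarks-[] u' V' (Par-NoMark (NoMarkEnv-λ h) (NoMark-sel i u₁ u₂ n2 n3) q₁) (Par-NoMark h n1 q)
Par-NoMark h (n1 , n2) (segV x q x₁ x₂) = ParSeg-NoMark h (Par-NoMark h n1 q) n2 x₂
Par-NoMark h (n1 , n2) (segE x x₁ x₂) = ParSeg-NoMark h (ParE-NoMark h n2 x) n1 x₂
ParE-NoMark h n (tm x) = Par-NoMark h n x
ParE-NoMark h n proj = n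
ParE-NoMark h (n1 , n2) (case x x₁) = Par-NoMark (NoMarkEnv-λ h) n1 x , Par-NoMark (NoMarkEnv-λ h) n2 x₁
ParSeg-NoMark {w = w} h hw n (acc {t' = t'} x) = NoMark-applyW w t' hw (Par-NoMark h n x)
ParSeg-NoMark {w = w} h hw (n1 , (n2 , n3)) (∨seg x q q₁) =
  Par-NoMark h n1 x ,
    (ParSeg-NoMark (NoMarkEnv-λ h) (NoMarkW-λ w hw) n2 q , ParSeg-NoMark (NoMarkEnv-λ h) (NoMarkW-λ w hw) n3 q₁)
ParSeg-NoMark {w = w} h hw n (⊥seg x) = Par-NoMark (NoMarkEnv-μ (λ { w' refl → NoMarkW-μ w hw }) h) n x
ParSeg-NoMark {w = w} h hw (n1 , (n2 , n3)) (ωseg {i = i} {V' = V'} {u₁ = u₁} {u₂ = u₂} {u' = u'} x x₁ q) =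
  AllMarks-[] u' V' (ParSeg-NoMark (NoMarkEnv-λ h) (NoMarkW-λ w hw) (NoMark-sel i u₁ u₂ n2 n3) q) (Par-NoMark h n1 x₁)
ParSeg-NoMark {w = w} h hw (n1 , (n2 , n3)) (nest x q q₁ q₂) =
  ParSeg-NoMark h
    (ParSeg-NoMark (NoMarkEnv-λ h) (NoMarkW-λ w hw) n2 q , ParSeg-NoMark (NoMarkEnv-λ h) (NoMarkW-λ w hw) n3 q₁) n1 q₂

data LabelledAt (Ψ : Env) (B : ℕ) : Maybe Wrap → Maybe (Maybe ℕ) → Set where
  unlabelled : LabelledAt Ψ B nothing nothing
  label : ∀ {w j} → Ψ j ≡ just w → j < B → LabelledAt Ψ B (just w) (just (just j))

record Labelled (Γ : Env) (Λ : LayerEnv) (Ψ : Env) (B : ℕ) : Set where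
  constructor labelled
  field labelledAt : ∀ a → LabelledAt Ψ B (Γ a) (Λ a)
open Labelled

LabelledAt-λ : ∀ {Ψ B g l} → LabelledAt Ψ B g l → LabelledAt (mapλ Ψ) B (mmap wλ g) l
LabelledAt-λ unlabelled = unlabelled
LabelledAt-λ (label e lt) = label (cong (mmap wλ) e) lt

LabelledAt-μ : ∀ {Ψ B g l} → LabelledAt Ψ B g l → LabelledAt (mapμ Ψ) B (mmap wμ g) l
LabelledAt-μ unlabelled = unlabelled
LabelledAt-μ (label e lt) = label (cong (mmap wμ) e) lt

Labelled-λ : ∀ {Γ Λ Ψ B} → Labelled Γ Λ Ψ B → Labelled (mapλ Γ) Λ (mapλ Ψ) B
labelledAt (Labelled-λ c) a = LabelledAt-λ (labelledAt c a)

Labelled-μ : ∀ {Γ Λ Ψ B x y} → LabelledAt (mapμ Ψ) B x y → Labelled Γ Λ Ψ B → Labelled (consμ x Γ) (consL y Λ) (mapμ Ψ) B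
labelledAt (Labelled-μ c0 c) zero = c0
labelledAt (Labelled-μ c0 c) (suc a) = LabelledAt-μ (labelledAt c a)

Labelled-empty : Labelled ∅ ∅ ∅ 0
labelledAt Labelled-empty a = unlabelled

LabelledAt-update : ∀ {Ψ B g l} w → LabelledAt Ψ B g l → LabelledAt (update Ψ B w) (suc B) g l
LabelledAt-update w unlabelled = unlabelled
LabelledAt-update {Ψ} w (label e lt) = label (trans (update-≢ Ψ w (<⇒≢ lt)) e) (m<n⇒m<1+n lt)

Labelled-update : ∀ {Γ Λ Ψ B} w → Labelled Γ Λ Ψ B → Labelled Γ Λ (update Ψ B w) (suc B)
labelledAt (Labelled-update w c) a = LabelledAt-update w (labelledAt c a)

LabelledAt-nothing : ∀ {Ψ B g l} → LabelledAt Ψ B g l → g ≡ nothing → l ≡ nothing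
LabelledAt-nothing unlabelled e = refl
LabelledAt-nothing (label _ _) ()

LabelledAt-just : ∀ {Ψ B g l w} → LabelledAt Ψ B g l → g ≡ just w → Σ ℕ λ j → l ≡ just (just j) × Ψ j ≡ just w × j < B
LabelledAt-just (label e lt) refl = _ , refl , e , lt

LabelledAt-live : ∀ {Ψ B g l} → LabelledAt Ψ B g l → l ≡ just nothing → ⊥
LabelledAt-live unlabelled ()
LabelledAt-live (label _ _) ()

Labelled-NoDeadLayer : ∀ {Γ Λ Ψ B} → Labelled Γ Λ Ψ B → NoDeadLayer Λ
Labelled-NoDeadLayer c a e = LabelledAt-live (labelledAt c a) e

LabelsBelow : LayerEnv → ℕ → Set
LabelsBelow Λ B = ∀ a j → Λ a ≡ just (just j) → j < B

LabelledAt-below : ∀ {Ψ B g l j} → LabelledAt Ψ B g l → l ≡ just (just j) → j < B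
LabelledAt-below (label _ lt) refl = lt

Labelled-below : ∀ {Γ Λ Ψ B} → Labelled Γ Λ Ψ B → LabelsBelow Λ B
Labelled-below c a j e = LabelledAt-below (labelledAt c a) e

LabelsBelow-consL : ∀ {Λ B} → LabelsBelow Λ B → LabelsBelow (consL nothing Λ) B
LabelsBelow-consL h zero j ()
LabelsBelow-consL h (suc a) j e = h a j e

LabelsBelow-consL-just : ∀ {Λ B ml} → (∀ j → ml ≡ just j → j < B) → LabelsBelow Λ B → LabelsBelow (consL (just ml) Λ) B
LabelsBelow-consL-just hm h zero j refl = hm j refl
LabelsBelow-consL-just hm h (suc a) j e = h a j e

Layered-marks< : ∀ {mx Λ y ŷ B} → LabelsBelow Λ B → Layered mx Λ y ŷ → AllMarks (λ j → j < B) ŷ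
LayeredE-marks< : ∀ {mx Λ y ŷ B} → LabelsBelow Λ B → LayeredE mx Λ y ŷ → AllMarksE (λ j → j < B) ŷ
LayeredSucc-marks< : ∀ {mx Λ ml y ŷ B} → LabelsBelow Λ B → (∀ j → ml ≡ just j → j < B) → LayeredSucc mx Λ ml y ŷ
  → AllMarks (λ j → j < B) ŷ
Layered-marks< h rvar = tt
Layered-marks< h (rlam r) = Layered-marks< h r
Layered-marks< h (rapp r x) = Layered-marks< h r , LayeredE-marks< h x
Layered-marks< h (rpair r r₁) = Layered-marks< h r , Layered-marks< h r₁
Layered-marks< h (rinj r) = Layered-marks< h r
Layered-marks< h (rmu r) = Layered-marks< (LabelsBelow-consL h) r
Layered-marks< h (rthr∉ x r) = Layered-marks< h r
Layered-marks< {Λ = Λ} h (rthr∈ {a = a} {ml = ml} x x₁) = LayeredSucc-marks< h hm x₁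
  where
  hm : ∀ j → ml ≡ just j → _
  hm j refl = h a j x
LayeredE-marks< h (rtm x) = Layered-marks< h x
LayeredE-marks< h rproj = tt
LayeredE-marks< h (rcase x x₁) = Layered-marks< h x , Layered-marks< h x₁
LayeredSucc-marks< h hm (rel (relor x x₁ x₂)) = Layered-marks< h x ,
  (LayeredSucc-marks< h hm x₁ , LayeredSucc-marks< h hm x₂)
LayeredSucc-marks< h hm (rel (relbot x)) = Layered-marks< (LabelsBelow-consL-just hm h) x
LayeredSucc-marks< h hm (racc e f x) = hm _ e , Layered-marks< h x

dropLabel-below : ∀ {Λ B} → LabelsBelow Λ B → dropLabel B Λ ≗ Λ
dropLabel-below {Λ} {B} h a with Λ a in eq
... | nothing = refl
... | just nothing = refl
... | just (just j) with j ≟ B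
...   | yes refl = ⊥-elim (<⇒≢ (h a j eq) refl)
...   | no _ = refl

layerOf-below : ∀ {Λ B} → LabelsBelow Λ B → ∀ a → layerOf B Λ a ≡ noneᵇ a
layerOf-below {Λ} {B} h a with Λ a in eq
... | nothing = refl
... | just nothing = refl
... | just (just j) with j ≟ B
...   | yes refl = ⊥-elim (<⇒≢ (h a j eq) refl)
...   | no _ = refl

record FreshLayer (Λ : LayerEnv) (B : ℕ) (s s̃ : Tm) : Set where
  field
    layered : Layered false Λ s (erase B s̃)
    segTree : SegTree B (erase B s̃) s̃
    bounded : bound (erase B s̃) ≤ B

freshLayer : ∀ {Λ B s s̃} → LabelsBelow Λ B → LayeredElem false Λ (just B) s s̃ → FreshLayer Λ B s s̃
freshLayer {Λ} {B} {s} {s̃} h r = record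
  { layered = r'
  ; segTree = MkElem-≗ (layerOf-below h) (LayeredElem-MkElem B r)
  ; bounded = AllMarks<⇒bound≤ (erase B s̃) (Layered-marks< h r') }
  where
  r' : Layered false Λ s (erase B s̃)
  r' = Layered-≗ (dropLabel-below h) (LayeredElem-erase-≡ B r)

NotAcc : ∀ {Γ w y z} → ParSeg Γ w y z → Set
NotAcc (acc _) = ⊥
NotAcc _ = ⊤

data AccView {Γ w} : ∀ {y z} → ParSeg Γ w y z → Set where
  acc  : ∀ {t t'} (q : Par Γ t t') → AccView (acc q)
  node : ∀ {y z} {qs : ParSeg Γ w y z} → NotAcc qs → AccView qs

accView : ∀ {Γ w y z} (qs : ParSeg Γ w y z) → AccView qs
accView (acc q) = acc q
accView (∨seg _ _ _) = node tt
accView (⊥seg _) = node tt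
accView (ωseg _ _ _) = node tt
accView (nest _ _ _ _) = node tt

record Realised (Λ : LayerEnv) (Ψ : Env) (y z : Tm) : Set where
  constructor realised
  field
    ŷ ẑ : Tm
    layered : Layered false Λ y ŷ
    reduces : ŷ ≻ ẑ
    filled : fillAll Ψ ẑ ≡ z

record RealisedE (Λ : LayerEnv) (Ψ : Env) (y z : El) : Set where
  constructor realisedE
  field
    ŷ ẑ : El
    layered : LayeredE false Λ y ŷ
    reduces : ŷ ≻ₑ ẑ
    filled : fillAllE Ψ ẑ ≡ z

record RealisedSucc (Λ : LayerEnv) (Ψ : Env) (j : ℕ) (y z : Tm) : Set where
  constructor realisedSucc
  field
    ŷ ẑ : Tm
    layered : LayeredSucc false Λ (just j) y ŷ
    reduces : ŷ ≻ ẑ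
    filled : fillAll Ψ ẑ ≡ z

record RealisedElem (Λ : LayerEnv) (Ψ : Env) (j : ℕ) (y z : Tm) : Set where
  constructor realisedElem
  field
    ŷ ẑ : Tm
    layered : LayeredElem false Λ (just j) y ŷ
    reduces : ŷ ≻ ẑ
    filled : fillAll Ψ ẑ ≡ z

Par⇒≻ : ∀ {Γ Λ Ψ B y z} → Labelled Γ Λ Ψ B → NoMark y → Par Γ y z → Realised Λ Ψ y z
ParE⇒≻ₑ : ∀ {Γ Λ Ψ B y z} → Labelled Γ Λ Ψ B → NoMarkE y → ParE Γ y z → RealisedE Λ Ψ y z
ParSeg⇒≻ : ∀ {Γ Λ Ψ B w j y z} → Labelled Γ Λ Ψ B → Ψ j ≡ just w → j < B → NoMark y → ParSeg Γ w y z → RealisedSucc Λ Ψ j y z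
ParSeg⇒≻-λ : ∀ {Γ Λ Ψ B w j y z} → Labelled Γ Λ Ψ B → Ψ j ≡ just w → j < B → NoMark y →
  ParSeg (mapλ Γ) (wλ w) y z → RealisedSucc Λ (mapλ Ψ) j y z
ParSegElem⇒≻ : ∀ {Γ Λ Ψ B w j y z} → Labelled Γ Λ Ψ B → Ψ j ≡ just w → j < B → NoMark y → (qs : ParSeg Γ w y z) → NotAcc qs
  → RealisedElem Λ Ψ j y z

realise-segV : ∀ {Λ Ψ B V V̂ V̂' s z} → LabelsBelow Λ B → Value V → Layered false Λ V V̂ → V̂ ≻ V̂' →
        RealisedElem Λ (update Ψ B (wl (fillAll Ψ V̂'))) B s z → Realised Λ Ψ (app V (tm s)) z
realise-segV {Ψ = Ψ} {B} {V̂' = V̂'} h v rV dV (realisedElem s̃ ẑs r ds es) =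
  realised (app _ (tm (erase B s̃))) (fill B (wl V̂') ẑs) (rapp rV (rtm layered))
      (segV (Layered-Value rV v) dV bounded segTree ds)
        (trans (fillAll-fill Ψ B (wl V̂') ẑs) es)
  where open FreshLayer (freshLayer h r)

realise-segE : ∀ {Λ Ψ B t e ê ê' z} → LabelsBelow Λ B → LayeredE false Λ e ê → ê ≻ₑ ê' →
        RealisedElem Λ (update Ψ B (wr (fillAllE Ψ ê'))) B t z → Realised Λ Ψ (app t e) z
realise-segE {Ψ = Ψ} {B} {ê' = ê'} h re de (realisedElem t̃ ẑs r ds es) =
  realised (app (erase B t̃) _) (fill B (wr ê') ẑs) (rapp layered re)
      (segE de bounded segTree ds) (trans (fillAll-fill Ψ B (wr ê') ẑs) es)
  where open FreshLayer (freshLayer h r)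

realise-nest : ∀ {Λ Ψ B j s u v û v̂ û' v̂' z} → LabelsBelow Λ B → LayeredSucc false Λ (just j) u û
  → LayeredSucc false Λ (just j) v v̂ →
      û ≻ û' → v̂ ≻ v̂' →
      RealisedElem Λ (update Ψ B (wr (fillAllE Ψ (case û' v̂')))) B s z → RealisedElem Λ Ψ j (app s (case u v)) z
realise-nest {Ψ = Ψ} {B} {û' = û'} {v̂' = v̂'} h ru rv du dv (realisedElem s̃ ẑs r ds es) =
  realisedElem (app (erase B s̃) (case _ _)) (fill B (wr (case û' v̂')) ẑs) (relor layered ru rv)
        (segE (case du dv) bounded segTree ds)
          (trans (fillAll-fill Ψ B (wr (case û' v̂')) ẑs) es)
  where open FreshLayer (freshLayer h r)

Par⇒≻-segV : ∀ {Γ Λ Ψ B V V' s z} → Labelled Γ Λ Ψ B → Value V → Realised Λ Ψ V V' → NoMark s →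
        (qs : ParSeg Γ (wl V') s z) → NotAcc qs → Realised Λ Ψ (app V (tm s)) z
Par⇒≻-segE : ∀ {Γ Λ Ψ B t e e' z} → Labelled Γ Λ Ψ B → RealisedE Λ Ψ e e' → NoMark t →
        (qs : ParSeg Γ (wr e') t z) → NotAcc qs → Realised Λ Ψ (app t e) z
ParSeg⇒≻-nest : ∀ {Γ Λ Ψ B j s u v u' v' z} → Labelled Γ Λ Ψ B → RealisedSucc Λ (mapλ Ψ) j u u'
  → RealisedSucc Λ (mapλ Ψ) j v v' → NoMark s →
      (qs : ParSeg Γ (wr (case u' v')) s z) → NotAcc qs → RealisedElem Λ Ψ j (app s (case u v)) z

realisedSucc-elem : ∀ {Λ Ψ j y z} → RealisedElem Λ Ψ j y z → RealisedSucc Λ Ψ j y z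
realisedSucc-elem (realisedElem ŷ ẑ r d e) = realisedSucc ŷ ẑ (rel r) d e

realise-⊥seg : ∀ {Λ Ψ s s' j} → Realised (consL (just (just j)) Λ) (mapμ Ψ) s s' → RealisedElem Λ Ψ j (mu s) (mu s')
realise-⊥seg (realised ŷ ẑ r d e) = realisedElem (mu ŷ) (mu ẑ) (relbot r) (mu d) (cong mu e)

-- B is above every label in use, so it serves as the fresh label of the segment rule.
Par⇒≻-segV {Ψ = Ψ} {B = B} c v (realised V̂ V̂' rV dV eV) ns qs na =
  realise-segV (Labelled-below c) v rV dV
    (ParSegElem⇒≻ (Labelled-update _ c) (trans (update-≡ Ψ B _) (cong (λ V → just (wl V)) eV)) (n<1+n B) ns qs na)
Par⇒≻-segE {Ψ = Ψ} {B = B} c (realisedE ê ê' re de ee) nt qs na =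
  realise-segE (Labelled-below c) re de
    (ParSegElem⇒≻ (Labelled-update _ c) (trans (update-≡ Ψ B _) (cong (λ e → just (wr e)) ee)) (n<1+n B) nt qs na)
ParSeg⇒≻-nest {Ψ = Ψ} {B = B} c (realisedSucc û û' ru du eu) (realisedSucc v̂ v̂' rv dv ev) ns qs na =
  realise-nest (Labelled-below c) ru rv du dv
    (ParSegElem⇒≻ (Labelled-update _ c) (trans (update-≡ Ψ B _) (cong (λ e → just (wr e)) (cong₂ case eu ev))) (n<1+n B) ns qs na)

Par⇒≻ c nm var = realised _ _ rvar var refl
Par⇒≻ c nm (lam q) with Par⇒≻ (Labelled-λ c) nm q
... | realised ŷ ẑ r d e = realised (lam ŷ) (lam ẑ) (rlam r) (lam d) (cong lam e)
Par⇒≻ c nm (mu q) with Par⇒≻ (Labelled-μ unlabelled c) nm q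
... | realised ŷ ẑ r d e = realised (mu ŷ) (mu ẑ) (rmu r) (mu d) (cong mu e)
Par⇒≻ c nm (thr∉ {a = a} x q) with Par⇒≻ c nm q
... | realised ŷ ẑ r d e = realised (thr a ŷ) (thr a ẑ) (rthr∉ (LabelledAt-nothing (labelledAt c a) x) r) (thr d)
  (cong (thr a) e)
Par⇒≻ c nm (thr∈ {a = a} x q) with LabelledAt-just (labelledAt c a) x
... | j , eΛ , eΨ , lt with ParSeg⇒≻ c eΨ lt nm q
...   | realisedSucc ŷ ẑ r d e = realised (thr a ŷ) (thr a ẑ) (rthr∈ eΛ r) (thr d) (cong (thr a) e)
Par⇒≻ c nm (inj {i = i} q) with Par⇒≻ c nm q
... | realised ŷ ẑ r d e = realised (inj i ŷ) (inj i ẑ) (rinj r) (inj d) (cong (inj i) e)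
Par⇒≻ c (n1 , n2) (pair q q₁) with Par⇒≻ c n1 q | Par⇒≻ c n2 q₁
... | realised ŷ ẑ r d e | realised ŷ₁ ẑ₁ r₁ d₁ e₁ = realised (pair ŷ ŷ₁) (pair ẑ ẑ₁) (rpair r r₁) (pair d d₁)
  (cong₂ pair e e₁)
Par⇒≻ c (n1 , n2) (app q x) with Par⇒≻ c n1 q | ParE⇒≻ₑ c n2 x
... | realised ŷ ẑ r d e | realisedE ŷ₁ ẑ₁ r₁ d₁ e₁ = realised (app ŷ ŷ₁) (app ẑ ẑ₁) (rapp r r₁) (app d d₁) (cong₂ app e e₁)
Par⇒≻ {Ψ = Ψ} c (n1 , n2) (β x q q₁) with Par⇒≻ (Labelled-λ c) n1 q | Par⇒≻ c n2 q₁
... | realised b̂ b̂' r d e | realised V̂ V̂' r₁ d₁ e₁ =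
  realised (app (lam b̂) (tm V̂)) (b̂' [ V̂' ]) (rapp (rlam r) (rtm r₁)) (β (Layered-Value r₁ x) d d₁)
      (trans (fillAll-[] Ψ b̂' V̂') (cong₂ _[_] e e₁))
Par⇒≻ c ((n1 , n2) , _) (π {i = ι₁} {V₂ = V₂} x x₁ q) with Par⇒≻ c n1 q | canonical (Labelled-NoDeadLayer c) V₂ n2
... | realised ŷ ẑ r d e | Ô , rO = realised (app (pair ŷ Ô) (proj ι₁)) ẑ (rapp (rpair r rO) rproj)
  (π (Layered-Value r x) (Layered-Value rO x₁) d) e
Par⇒≻ c ((n1 , n2) , _) (π {i = ι₂} {V₁ = V₁} x x₁ q) with Par⇒≻ c n2 q | canonical (Labelled-NoDeadLayer c) V₁ n1
... | realised ŷ ẑ r d e | Ô , rO = realised (app (pair Ô ŷ) (proj ι₂)) ẑ (rapp (rpair rO r) rproj)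
  (π (Layered-Value rO x) (Layered-Value r x₁) d) e
Par⇒≻ {Ψ = Ψ} c (n1 , (n2 , n3)) (ω {i = ι₁} {u₂ = u₂} x q q₁) with Par⇒≻ c n1 q | Par⇒≻ (Labelled-λ c) n2 q₁ | canonical
  (Labelled-NoDeadLayer c) u₂ n3
... | realised V̂ V̂' rV dV eV | realised û û' ru du eu | Ô , rO =
  realised (app (inj ι₁ V̂) (case û Ô)) (û' [ V̂' ]) (rapp (rinj rV) (rcase ru rO)) (ω (Layered-Value rV x) dV du)
      (trans (fillAll-[] Ψ û' V̂') (cong₂ _[_] eu eV))
Par⇒≻ {Ψ = Ψ} c (n1 , (n2 , n3)) (ω {i = ι₂} {u₁ = u₁} x q q₁) with Par⇒≻ c n1 q | Par⇒≻ (Labelled-λ c) n3 q₁ | canonical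
  (Labelled-NoDeadLayer c) u₁ n2
... | realised V̂ V̂' rV dV eV | realised û û' ru du eu | Ô , rO =
  realised (app (inj ι₂ V̂) (case Ô û)) (û' [ V̂' ]) (rapp (rinj rV) (rcase rO ru)) (ω (Layered-Value rV x) dV du)
      (trans (fillAll-[] Ψ û' V̂') (cong₂ _[_] eu eV))
Par⇒≻ c (n1 , n2) (segV x q x₁ qs) with accView qs
... | node na = Par⇒≻-segV c x (Par⇒≻ c n1 q) n2 qs na
... | acc q0 with Par⇒≻ c n1 q | Par⇒≻ c n2 q0
...   | realised V̂ V̂' rV dV eV | realised ŝ ŝ' rs ds es =
  realised (app V̂ (tm ŝ)) (app V̂' (tm ŝ')) (rapp rV (rtm rs)) (app dV (tm ds)) (cong₂ app eV (cong tm es))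
Par⇒≻ c (n1 , n2) (segE x x₁ qs) with accView qs
... | node na = Par⇒≻-segE c (ParE⇒≻ₑ c n2 x) n1 qs na
... | acc q0 with ParE⇒≻ₑ c n2 x | Par⇒≻ c n1 q0
...   | realisedE ê ê' re de ee | realised t̂ t̂' rt dt et =
  realised (app t̂ ê) (app t̂' ê') (rapp rt re) (app dt de) (cong₂ app et ee)

ParE⇒≻ₑ c nm (tm x) with Par⇒≻ c nm x
... | realised ŷ ẑ r d e = realisedE (tm ŷ) (tm ẑ) (rtm r) (tm d) (cong tm e)
ParE⇒≻ₑ c nm proj = realisedE _ _ rproj proj refl
ParE⇒≻ₑ c (n1 , n2) (case x x₁) with Par⇒≻ (Labelled-λ c) n1 x | Par⇒≻ (Labelled-λ c) n2 x₁
... | realised ŷ ẑ r d e | realised ŷ₁ ẑ₁ r₁ d₁ e₁ = realisedE (case ŷ ŷ₁) (case ẑ ẑ₁) (rcase r r₁) (case d d₁)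
  (cong₂ case e e₁)

ParSeg⇒≻ c hΨ hB nm qs with accView qs
... | node na = realisedSucc-elem (ParSegElem⇒≻ c hΨ hB nm qs na)
ParSeg⇒≻ {Ψ = Ψ} {w = w} {j = j} c hΨ hB nm (acc {t' = t'} q) | acc q with Par⇒≻ c nm q
... | realised ŷ ẑ r d e = realisedSucc (mark j ŷ) (mark j ẑ) (racc refl (λ ()) r) (mark d) eq
  where
  eq : fillMark j (Ψ j) (fillAll Ψ ẑ) ≡ applyW w t'
  eq rewrite hΨ = cong (applyW w) e

ParSegElem⇒≻ c hΨ hB nm (acc _) ()
ParSegElem⇒≻ c hΨ hB (n0 , (n1 , n2)) (∨seg q0 q1 q2) _
  with Par⇒≻ c n0 q0 | ParSeg⇒≻-λ c hΨ hB n1 q1 | ParSeg⇒≻-λ c hΨ hB n2 q2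
... | realised ŝ ŝ' rs ds es | realisedSucc û û' ru du eu | realisedSucc v̂ v̂' rv dv ev =
  realisedElem (app ŝ (case û v̂)) (app ŝ' (case û' v̂')) (relor rs ru rv) (app ds (case du dv))
    (cong₂ app es (cong₂ case eu ev))
ParSegElem⇒≻ c hΨ hB nm (⊥seg q) _ = realise-⊥seg (Par⇒≻ (Labelled-μ (label (cong (mmap wμ) hΨ) hB) c) nm q)
ParSegElem⇒≻ {Ψ = Ψ} {j = j} c hΨ hB (nV , (n1 , n2)) (ωseg {i = ι₁} {u₂ = u₂} x qV q) _
  with Par⇒≻ c nV qV | ParSeg⇒≻-λ c hΨ hB n1 q | canonicalSucc (Labelled-NoDeadLayer c) j u₂ n2
... | realised V̂ V̂' rV dV eV | realisedSucc û û' ru du eu | Ô , rO =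
  realisedElem (app (inj ι₁ V̂) (case û Ô)) (û' [ V̂' ]) (relor (rinj rV) ru rO) (ω (Layered-Value rV x) dV du)
    (trans (fillAll-[] Ψ û' V̂') (cong₂ _[_] eu eV))
ParSegElem⇒≻ {Ψ = Ψ} {j = j} c hΨ hB (nV , (n1 , n2)) (ωseg {i = ι₂} {u₁ = u₁} x qV q) _
  with Par⇒≻ c nV qV | ParSeg⇒≻-λ c hΨ hB n2 q | canonicalSucc (Labelled-NoDeadLayer c) j u₁ n1
... | realised V̂ V̂' rV dV eV | realisedSucc û û' ru du eu | Ô , rO =
  realisedElem (app (inj ι₂ V̂) (case Ô û)) (û' [ V̂' ]) (relor (rinj rV) rO ru) (ω (Layered-Value rV x) dV du)
    (trans (fillAll-[] Ψ û' V̂') (cong₂ _[_] eu eV))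
ParSegElem⇒≻ c hΨ hB (ns , (n1 , n2)) (nest x q1 q2 qs) _ with accView qs
... | node na = ParSeg⇒≻-nest c (ParSeg⇒≻-λ c hΨ hB n1 q1) (ParSeg⇒≻-λ c hΨ hB n2 q2) ns qs na
... | acc q0 with ParSeg⇒≻-λ c hΨ hB n1 q1 | ParSeg⇒≻-λ c hΨ hB n2 q2 | Par⇒≻ c ns q0
...   | realisedSucc û û' ru du eu | realisedSucc v̂ v̂' rv dv ev | realised ŝ ŝ' rs ds es =
  realisedElem (app ŝ (case û v̂)) (app ŝ' (case û' v̂')) (relor rs ru rv) (app ds (case du dv))
    (cong₂ app es (cong₂ case eu ev))

ParSeg⇒≻-λ c hΨ hB = ParSeg⇒≻ (Labelled-λ c) (cong (mmap wλ) hΨ) hB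

Par⇒≻-closed : ∀ {t t'} → NoMark t → Par ∅ t t' → t ≻ t'
Par⇒≻-closed nm q with Par⇒≻ Labelled-empty nm q
... | realised t̂ t̂' r d e =
  subst₂ _≻_ (Layered-empty (λ _ → refl) r) (trans (sym (fillAll-empty (λ _ → refl) t̂')) e) d

-- The complete development computes develop

1≤size : ∀ t → 1 ≤ size t
1≤size (var x) = s≤s z≤n
1≤size (lam t) = s≤s z≤n
1≤size (app t x) = s≤s z≤n
1≤size (pair t t₁) = s≤s z≤n
1≤size (inj x t) = s≤s z≤n
1≤size (mu t) = s≤s z≤n
1≤size (thr x t) = s≤s z≤n
1≤size (mark x t) = 1≤size t

size≰0 : ∀ {A : Set} t → size t ≤ 0 → A
size≰0 t le with ≤-trans (1≤size t) le
... | ()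

1+m+n≤1+o⇒m≤o : ∀ {m n o} → suc (m + n) ≤ suc o → m ≤ o
1+m+n≤1+o⇒m≤o {m} le = m+n≤o⇒m≤o m (s≤s⁻¹ le)
1+m+n≤1+o⇒n≤o : ∀ {m n o} → suc (m + n) ≤ suc o → n ≤ o
1+m+n≤1+o⇒n≤o {m} le = m+n≤o⇒n≤o m (s≤s⁻¹ le)
1+m+n≤o⇒m≤o : ∀ {m n o} → suc (m + n) ≤ o → m ≤ o
1+m+n≤o⇒m≤o {m} le = m+n≤o⇒m≤o m (<⇒≤ le)
1+m+n≤o⇒n≤o : ∀ {m n o} → suc (m + n) ≤ o → n ≤ o
1+m+n≤o⇒n≤o {m} le = m+n≤o⇒n≤o m (<⇒≤ le)

isSeg⇒SegTerm : ∀ {t} → isSeg t ≡ true → SegTerm t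
isSeg⇒SegTerm {app t (case x x₁)} e = ∨ₛ
isSeg⇒SegTerm {mu t} e = ⊥ₛ
isSeg⇒SegTerm {var x} ()
isSeg⇒SegTerm {lam t} ()
isSeg⇒SegTerm {app t (tm x)} ()
isSeg⇒SegTerm {app t (proj x)} ()
isSeg⇒SegTerm {pair t t₁} ()
isSeg⇒SegTerm {inj x t} ()
isSeg⇒SegTerm {thr x t} ()
isSeg⇒SegTerm {mark x t} ()

maxSegTree≡mmSucc : ∀ k {t} → SegTerm t → maxSegTree k t ≡ mmSucc k noneᵇ t
maxSegTree≡mmSucc k ∨ₛ = refl
maxSegTree≡mmSucc k ⊥ₛ = refl

developSeg-acc : ∀ G w x → isSeg x ≡ false → developSeg G w x ≡ applyW w (develop G x)
developSeg-acc G w (var x) e = refl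
developSeg-acc G w (lam x) e = refl
developSeg-acc G w (app x (tm x₁)) e = refl
developSeg-acc G w (app x (proj x₁)) e = refl
developSeg-acc G w (app x (case x₁ x₂)) ()
developSeg-acc G w (pair x x₁) e = refl
developSeg-acc G w (inj x x₁) e = refl
developSeg-acc G w (mu x) ()
developSeg-acc G w (thr x x₁) e = refl
developSeg-acc G w (mark x x₁) e = refl

fillAll-acceptor : ∀ Ψ G j w x Y → Ψ j ≡ just w → isSeg x ≡ false → fillAll Ψ Y ≡ develop G x →
        fillAll Ψ (mark j Y) ≡ developSeg G w x
fillAll-acceptor Ψ G j w x Y e f h rewrite e = trans (cong (applyW w) h) (sym (developSeg-acc G w x f))

fillAll-dev : ∀ {G Λ Ψ x x̂} n → Consistent G Λ Ψ → Layered true Λ x x̂ → size x ≤ n → fillAll Ψ (dev n x̂) ≡ develop G x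
fillAllE-devE : ∀ {G Λ Ψ e ê} n → Consistent G Λ Ψ → LayeredE true Λ e ê → sizeE e ≤ n → fillAllE Ψ (devE n ê) ≡ developE G e
fillAll-devSeg : ∀ {G Λ Ψ ml w x x̂} n → Consistent G Λ Ψ → LabelWraps Ψ ml w → LayeredSucc true Λ ml x x̂ → size x ≤ n →
      fillAll Ψ (dev n x̂) ≡ developSeg G w x
fillAll-devApp : ∀ {G Λ Ψ t t̂ e ê} m → Consistent G Λ Ψ → Layered true Λ t t̂ → LayeredE true Λ e ê → size t ≤ m
  → sizeE e ≤ m →
        fillAll Ψ (devApp m t̂ ê) ≡ developApp G t e
fillAll-devDef : ∀ {G Λ Ψ t t̂ e ê} m → Consistent G Λ Ψ → Layered true Λ t t̂ → LayeredE true Λ e ê → size t ≤ m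
  → sizeE e ≤ m →
        fillAll Ψ (devDef m t̂ ê) ≡ developDef G t e
fillAll-devSegE : ∀ {G Λ Ψ t t̂ e ê} m → Consistent G Λ Ψ → Layered true Λ t t̂ → LayeredE true Λ e ê → size t ≤ m
  → sizeE e ≤ m →
        fillAll Ψ (devSegE m t̂ ê) ≡ developSegE G t e
fillAll-devNode : ∀ {G Λ Ψ ml w s ŝ u û v v̂} m → Consistent G Λ Ψ → LabelWraps Ψ ml w →
        Layered true Λ s ŝ → LayeredSucc true Λ ml u û → LayeredSucc true Λ ml v v̂ → size s ≤ m → size u ≤ m → size v ≤ m →
        fillAll Ψ (devApp m ŝ (case û v̂)) ≡ developNode G w s u v
fillAll-devNodeDef : ∀ {G Λ Ψ ml w s ŝ u û v v̂} m → Consistent G Λ Ψ → LabelWraps Ψ ml w →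
        Layered true Λ s ŝ → LayeredSucc true Λ ml u û → LayeredSucc true Λ ml v v̂ → size s ≤ m → size u ≤ m → size v ≤ m →
        fillAll Ψ (devSegE m ŝ (case û v̂)) ≡ developNodeDef G w s u v
fillAll-devSegTree : ∀ {G Λ Ψ s ŝ W Ŵ} m → Consistent G Λ Ψ → Layered true Λ s ŝ → SegTerm s → fillAllW Ψ Ŵ ≡ W → size s ≤ m
       → fillAll Ψ (fill (bound ŝ) Ŵ (dev m (maxSegTree (bound ŝ) ŝ))) ≡ developSeg G W s

fillAll-dev {x = x} zero c r le = size≰0 x le
fillAll-dev (suc m) c rvar le = refl
fillAll-dev (suc m) c (rlam r) le = cong lam (fillAll-dev m (Consistent-λ c) r (s≤s⁻¹ le))
fillAll-dev (suc m) c (rapp r x) le = fillAll-devApp m c r x (1+m+n≤1+o⇒m≤o le) (1+m+n≤1+o⇒n≤o le)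
fillAll-dev (suc m) c (rpair r r₁) le = cong₂ pair (fillAll-dev m c r (1+m+n≤1+o⇒m≤o le))
  (fillAll-dev m c r₁ (1+m+n≤1+o⇒n≤o le))
fillAll-dev (suc m) c (rinj {i = i} r) le = cong (inj i) (fillAll-dev m c r (s≤s⁻¹ le))
fillAll-dev (suc m) c (rmu r) le = cong mu (fillAll-dev m (Consistent-μ cN c) r (s≤s⁻¹ le))
fillAll-dev (suc m) c (rthr∉ {a = a} x r) le rewrite ConsistentAt-nothing (consistentAt c a) x =
  cong (thr a) (fillAll-dev m c r (s≤s⁻¹ le))
fillAll-dev {G = G} (suc m) c (rthr∈ {a = a} x x₁) le with ConsistentAt-just (consistentAt c a) x
... | w , eg , hj rewrite eg = cong (thr a) (fillAll-devSeg m c hj x₁ (s≤s⁻¹ le))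

fillAllE-devE n c (rtm x) le = cong tm (fillAll-dev n c x (<⇒≤ le))
fillAllE-devE n c rproj le = refl
fillAllE-devE n c (rcase x x₁) le = cong₂ case (fillAll-dev n (Consistent-λ c) x (1+m+n≤o⇒m≤o le))
  (fillAll-dev n (Consistent-λ c) x₁ (1+m+n≤o⇒n≤o le))

fillAll-devSeg {x = x} zero c hj r le = size≰0 x le
fillAll-devSeg {G = G} {Ψ = Ψ} {w = w} {x = x} (suc m) c hj (racc {j = j} {t̂ = t̂} refl f r) le =
  fillAll-acceptor Ψ G j w x (dev (suc m) t̂) (hj j refl) (f refl) (fillAll-dev (suc m) c r le)
fillAll-devSeg (suc m) c hj (rel (relor x x₁ x₂)) le =
  fillAll-devNode m c hj x x₁ x₂ (1+m+n≤1+o⇒m≤o le) (1+m+n≤o⇒m≤o (1+m+n≤1+o⇒n≤o le)) (1+m+n≤o⇒n≤o (1+m+n≤1+o⇒n≤o le))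
fillAll-devSeg (suc m) c hj (rel (relbot x)) le = cong mu (fillAll-dev m (Consistent-μ (ConsistentAt-wμ hj) c) x (s≤s⁻¹ le))

fillAll-devSegTree {G = G} {Λ = Λ} {Ψ = Ψ} {s = s} {ŝ = ŝ} {W = W} {Ŵ = Ŵ} m c rs el eW ls = begin
  fillAll Ψ (fill k Ŵ (dev m (maxSegTree k ŝ)))   ≡⟨ fillAll-fill Ψ k Ŵ (dev m (maxSegTree k ŝ)) ⟩
  fillAll Ψ' (dev m (maxSegTree k ŝ))             ≡⟨ cong (fillAll Ψ' ∘ dev m) (maxSegTree≡mmSucc k (Layered-SegTerm rs el)) ⟩
  fillAll Ψ' (dev m (mmSucc k noneᵇ ŝ))           ≡⟨ fillAll-devSeg m (Consistent-kill k (fillAllW Ψ Ŵ) c) k-wraps rs' ls ⟩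
  developSeg G W s                                ∎
  where
  open ≡-Reasoning
  k : ℕ
  k = bound ŝ
  Ψ' : Env
  Ψ' = update Ψ k (fillAllW Ψ Ŵ)
  k-wraps : LabelWraps Ψ' (just k) W
  k-wraps j refl = trans (update-≡ Ψ k _) (cong just eW)
  rs' : LayeredSucc true (kill k Λ) (just k) s (mmSucc k noneᵇ ŝ)
  rs' = Layered-mmSucc k noneᵇ (Layered-kill k rs (bound≤⇒Avoids ŝ ≤-refl)) (Disjoint-none (kill k Λ))

fillAll-devApp {Ψ = Ψ} m c (rlam {t̂ = b̂} rb) (rtm {t = V} {t̂ = V̂} rV) lt le rewrite Layered-isValue rV with isValue V
... | true = trans (fillAll-[] Ψ (dev m b̂) (dev m V̂))
  (cong₂ _[_] (fillAll-dev m (Consistent-λ c) rb (<⇒≤ lt)) (fillAll-dev m c rV (<⇒≤ le)))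
... | false = fillAll-devDef m c (rlam rb) (rtm rV) lt le
fillAll-devApp m c (rpair {t = V₁} {u = V₂} r₁ r₂) (rproj {i = ι₁}) lt le rewrite Layered-isValue r₁ | Layered-isValue r₂
  with isValue V₁ ∧ isValue V₂
... | true = fillAll-dev m c r₁ (1+m+n≤o⇒m≤o lt)
... | false = fillAll-devDef m c (rpair r₁ r₂) rproj lt le
fillAll-devApp m c (rpair {t = V₁} {u = V₂} r₁ r₂) (rproj {i = ι₂}) lt le rewrite Layered-isValue r₁ | Layered-isValue r₂
  with isValue V₁ ∧ isValue V₂
... | true = fillAll-dev m c r₂ (1+m+n≤o⇒n≤o lt)
... | false = fillAll-devDef m c (rpair r₁ r₂) rproj lt le
fillAll-devApp {Ψ = Ψ} m c (rinj {i = ι₁} {t = V} {t̂ = V̂} rV) (rcase {û = û} r₁ r₂) lt le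
  rewrite Layered-isValue rV with isValue V
... | true = trans (fillAll-[] Ψ (dev m û) (dev m V̂))
  (cong₂ _[_] (fillAll-dev m (Consistent-λ c) r₁ (1+m+n≤o⇒m≤o le)) (fillAll-dev m c rV (<⇒≤ lt)))
... | false = fillAll-devDef m c (rinj rV) (rcase r₁ r₂) lt le
fillAll-devApp {Ψ = Ψ} m c (rinj {i = ι₂} {t = V} {t̂ = V̂} rV) (rcase {v̂ = v̂} r₁ r₂) lt le
  rewrite Layered-isValue rV with isValue V
... | true = trans (fillAll-[] Ψ (dev m v̂) (dev m V̂))
  (cong₂ _[_] (fillAll-dev m (Consistent-λ c) r₂ (1+m+n≤o⇒n≤o le)) (fillAll-dev m c rV (<⇒≤ lt)))
... | false = fillAll-devDef m c (rinj rV) (rcase r₁ r₂) lt le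
fillAll-devApp m c r@rvar re@(rtm _) lt le = fillAll-devDef m c r re lt le
fillAll-devApp m c r@rvar re@rproj lt le = fillAll-devDef m c r re lt le
fillAll-devApp m c r@rvar re@(rcase _ _) lt le = fillAll-devDef m c r re lt le
fillAll-devApp m c r@(rlam _) re@rproj lt le = fillAll-devDef m c r re lt le
fillAll-devApp m c r@(rlam _) re@(rcase _ _) lt le = fillAll-devDef m c r re lt le
fillAll-devApp m c r@(rapp _ _) re@(rtm _) lt le = fillAll-devDef m c r re lt le
fillAll-devApp m c r@(rapp _ _) re@rproj lt le = fillAll-devDef m c r re lt le
fillAll-devApp m c r@(rapp _ _) re@(rcase _ _) lt le = fillAll-devDef m c r re lt le
fillAll-devApp m c r@(rpair _ _) re@(rtm _) lt le = fillAll-devDef m c r re lt le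
fillAll-devApp m c r@(rpair _ _) re@(rcase _ _) lt le = fillAll-devDef m c r re lt le
fillAll-devApp m c r@(rinj _) re@(rtm _) lt le = fillAll-devDef m c r re lt le
fillAll-devApp m c r@(rinj _) re@rproj lt le = fillAll-devDef m c r re lt le
fillAll-devApp m c r@(rmu _) re@(rtm _) lt le = fillAll-devDef m c r re lt le
fillAll-devApp m c r@(rmu _) re@rproj lt le = fillAll-devDef m c r re lt le
fillAll-devApp m c r@(rmu _) re@(rcase _ _) lt le = fillAll-devDef m c r re lt le
fillAll-devApp m c r@(rthr∉ _ _) re@(rtm _) lt le = fillAll-devDef m c r re lt le
fillAll-devApp m c r@(rthr∉ _ _) re@rproj lt le = fillAll-devDef m c r re lt le
fillAll-devApp m c r@(rthr∉ _ _) re@(rcase _ _) lt le = fillAll-devDef m c r re lt le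
fillAll-devApp m c r@(rthr∈ _ _) re@(rtm _) lt le = fillAll-devDef m c r re lt le
fillAll-devApp m c r@(rthr∈ _ _) re@rproj lt le = fillAll-devDef m c r re lt le
fillAll-devApp m c r@(rthr∈ _ _) re@(rcase _ _) lt le = fillAll-devDef m c r re lt le

fillAll-devDef {t = t} m c rt (rtm {t = s} rs) lt le
  rewrite Layered-isValue rt | Layered-isSeg rs with isValue t ∧ isSeg s in eq
... | true = fillAll-devSegTree m c rs (isSeg⇒SegTerm (∧-conicalʳ (isValue t) _ eq)) (cong wl (fillAll-dev m c rt lt)) (<⇒≤ le)
... | false = fillAll-devSegE m c rt (rtm rs) lt le
fillAll-devDef m c rt rproj lt le = fillAll-devSegE m c rt rproj lt le
fillAll-devDef m c rt (rcase r₁ r₂) lt le = fillAll-devSegE m c rt (rcase r₁ r₂) lt le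

fillAll-devSegE {t = t} m c rt re lt le rewrite Layered-isSeg rt with isSeg t in eq
... | true = fillAll-devSegTree m c rt (isSeg⇒SegTerm eq) (cong wr (fillAllE-devE m c re le)) lt
... | false = cong₂ app (fillAll-dev m c rt lt) (fillAllE-devE m c re le)

fillAll-devNode {Ψ = Ψ} {û = û} m c hj (rinj {i = ι₁} {t = V} {t̂ = V̂} rV) ru rv ls lu lv
  rewrite Layered-isValue rV with isValue V
... | true = trans (fillAll-[] Ψ (dev m û) (dev m V̂))
  (cong₂ _[_] (fillAll-devSeg m (Consistent-λ c) (LabelWraps-λ hj) ru lu) (fillAll-dev m c rV (<⇒≤ ls)))
... | false = fillAll-devNodeDef m c hj (rinj rV) ru rv ls lu lv
fillAll-devNode {Ψ = Ψ} {v̂ = v̂} m c hj (rinj {i = ι₂} {t = V} {t̂ = V̂} rV) ru rv ls lu lv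
  rewrite Layered-isValue rV with isValue V
... | true = trans (fillAll-[] Ψ (dev m v̂) (dev m V̂))
  (cong₂ _[_] (fillAll-devSeg m (Consistent-λ c) (LabelWraps-λ hj) rv lv) (fillAll-dev m c rV (<⇒≤ ls)))
... | false = fillAll-devNodeDef m c hj (rinj rV) ru rv ls lu lv
fillAll-devNode m c hj r@rvar ru rv ls lu lv = fillAll-devNodeDef m c hj r ru rv ls lu lv
fillAll-devNode m c hj r@(rlam _) ru rv ls lu lv = fillAll-devNodeDef m c hj r ru rv ls lu lv
fillAll-devNode m c hj r@(rapp _ _) ru rv ls lu lv = fillAll-devNodeDef m c hj r ru rv ls lu lv
fillAll-devNode m c hj r@(rpair _ _) ru rv ls lu lv = fillAll-devNodeDef m c hj r ru rv ls lu lv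
fillAll-devNode m c hj r@(rmu _) ru rv ls lu lv = fillAll-devNodeDef m c hj r ru rv ls lu lv
fillAll-devNode m c hj r@(rthr∉ _ _) ru rv ls lu lv = fillAll-devNodeDef m c hj r ru rv ls lu lv
fillAll-devNode m c hj r@(rthr∈ _ _) ru rv ls lu lv = fillAll-devNodeDef m c hj r ru rv ls lu lv

fillAll-devNodeDef {s = s} m c hj rs ru rv ls lu lv rewrite Layered-isSeg rs with isSeg s in eq
... | true = fillAll-devSegTree m c rs (isSeg⇒SegTerm eq)
  (cong wr (cong₂ case (fillAll-devSeg m (Consistent-λ c) (LabelWraps-λ hj) ru lu)
  (fillAll-devSeg m (Consistent-λ c) (LabelWraps-λ hj) rv lv))) ls
... | false = cong₂ app (fillAll-dev m c rs ls)
  (cong₂ case (fillAll-devSeg m (Consistent-λ c) (LabelWraps-λ hj) ru lu)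
  (fillAll-devSeg m (Consistent-λ c) (LabelWraps-λ hj) rv lv))

star≡develop : ∀ t → NoMark t → star t ≡ develop ∅ t
star≡develop t nm = begin
  star t                       ≡⟨ fillAll-empty (λ _ → refl) (dev (size t) t) ⟨
  fillAll ∅ (dev (size t) t)   ≡⟨ fillAll-dev (size t) Consistent-empty (Layered-refl (λ _ → refl) t nm) ≤-refl ⟩
  develop ∅ t                  ∎
  where open ≡-Reasoning

mainTheorem5 : (t t' : Tm) → bound t ≡ 0 → t ≻ t' → t' ≻ star t
mainTheorem5 t t' b t≻t' = subst (t' ≻_) (sym (star≡develop t t-unmarked)) t'≻t*
  where
  t-unmarked : NoMark t
  t-unmarked = bound≡0⇒NoMark t b

  t⇛t' : Par ∅ t t'
  t⇛t' = ≻⇒Par-closed t-unmarked t≻t'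

  t'⇛t* : Par ∅ t' (develop ∅ t)
  t'⇛t* = triangle-par Triangle-empty t⇛t'

  t'≻t* : t' ≻ develop ∅ t
  t'≻t* = Par⇒≻-closed (Par-NoMark (λ _ _ ()) t-unmarked t⇛t') t'⇛t*
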